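{- There exists an absolute constant $c>0$ such that for every positive integer $n$ there exists an $n$-element set $P\subset \mathbb{R}^2$ whose box-Delaunay graph $G=D_{\mathrm{box}}(P)$ satisfies $$\alpha(G)\leq n\,2^{ -c\sqrt{\log n}}\quad\text{and}\quad \chi(G)\geq 2^{c\sqrt{\log n}}.$$
   Context: For a finite set of points $P\subset\mathbb{R}^2$, the box-Delaunay graph $D_{\mathrm{box}}(P)$ is the graph on vertex set $P$ in which two distinct points $x,y\in P$ are joined by an edge if there exists a (closed) axis-parallel rectangle containing $x$ and $y$ but no other element of $P$. For a graph $G$, $\alpha(G)$ denotes its independence number (the maximum size of a set of pairwise non-adjacent vertices) and $\chi(G)$ its chromatic number. The base of $\log$ (any fixed base greater than $1$) is immaterial, as it only affects the constant $c$. -}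

module Defs where

open import Data.Nat as ℕ using (ℕ; zero; suc; NonZero)
import Data.Nat.Properties as ℕₚ
open import Data.Integer as ℤ using (ℤ; +_; -[1+_])
import Data.Integer.Properties as ℤₚ
open import Data.Rational as ℚ
  using (ℚ; mkℚ; 0ℚ; 1ℚ; ½; _+_; _*_; -_; _≤_; _<_; _/_; 1/_; toℚᵘ)
import Data.Rational.Properties as ℚₚ
open import Data.Rational.Solver using (module +-*-Solver)
import Data.Rational.Unnormalised as ℚᵘ
import Data.Rational.Unnormalised.Properties as ℚᵘₚ
open import Algebra.Bundles using (CommutativeRing; CommutativeSemiring)
open import Algebra.Properties.Semiring.Exp
  (CommutativeRing.semiring ℚₚ.+-*-commutativeRing)
  using (_^_; ^-homo-*; ^-assocʳ)
open import Data.Fin using (Fin)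
open import Data.Fin.Subset using (Subset; _∈_; ∣_∣)
open import Data.Product using (∃; ∃₂; _×_; _,_; proj₁; proj₂)
open import Data.Sum using (_⊎_; inj₁; inj₂; [_,_]′)
open import Data.Empty using (⊥; ⊥-elim)
open import Level using (Level)
open import Relation.Binary using (Rel; Symmetric)
open import Relation.Nullary using (¬_; yes; no)
open import Relation.Binary.PropositionalEquality

*-monoˡ : ∀ {r p q} → 0ℚ ≤ r → p ≤ q → r * p ≤ r * q
*-monoˡ {r} 0≤r = ℚₚ.*-monoˡ-≤-nonNeg r {{ℚ.nonNegative 0≤r}}

*-monoʳ : ∀ {r p q} → 0ℚ ≤ r → p ≤ q → p * r ≤ q * r
*-monoʳ {r} 0≤r = ℚₚ.*-monoʳ-≤-nonNeg r {{ℚ.nonNegative 0≤r}}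

*-mono : ∀ {p q r s} → 0ℚ ≤ p → 0ℚ ≤ s → p ≤ q → r ≤ s → p * r ≤ q * s
*-mono 0≤p 0≤s p≤q r≤s = ℚₚ.≤-trans (*-monoˡ 0≤p r≤s) (*-monoʳ 0≤s p≤q)

*-nonNeg : ∀ {p q} → 0ℚ ≤ p → 0ℚ ≤ q → 0ℚ ≤ p * q
*-nonNeg {p} {q} 0≤p 0≤q = subst (_≤ p * q) (ℚₚ.*-zeroʳ p) (*-monoˡ 0≤p 0≤q)

*-pos : ∀ {p q} → 0ℚ < p → 0ℚ < q → 0ℚ < p * q
*-pos {p} {q} 0<p 0<q =
  subst (_< p * q) (ℚₚ.*-zeroʳ p) (ℚₚ.*-monoʳ-<-pos p {{ℚ.positive 0<p}} 0<q)

≤-or-> : ∀ p q → p ≤ q ⊎ q < p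
≤-or-> p q with p ℚₚ.≤? q
... | yes p≤q = inj₁ p≤q
... | no  p≰q = inj₂ (ℚₚ.≰⇒> p≰q)

<⇒≱ : ∀ {p q} → p < q → ¬ (q ≤ p)
<⇒≱ p<q q≤p = ℚₚ.<-irrefl refl (ℚₚ.<-≤-trans p<q q≤p)

0≤1 : 0ℚ ≤ 1ℚ
0≤1 = ℚₚ.nonNegative⁻¹ 1ℚ

0<1 : 0ℚ < 1ℚ
0<1 = ℚₚ.positive⁻¹ 1ℚ

p<p+q : ∀ p {q} → 0ℚ < q → p < p + q
p<p+q p {q} 0<q = subst (_< p + q) (ℚₚ.+-identityʳ p) (ℚₚ.+-monoʳ-< p 0<q)

p≤p+q : ∀ p {q} → 0ℚ ≤ q → p ≤ p + q
p≤p+q p {q} 0≤q = subst (_≤ p + q) (ℚₚ.+-identityʳ p) (ℚₚ.+-monoʳ-≤ p 0≤q)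

p≤∣p∣ : ∀ p → p ≤ ℚ.∣ p ∣
p≤∣p∣ p with ≤-or-> 0ℚ p
... | inj₁ 0≤p = ℚₚ.≤-reflexive (sym (ℚₚ.0≤p⇒∣p∣≡p 0≤p))
... | inj₂ p<0 = ℚₚ.≤-trans (ℚₚ.<⇒≤ p<0) (ℚₚ.0≤∣p∣ p)

divide : ∀ {p r} → 0ℚ < p → 0ℚ < r → ∃ λ δ → 0ℚ < δ × δ * r ≡ p
divide {p} {r} 0<p 0<r =
  p * r⁻¹ , *-pos 0<p (ℚₚ.positive⁻¹ r⁻¹ {{ℚₚ.1/pos⇒pos r}}) ,
  trans (ℚₚ.*-assoc p r⁻¹ r) (trans (cong (p *_) (ℚₚ.*-inverseˡ r)) (ℚₚ.*-identityʳ p))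
  where
  instance
    _ = ℚ.positive 0<r
    _ = ℚₚ.pos⇒nonZero r
  r⁻¹ = 1/ r

ι : ℕ → ℚ
ι n = + n / 1

/-≤ : ∀ a m b n → a ℤ.* + suc n ℤ.≤ b ℤ.* + suc m → a / suc m ≤ b / suc n
/-≤ a m b n h = ℚₚ.toℚᵘ-cancel-≤
  (ℚᵘₚ.≤-respˡ-≃ (ℚᵘₚ.≃-sym (ℚₚ.toℚᵘ-fromℚᵘ (ℚᵘ.mkℚᵘ a m)))
  (ℚᵘₚ.≤-respʳ-≃ (ℚᵘₚ.≃-sym (ℚₚ.toℚᵘ-fromℚᵘ (ℚᵘ.mkℚᵘ b n))) (ℚᵘ.*≤* h)))

/-< : ∀ a m b n → a ℤ.* + suc n ℤ.< b ℤ.* + suc m → a / suc m < b / suc n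
/-< a m b n h = ℚₚ.toℚᵘ-cancel-<
  (ℚᵘₚ.<-respˡ-≃ (ℚᵘₚ.≃-sym (ℚₚ.toℚᵘ-fromℚᵘ (ℚᵘ.mkℚᵘ a m)))
  (ℚᵘₚ.<-respʳ-≃ (ℚᵘₚ.≃-sym (ℚₚ.toℚᵘ-fromℚᵘ (ℚᵘ.mkℚᵘ b n))) (ℚᵘ.*<* h)))

/-<⁻¹ : ∀ a m b n → a / suc m < b / suc n → a ℤ.* + suc n ℤ.< b ℤ.* + suc m
/-<⁻¹ a m b n h with ℚᵘₚ.<-respˡ-≃ (ℚₚ.toℚᵘ-fromℚᵘ (ℚᵘ.mkℚᵘ a m))
  (ℚᵘₚ.<-respʳ-≃ (ℚₚ.toℚᵘ-fromℚᵘ (ℚᵘ.mkℚᵘ b n)) (ℚₚ.toℚᵘ-mono-< h))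
... | ℚᵘ.*<* h′ = h′

ι-nonNeg : ∀ n → 0ℚ ≤ ι n
ι-nonNeg n = ℚₚ.nonNegative⁻¹ (ι n) {{ℚₚ.normalize-nonNeg n 1}}

+-/ : ∀ a b d → (a ℤ.+ b) / suc d ≡ a / suc d + b / suc d
+-/ a b d = ℚₚ.toℚᵘ-injective (begin
  toℚᵘ ((a ℤ.+ b) / suc d)               ≈⟨ ℚₚ.toℚᵘ-fromℚᵘ (ℚᵘ.mkℚᵘ (a ℤ.+ b) d) ⟩
  ℚᵘ.mkℚᵘ (a ℤ.+ b) d                    ≈⟨ ℚᵘ.*≡* eq ⟩
  ℚᵘ.mkℚᵘ a d ℚᵘ.+ ℚᵘ.mkℚᵘ b d           ≈⟨ ℚᵘₚ.+-cong (ℚₚ.toℚᵘ-fromℚᵘ (ℚᵘ.mkℚᵘ a d)) (ℚₚ.toℚᵘ-fromℚᵘ (ℚᵘ.mkℚᵘ b d)) ⟨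
  toℚᵘ (a / suc d) ℚᵘ.+ toℚᵘ (b / suc d) ≈⟨ ℚₚ.toℚᵘ-homo-+ (a / suc d) (b / suc d) ⟨
  toℚᵘ (a / suc d + b / suc d)           ∎)
  where
  open ℚᵘₚ.≃-Reasoning
  eq : (a ℤ.+ b) ℤ.* + (suc d ℕ.* suc d) ≡ (a ℤ.* + suc d ℤ.+ b ℤ.* + suc d) ℤ.* + suc d
  eq = trans (cong ((a ℤ.+ b) ℤ.*_) (ℤₚ.pos-* (suc d) (suc d)))
      (trans (sym (ℤₚ.*-assoc (a ℤ.+ b) (+ suc d) (+ suc d)))
             (cong (ℤ._* + suc d) (ℤₚ.*-distribʳ-+ (+ suc d) a b)))

ι-suc : ∀ n → ι (suc n) ≡ 1ℚ + ι n
ι-suc n = +-/ (+ 1) (+ n) 0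


x≤ι : ∀ x → x ≤ ι ℤ.∣ ℚ.↥ x ∣
x≤ι x = subst (_≤ ι ℤ.∣ ℚ.↥ x ∣) (ℚₚ.↥p/↧p≡p x)
  (/-≤ (ℚ.↥ x) (ℚ.denominator-1 x) (+ ℤ.∣ ℚ.↥ x ∣) 0 (aux (ℚ.↥ x)))
  where
  aux : ∀ i → i ℤ.* + 1 ℤ.≤ + ℤ.∣ i ∣ ℤ.* + ℚ.↧ₙ x
  aux (+ n) = subst₂ ℤ._≤_ (ℤₚ.pos-* n 1) (ℤₚ.pos-* n (ℚ.↧ₙ x))
    (ℤ.+≤+ (ℕₚ.*-monoʳ-≤ n (ℕ.s≤s ℕ.z≤n)))
  aux -[1+ n ] = ℤ.-≤+

archimedean : ∀ {d} → 0ℚ < d → ∀ x → ∃ λ N → x ≤ ι N * d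
archimedean {d} 0<d x with ≤-or-> x 0ℚ
... | inj₁ x≤0 = 0 , subst (x ≤_) (sym (ℚₚ.*-zeroˡ d)) x≤0
... | inj₂ 0<x with divide 0<x 0<d
... | δ , _ , δd≡x = ℤ.∣ ℚ.↥ δ ∣ ,
  subst (_≤ ι ℤ.∣ ℚ.↥ δ ∣ * d) δd≡x (*-monoʳ (ℚₚ.<⇒≤ 0<d) (x≤ι δ))

^-nonNeg : ∀ {x} n → 0ℚ ≤ x → 0ℚ ≤ x ^ n
^-nonNeg zero    0≤x = 0≤1
^-nonNeg (suc n) 0≤x = *-nonNeg 0≤x (^-nonNeg n 0≤x)

^-pos : ∀ {x} n → 0ℚ < x → 0ℚ < x ^ n
^-pos zero    0<x = 0<1
^-pos (suc n) 0<x = *-pos 0<x (^-pos n 0<x)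

^-mono : ∀ {x y} n → 0ℚ ≤ x → x ≤ y → x ^ n ≤ y ^ n
^-mono zero    0≤x x≤y = ℚₚ.≤-refl
^-mono (suc n) 0≤x x≤y =
  *-mono 0≤x (^-nonNeg n (ℚₚ.≤-trans 0≤x x≤y)) x≤y (^-mono n 0≤x x≤y)

^-cancel : ∀ {x y} n → 0ℚ ≤ y → x ^ suc n ≤ y ^ suc n → x ≤ y
^-cancel {x} {y} n 0≤y h with ≤-or-> x y
... | inj₁ x≤y = x≤y
... | inj₂ y<x = ⊥-elim (<⇒≱ y^<x^ h)
  where
  0<x = ℚₚ.≤-<-trans 0≤y y<x
  y^<x^ : y ^ suc n < x ^ suc n
  y^<x^ = ℚₚ.≤-<-trans (*-monoˡ 0≤y (^-mono n 0≤y (ℚₚ.<⇒≤ y<x)))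
    (ℚₚ.*-monoˡ-<-pos (x ^ n) {{ℚ.positive (^-pos n 0<x)}} y<x)

bernoulli : ∀ {y d} → 0ℚ < y → 0ℚ ≤ d → ∀ m →
  y ^ m * (y + ι m * d) ≤ (y + d) ^ m * y
bernoulli {y} {d} 0<y 0≤d zero = ℚₚ.≤-reflexive
  (solve 2 (λ y d → con 1ℚ :* (y :+ con 0ℚ :* d) := con 1ℚ :* y) refl y d)
  where open +-*-Solver
bernoulli {y} {d} 0<y 0≤d (suc m) = begin
  (y * y ^ m) * (y + ι (suc m) * d)
    ≡⟨ cong (λ t → (y * y ^ m) * (y + t * d)) (ι-suc m) ⟩
  (y * y ^ m) * (y + (1ℚ + ι m) * d)
    ≤⟨ p≤p+q _ (*-nonNeg (^-nonNeg m 0≤y) (*-nonNeg (ι-nonNeg m) (*-nonNeg 0≤d 0≤d))) ⟩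
  (y * y ^ m) * (y + (1ℚ + ι m) * d) + y ^ m * (ι m * (d * d))
    ≡⟨ solve 4 (λ y d i e → (y :* e) :* (y :+ (con 1ℚ :+ i) :* d) :+ e :* (i :* (d :* d))
                  := (y :+ d) :* (e :* (y :+ i :* d))) refl y d (ι m) (y ^ m) ⟩
  (y + d) * (y ^ m * (y + ι m * d))
    ≤⟨ *-monoˡ (ℚₚ.≤-trans 0≤y (p≤p+q y 0≤d)) (bernoulli 0<y 0≤d m) ⟩
  (y + d) * ((y + d) ^ m * y)
    ≡⟨ ℚₚ.*-assoc (y + d) ((y + d) ^ m) y ⟨
  (y + d) ^ suc m * y ∎
  where
  open ℚₚ.≤-Reasoning
  open +-*-Solver
  0≤y = ℚₚ.<⇒≤ 0<y

2ℚ : ℚ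
2ℚ = + 2 / 1

0<2 : 0ℚ < 2ℚ
0<2 = ℚₚ.positive⁻¹ 2ℚ

0≤2 : 0ℚ ≤ 2ℚ
0≤2 = ℚₚ.<⇒≤ 0<2

double : ∀ x → 2ℚ * x ≡ x + x
double = solve 1 (λ x → con 2ℚ :* x := x :+ x) refl
  where open +-*-Solver

growth-gap : ∀ {y z} → 0ℚ < y → y < z → ∃ λ m → (2ℚ * 2ℚ) * y ^ suc m ≤ z ^ suc m
growth-gap {y} {z} 0<y y<z = N ,
  ℚₚ.*-cancelʳ-≤-pos y {{ℚ.positive 0<y}} (begin
    ((2ℚ * 2ℚ) * y ^ suc N) * y
      ≡⟨ solve 2 (λ y e → ((con 2ℚ :* con 2ℚ) :* e) :* y
           := e :* (y :+ (con 3ℚ :* y))) refl y (y ^ suc N) ⟩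
    y ^ suc N * (y + 3ℚ * y)
      ≤⟨ *-monoˡ (^-nonNeg (suc N) 0≤y) (ℚₚ.+-monoʳ-≤ y 3y≤) ⟩
    y ^ suc N * (y + ι (suc N) * d)
      ≤⟨ bernoulli 0<y (ℚₚ.<⇒≤ 0<d) (suc N) ⟩
    (y + d) ^ suc N * y
      ≡⟨ cong (λ t → t ^ suc N * y) (solve 2 (λ y z → y :+ (z :- y) := z) refl y z) ⟩
    z ^ suc N * y ∎)
  where
  open ℚₚ.≤-Reasoning
  open +-*-Solver
  0≤y = ℚₚ.<⇒≤ 0<y
  3ℚ = + 3 / 1
  d = z ℚ.- y
  0<d : 0ℚ < d
  0<d = subst (_< d) (ℚₚ.+-inverseʳ y) (ℚₚ.+-monoˡ-< (- y) y<z)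
  N = proj₁ (archimedean 0<d (3ℚ * y))
  3y≤ : 3ℚ * y ≤ ι (suc N) * d
  3y≤ = ℚₚ.≤-trans (proj₂ (archimedean 0<d (3ℚ * y)))
    (*-monoʳ (ℚₚ.<⇒≤ 0<d) (subst (ι N ≤_) (trans (ℚₚ.+-comm (ι N) 1ℚ) (sym (ι-suc N))) (p≤p+q (ι N) 0≤1)))

pow2 : ℤ → ℚ
pow2 (+ n)    = 2ℚ ^ n
pow2 -[1+ n ] = ½ ^ suc n

pow2-pos : ∀ a → 0ℚ < pow2 a
pow2-pos (+ n)    = ^-pos n 0<2
pow2-pos -[1+ n ] = ^-pos (suc n) (ℚₚ.positive⁻¹ ½)

pow2-suc : ∀ a → pow2 (+ 1 ℤ.+ a) ≡ 2ℚ * pow2 a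
pow2-suc (+ n)          = refl
pow2-suc -[1+ zero ]    = refl
pow2-suc -[1+ suc n ]   = trans (sym (ℚₚ.*-identityˡ (½ ^ suc n))) (ℚₚ.*-assoc 2ℚ ½ (½ ^ suc n))

pow2-pred : ∀ a → pow2 (-[1+ 0 ] ℤ.+ a) ≡ ½ * pow2 a
pow2-pred (+ zero)  = refl
pow2-pred (+ suc n) = trans (sym (ℚₚ.*-identityˡ (2ℚ ^ n))) (ℚₚ.*-assoc ½ 2ℚ (2ℚ ^ n))
pow2-pred -[1+ n ]  = refl

pow2-+ : ∀ a b → pow2 (a ℤ.+ b) ≡ pow2 a * pow2 b
pow2-+ (+ zero) b = trans (cong pow2 (ℤₚ.+-identityˡ b)) (sym (ℚₚ.*-identityˡ (pow2 b)))
pow2-+ (+ suc n) b = begin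
  pow2 (+ suc n ℤ.+ b)          ≡⟨ cong pow2 (ℤₚ.+-assoc (+ 1) (+ n) b) ⟩
  pow2 (+ 1 ℤ.+ (+ n ℤ.+ b))    ≡⟨ pow2-suc (+ n ℤ.+ b) ⟩
  2ℚ * pow2 (+ n ℤ.+ b)         ≡⟨ cong (2ℚ *_) (pow2-+ (+ n) b) ⟩
  2ℚ * (2ℚ ^ n * pow2 b)        ≡⟨ ℚₚ.*-assoc 2ℚ (2ℚ ^ n) (pow2 b) ⟨
  2ℚ ^ suc n * pow2 b           ∎
  where open ≡-Reasoning
pow2-+ -[1+ zero ] b = pow2-pred b
pow2-+ -[1+ suc n ] b = begin
  pow2 (-[1+ suc n ] ℤ.+ b)               ≡⟨ cong pow2 (ℤₚ.+-assoc -[1+ 0 ] -[1+ n ] b) ⟩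
  pow2 (-[1+ 0 ] ℤ.+ (-[1+ n ] ℤ.+ b))    ≡⟨ pow2-pred (-[1+ n ] ℤ.+ b) ⟩
  ½ * pow2 (-[1+ n ] ℤ.+ b)               ≡⟨ cong (½ *_) (pow2-+ -[1+ n ] b) ⟩
  ½ * (½ ^ suc n * pow2 b)                ≡⟨ ℚₚ.*-assoc ½ (½ ^ suc n) (pow2 b) ⟨
  ½ ^ suc (suc n) * pow2 b                ∎
  where open ≡-Reasoning

ι≤pow2 : ∀ n → ι n ≤ pow2 (+ n)
1≤pow2 : ∀ n → 1ℚ ≤ pow2 (+ n)
1≤pow2 zero    = ℚₚ.≤-refl
1≤pow2 (suc n) = ℚₚ.≤-trans (1≤pow2 n)
  (subst (2ℚ ^ n ≤_) (sym (double (2ℚ ^ n))) (p≤p+q (2ℚ ^ n) (^-nonNeg n 0≤2)))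
ι≤pow2 zero    = 0≤1
ι≤pow2 (suc n) = subst₂ _≤_ (sym (ι-suc n)) (sym (double (2ℚ ^ n)))
  (ℚₚ.+-mono-≤ (1≤pow2 n) (ι≤pow2 n))

pow2-mono : ∀ {a b} → a ℤ.≤ b → pow2 a ≤ pow2 b
pow2-mono {a} {b} a≤b = begin
  pow2 a                ≡⟨ ℚₚ.*-identityʳ (pow2 a) ⟨
  pow2 a * 1ℚ           ≤⟨ *-monoˡ (ℚₚ.<⇒≤ (pow2-pos a)) (1≤pow2 n) ⟩
  pow2 a * pow2 (+ n)   ≡⟨ pow2-+ a (+ n) ⟨
  pow2 (a ℤ.+ + n)      ≡⟨ cong pow2 eq ⟩
  pow2 b                ∎
  where
  open ℚₚ.≤-Reasoning
  n = ℤ.∣ b ℤ.- a ∣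
  eq : a ℤ.+ + n ≡ b
  eq = trans (cong (λ t → a ℤ.+ t) (ℤₚ.0≤i⇒+∣i∣≡i (ℤₚ.i≤j⇒0≤j-i a≤b)))
      (trans (ℤₚ.+-comm a (b ℤ.- a)) (trans (ℤₚ.+-assoc b (ℤ.- a) a)
      (trans (cong (λ t → b ℤ.+ t) (ℤₚ.+-inverseˡ a)) (ℤₚ.+-identityʳ b))))

pow2-^ : ∀ a n → pow2 a ^ n ≡ pow2 (a ℤ.* + n)
pow2-^ a zero    = cong pow2 (sym (ℤₚ.*-zeroʳ a))
pow2-^ a (suc n) = begin
  pow2 a * pow2 a ^ n            ≡⟨ cong (pow2 a *_) (pow2-^ a n) ⟩
  pow2 a * pow2 (a ℤ.* + n)      ≡⟨ pow2-+ a (a ℤ.* + n) ⟨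
  pow2 (a ℤ.+ a ℤ.* + n)         ≡⟨ cong pow2 (ℤₚ.*-suc a (+ n)) ⟨
  pow2 (a ℤ.* + suc n)           ∎
  where open ≡-Reasoning

pow2-near : ∀ {r} → 0ℚ < r → ∃ λ a → r ≤ pow2 a × pow2 a ≤ 2ℚ * r
pow2-near {r} 0<r = search (s ℕ.+ N) (subst (λ t → r ≤ pow2 t) (sym eq) r≤)
  where
  open ℚₚ.≤-Reasoning
  s N : ℕ
  s = proj₁ (archimedean 0<r 1ℚ)
  N = ℤ.∣ ℚ.↥ r ∣
  r≤ : r ≤ pow2 (+ N)
  r≤ = ℚₚ.≤-trans (x≤ι r) (ι≤pow2 N)
  eq : ℤ.- + s ℤ.+ + (s ℕ.+ N) ≡ + N
  eq = trans (sym (ℤₚ.+-assoc (ℤ.- + s) (+ s) (+ N)))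
      (trans (cong (ℤ._+ + N) (ℤₚ.+-inverseˡ (+ s))) (ℤₚ.+-identityˡ (+ N)))
  r≤2r : r ≤ 2ℚ * r
  r≤2r = subst (r ≤_) (sym (double r)) (p≤p+q r (ℚₚ.<⇒≤ 0<r))
  low : pow2 (ℤ.- + s) ≤ r
  low = begin
    pow2 (ℤ.- + s)                       ≡⟨ ℚₚ.*-identityʳ (pow2 (ℤ.- + s)) ⟨
    pow2 (ℤ.- + s) * 1ℚ
      ≤⟨ *-monoˡ (ℚₚ.<⇒≤ (pow2-pos (ℤ.- + s))) (proj₂ (archimedean 0<r 1ℚ)) ⟩
    pow2 (ℤ.- + s) * (ι s * r)
      ≤⟨ *-monoˡ (ℚₚ.<⇒≤ (pow2-pos (ℤ.- + s))) (*-monoʳ (ℚₚ.<⇒≤ 0<r) (ι≤pow2 s)) ⟩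
    pow2 (ℤ.- + s) * (pow2 (+ s) * r)    ≡⟨ ℚₚ.*-assoc (pow2 (ℤ.- + s)) (pow2 (+ s)) r ⟨
    (pow2 (ℤ.- + s) * pow2 (+ s)) * r    ≡⟨ cong (_* r) (pow2-+ (ℤ.- + s) (+ s)) ⟨
    pow2 (ℤ.- + s ℤ.+ + s) * r           ≡⟨ cong (λ t → pow2 t * r) (ℤₚ.+-inverseˡ (+ s)) ⟩
    1ℚ * r                               ≡⟨ ℚₚ.*-identityˡ r ⟩
    r                                    ∎
  step : ∀ t → pow2 (ℤ.- + s ℤ.+ + suc t) ≡ 2ℚ * pow2 (ℤ.- + s ℤ.+ + t)
  step t = trans (cong pow2 (trans (ℤₚ.+-comm (ℤ.- + s) (+ suc t))
    (trans (ℤₚ.+-assoc (+ 1) (+ t) (ℤ.- + s)) (cong (λ u → + 1 ℤ.+ u) (ℤₚ.+-comm (+ t) (ℤ.- + s))))))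
    (pow2-suc (ℤ.- + s ℤ.+ + t))
  search : ∀ t → r ≤ pow2 (ℤ.- + s ℤ.+ + t) → ∃ λ a → r ≤ pow2 a × pow2 a ≤ 2ℚ * r
  search zero h = ℤ.- + s ℤ.+ + 0 , h ,
    ℚₚ.≤-trans (subst (λ t → pow2 t ≤ r) (sym (ℤₚ.+-identityʳ (ℤ.- + s))) low) r≤2r
  search (suc t) h with ≤-or-> r (pow2 (ℤ.- + s ℤ.+ + t))
  ... | inj₁ r≤f = search t r≤f
  ... | inj₂ f<r = ℤ.- + s ℤ.+ + suc t , h , subst (_≤ 2ℚ * r) (sym (step t)) (*-monoˡ 0≤2 (ℚₚ.<⇒≤ f<r))

third : ∀ {ε} → 0ℚ < ε → ∃ λ δ → 0ℚ < δ × δ + δ < ε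
third {ε} 0<ε with divide 0<ε (ℚₚ.positive⁻¹ (+ 3 / 1))
... | δ , 0<δ , 3δ≡ε = δ , 0<δ , subst (δ + δ <_) (trans eq 3δ≡ε) (p<p+q (δ + δ) 0<δ)
  where
  open +-*-Solver
  eq : δ + δ + δ ≡ δ * (+ 3 / 1)
  eq = solve 1 (λ δ → δ :+ δ :+ δ := δ :* con (+ 3 / 1)) refl δ

1/suc<ε : ∀ {ε} → 0ℚ < ε → ∃ λ k → + 1 / suc k < ε
1/suc<ε {ε@(mkℚ (+ zero) d _)} 0<ε = ⊥-elim (ℤ.Positive.pos (ℚ.positive 0<ε))
1/suc<ε {ε@(mkℚ (+ suc r) d _)} 0<ε = suc d , subst (+ 1 / suc (suc d) <_) (ℚₚ.↥p/↧p≡p ε)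
  (/-< (+ 1) (suc d) (+ suc r) d
    (subst₂ ℤ._<_ (ℤₚ.pos-* 1 (suc d)) (ℤₚ.pos-* (suc r) (suc (suc d))) (ℤ.+<+
      (ℕₚ.<-≤-trans (ℕ.s≤s (ℕₚ.≤-reflexive (ℕₚ.*-identityˡ (suc d)))) (ℕₚ.m≤m+n (suc (suc d)) _)))))
1/suc<ε {ε@(mkℚ -[1+ n ] d _)} 0<ε = ⊥-elim (ℤ.Positive.pos (ℚ.positive 0<ε))

search : {A B : ℕ → Set} → (∀ k → A k ⊎ B (suc k)) → (∀ k → B k → B (suc k)) →
         A 0 → ∀ N → B N → ∃ λ k → A k × B (2 ℕ.+ k)
search A⊎B up A0 zero          BN = 0 , A0 , up 1 (up 0 BN)
search A⊎B up A0 (suc zero)    BN = 0 , A0 , up 1 BN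
search A⊎B up A0 (suc (suc k)) BN =
  [ (λ Ak → k , Ak , BN) , search A⊎B up A0 (suc k) ]′ (A⊎B k)

-- Two-sided Dedekind cuts: L q means q < x and U q means x < q.
record ℝ : Set₁ where
  field
    L U         : ℚ → Set
    L-inhabited : ∃ L
    U-inhabited : ∃ U
    L-lower     : ∀ {p q} → p < q → L q → L p
    U-upper     : ∀ {p q} → p < q → U p → U q
    L-open      : ∀ {p} → L p → ∃ λ q → p < q × L q
    U-open      : ∀ {q} → U q → ∃ λ p → p < q × U p
    disjoint    : ∀ {q} → L q → U q → ⊥
    located     : ∀ {p q} → p < q → L p ⊎ U q

  L-lower-≤ : ∀ {p q} → p ≤ q → L q → L p
  L-lower-≤ {p} {q} p≤q Lq with L-open Lq
  ... | r , q<r , Lr = L-lower (ℚₚ.≤-<-trans p≤q q<r) Lr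

  U-upper-≤ : ∀ {p q} → p ≤ q → U p → U q
  U-upper-≤ p≤q Up with U-open Up
  ... | r , r<p , Ur = U-upper (ℚₚ.<-≤-trans r<p p≤q) Ur

  L<U : ∀ {p q} → L p → U q → p < q
  L<U {p} {q} Lp Uq with ≤-or-> q p
  ... | inj₁ q≤p = ⊥-elim (disjoint Lp (U-upper-≤ q≤p Uq))
  ... | inj₂ p<q = p<q

  private
    tight′ : ∀ {ε δ p q} → 0ℚ < δ → δ + δ < ε → L p → U q → ∀ N → q ℚ.- p ≤ ι N * δ →
             ∃ λ a → ∃ λ b → L a × U b × b < a + ε
    tight′ {ε} {δ} {p} {q} 0<δ 2δ<ε Lp Uq N q-p≤ =
      let k , Lk , Uk = search {A = λ k → L (t k)} {B = λ k → U (t k)}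
            (λ k → located (t< k)) (λ k → U-upper (t< k)) L0 N UN
      in t k , t (2 ℕ.+ k) , Lk , Uk , narrow k
      where
      open +-*-Solver
      t : ℕ → ℚ
      t k = p + ι k * δ
      t-suc : ∀ k → t (suc k) ≡ t k + δ
      t-suc k = trans (cong (λ i → p + i * δ) (ι-suc k))
        (solve 3 (λ p i δ → p :+ (con 1ℚ :+ i) :* δ := p :+ i :* δ :+ δ) refl p (ι k) δ)
      t< : ∀ k → t k < t (suc k)
      t< k = subst (t k <_) (sym (t-suc k)) (p<p+q (t k) 0<δ)
      narrow : ∀ k → t (2 ℕ.+ k) < t k + ε
      narrow k = subst (_< t k + ε)
        (sym (trans (t-suc (suc k)) (trans (cong (_+ δ) (t-suc k)) (ℚₚ.+-assoc (t k) δ δ))))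
        (ℚₚ.+-monoʳ-< (t k) 2δ<ε)
      L0 : L (t 0)
      L0 = subst L (solve 2 (λ p δ → p := p :+ con 0ℚ :* δ) refl p δ) Lp
      UN : U (t N)
      UN = U-upper-≤ (subst (_≤ t N) (solve 2 (λ p q → p :+ (q :- p) := q) refl p q)
        (ℚₚ.+-monoʳ-≤ p q-p≤)) Uq

  tight : ∀ {ε} → 0ℚ < ε → ∃ λ a → ∃ λ b → L a × U b × b < a + ε
  tight 0<ε =
    let δ , 0<δ , 2δ<ε = third 0<ε
        p , Lp = L-inhabited
        q , Uq = U-inhabited
        N , q-p≤ = archimedean 0<δ (q ℚ.- p)
    in tight′ 0<δ 2δ<ε Lp Uq N q-p≤

open ℝ

-- A family of rational intervals [ a , b ] which pairwise intersect and become
-- arbitrarily short determines the unique real number lying in all of them.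
fromIntervals : (I : ℚ → ℚ → Set) →
  (∀ {a b a′ b′} → I a b → I a′ b′ → a ≤ b′) →
  (∀ {ε} → 0ℚ < ε → ∃ λ a → ∃ λ b → I a b × b < a + ε) → ℝ
fromIntervals I consistent fine = record
  { L           = λ q → ∃ λ a → ∃ λ b → I a b × q < a
  ; U           = λ q → ∃ λ a → ∃ λ b → I a b × b < q
  ; L-inhabited = let a , b , Iab , _ = fine 0<1 in
                  a ℚ.- 1ℚ , a , b , Iab ,
                  subst (a ℚ.- 1ℚ <_) (ℚₚ.+-identityʳ a) (ℚₚ.+-monoʳ-< a (ℚₚ.negative⁻¹ (- 1ℚ)))
  ; U-inhabited = let a , b , Iab , _ = fine 0<1 in b + 1ℚ , a , b , Iab , p<p+q b 0<1
  ; L-lower     = λ { p<q (a , b , Iab , q<a) → a , b , Iab , ℚₚ.<-trans p<q q<a }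
  ; U-upper     = λ { p<q (a , b , Iab , b<p) → a , b , Iab , ℚₚ.<-trans b<p p<q }
  ; L-open      = λ { (a , b , Iab , p<a) → let r , p<r , r<a = ℚₚ.<-dense p<a in
                      r , p<r , a , b , Iab , r<a }
  ; U-open      = λ { (a , b , Iab , b<q) → let r , b<r , r<q = ℚₚ.<-dense b<q in
                      r , r<q , a , b , Iab , b<r }
  ; disjoint    = λ { (a , b , I₁ , q<a) (a′ , b′ , I₂ , b′<q) →
                      <⇒≱ (ℚₚ.<-trans b′<q q<a) (consistent I₁ I₂) }
  ; located     = located′
  }
  where
  located′ : ∀ {p q} → p < q →
    (∃ λ a → ∃ λ b → I a b × p < a) ⊎ (∃ λ a → ∃ λ b → I a b × b < q)
  located′ {p} {q} p<q with fine (subst (_< q ℚ.- p) (ℚₚ.+-inverseʳ p) (ℚₚ.+-monoˡ-< (- p) p<q))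
  ... | a , b , Iab , b<a+q-p with ≤-or-> a p
  ... | inj₂ p<a = inj₁ (a , b , Iab , p<a)
  ... | inj₁ a≤p = inj₂ (a , b , Iab , ℚₚ.<-≤-trans b<a+q-p
    (subst (a + (q ℚ.- p) ≤_) (solve 2 (λ p q → p :+ (q :- p) := q) refl p q)
      (ℚₚ.+-monoˡ-≤ (q ℚ.- p) a≤p)))
    where open +-*-Solver

infix  4 _≃_ _≤ℝ_ _<ℝ_
infix  8 -ℝ_

_≤ℝ_ _<ℝ_ : ℝ → ℝ → Set
x ≤ℝ y = ∀ q → L x q → L y q
x <ℝ y = ∃ λ q → U x q × L y q

_≃_ : ℝ → ℝ → Set
x ≃ y = x ≤ℝ y × y ≤ℝ x

fromℚ : ℚ → ℝ
fromℚ p = record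
  { L           = _< p
  ; U           = p <_
  ; L-inhabited = p ℚ.- 1ℚ ,
                  subst (p ℚ.- 1ℚ <_) (ℚₚ.+-identityʳ p) (ℚₚ.+-monoʳ-< p (ℚₚ.negative⁻¹ (- 1ℚ)))
  ; U-inhabited = p + 1ℚ , p<p+q p 0<1
  ; L-lower     = ℚₚ.<-trans
  ; U-upper     = λ q<r p<q → ℚₚ.<-trans p<q q<r
  ; L-open      = λ q<p → let r , q<r , r<p = ℚₚ.<-dense q<p in r , q<r , r<p
  ; U-open      = λ p<q → let r , p<r , r<q = ℚₚ.<-dense p<q in r , r<q , p<r
  ; disjoint    = ℚₚ.<-asym
  ; located     = located′
  }
  where
  located′ : ∀ {q r} → q < r → q < p ⊎ p < r
  located′ {q} {r} q<r with ≤-or-> p q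
  ... | inj₁ p≤q = inj₂ (ℚₚ.≤-<-trans p≤q q<r)
  ... | inj₂ q<p = inj₁ q<p

fromℕ : ℕ → ℝ
fromℕ n = fromℚ (+ n / 1)

0ℝ : ℝ
0ℝ = fromℚ 0ℚ

-ℝ_ : ℝ → ℝ
-ℝ x = record
  { L           = λ q → U x (- q)
  ; U           = λ q → L x (- q)
  ; L-inhabited = neg (U-inhabited x)
  ; U-inhabited = neg (L-inhabited x)
  ; L-lower     = λ p<q → U-upper x (ℚₚ.neg-antimono-< p<q)
  ; U-upper     = λ p<q → L-lower x (ℚₚ.neg-antimono-< p<q)
  ; L-open      = λ {p} h → let r , r<-p , Ur = U-open x h in
                  - r , subst (_< - r) (neg² p) (ℚₚ.neg-antimono-< r<-p) ,
                  subst (U x) (sym (neg² r)) Ur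
  ; U-open      = λ {q} h → let r , -q<r , Lr = L-open x h in
                  - r , subst (- r <_) (neg² q) (ℚₚ.neg-antimono-< -q<r) ,
                  subst (L x) (sym (neg² r)) Lr
  ; disjoint    = λ Uq Lq → disjoint x Lq Uq
  ; located     = λ p<q → [ inj₂ , inj₁ ]′ (located x (ℚₚ.neg-antimono-< p<q))
  }
  where
  neg² : ∀ p → - (- p) ≡ p
  neg² = solve 1 (λ p → :- (:- p) := p) refl
    where open +-*-Solver
  neg : ∀ {P : ℚ → Set} → ∃ P → ∃ λ q → P (- q)
  neg {P} (p , h) = - p , subst P (sym (neg² p)) h

lower-interp : ∀ {lo a m b k} → a ≤ m → m ≤ b → lo ≤ a * k → lo ≤ b * k → lo ≤ m * k
lower-interp {k = k} a≤m m≤b lo≤ak lo≤bk with ≤-or-> 0ℚ k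
... | inj₁ 0≤k = ℚₚ.≤-trans lo≤ak (*-monoʳ 0≤k a≤m)
... | inj₂ k<0 = ℚₚ.≤-trans lo≤bk (ℚₚ.*-monoʳ-≤-nonPos k {{ℚ.nonPositive (ℚₚ.<⇒≤ k<0)}} m≤b)

upper-interp : ∀ {hi a m b k} → a ≤ m → m ≤ b → a * k ≤ hi → b * k ≤ hi → m * k ≤ hi
upper-interp {k = k} a≤m m≤b ak≤hi bk≤hi with ≤-or-> 0ℚ k
... | inj₁ 0≤k = ℚₚ.≤-trans (*-monoʳ 0≤k m≤b) bk≤hi
... | inj₂ k<0 = ℚₚ.≤-trans (ℚₚ.*-monoʳ-≤-nonPos k {{ℚ.nonPositive (ℚₚ.<⇒≤ k<0)}} a≤m) ak≤hi

lower-corner : ∀ {lo a m b c k d} → a ≤ m → m ≤ b → c ≤ k → k ≤ d →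
  lo ≤ a * c → lo ≤ a * d → lo ≤ b * c → lo ≤ b * d → lo ≤ m * k
lower-corner {lo} {a} {m} {b} {c} {k} {d} a≤m m≤b c≤k k≤d ac ad bc bd =
  lower-interp a≤m m≤b (side a ac ad) (side b bc bd)
  where
  side : ∀ x → lo ≤ x * c → lo ≤ x * d → lo ≤ x * k
  side x xc xd = subst (lo ≤_) (ℚₚ.*-comm k x) (lower-interp c≤k k≤d
    (subst (lo ≤_) (ℚₚ.*-comm x c) xc) (subst (lo ≤_) (ℚₚ.*-comm x d) xd))

upper-corner : ∀ {hi a m b c k d} → a ≤ m → m ≤ b → c ≤ k → k ≤ d →
  a * c ≤ hi → a * d ≤ hi → b * c ≤ hi → b * d ≤ hi → m * k ≤ hi
upper-corner {hi} {a} {m} {b} {c} {k} {d} a≤m m≤b c≤k k≤d ac ad bc bd =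
  upper-interp a≤m m≤b (side a ac ad) (side b bc bd)
  where
  side : ∀ x → x * c ≤ hi → x * d ≤ hi → x * k ≤ hi
  side x xc xd = subst (_≤ hi) (ℚₚ.*-comm k x) (upper-interp c≤k k≤d
    (subst (_≤ hi) (ℚₚ.*-comm x c) xc) (subst (_≤ hi) (ℚₚ.*-comm x d) xd))

common : ∀ (x : ℝ) {a b a′ b′} → L x a → U x b → L x a′ → U x b′ →
  ∃ λ m → (a ≤ m × m ≤ b) × (a′ ≤ m × m ≤ b′)
common x {a} {b} {a′} {b′} La Ub La′ Ub′ with ≤-or-> a a′
... | inj₁ a≤a′ = a′ , (a≤a′ , ℚₚ.<⇒≤ (L<U x La′ Ub)) , (ℚₚ.≤-refl , ℚₚ.<⇒≤ (L<U x La′ Ub′))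
... | inj₂ a′<a = a , (ℚₚ.≤-refl , ℚₚ.<⇒≤ (L<U x La Ub)) , (ℚₚ.<⇒≤ a′<a , ℚₚ.<⇒≤ (L<U x La Ub′))

-- [ lo , hi ] contains the product of some rational intervals around x and y.
record ProductInterval (x y : ℝ) (lo hi : ℚ) : Set where
  constructor productInterval
  field
    {a b c d} : ℚ
    Lx : L x a
    Ux : U x b
    Ly : L y c
    Uy : U y d
    lo≤ac : lo ≤ a * c
    lo≤ad : lo ≤ a * d
    lo≤bc : lo ≤ b * c
    lo≤bd : lo ≤ b * d
    ac≤hi : a * c ≤ hi
    ad≤hi : a * d ≤ hi
    bc≤hi : b * c ≤ hi
    bd≤hi : b * d ≤ hi

product-consistent : ∀ x y {lo hi lo′ hi′} →
  ProductInterval x y lo hi → ProductInterval x y lo′ hi′ → lo ≤ hi′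
product-consistent x y I J
  with common x I.Lx I.Ux J.Lx J.Ux | common y I.Ly I.Uy J.Ly J.Uy
  where module I = ProductInterval I
        module J = ProductInterval J
... | m , (am , mb) , (a′m , mb′) | k , (ck , kd) , (c′k , kd′) =
  ℚₚ.≤-trans (lower-corner am mb ck kd I.lo≤ac I.lo≤ad I.lo≤bc I.lo≤bd)
             (upper-corner a′m mb′ c′k kd′ J.ac≤hi J.ad≤hi J.bc≤hi J.bd≤hi)
  where module I = ProductInterval I
        module J = ProductInterval J

bound : ∀ x → ∃ λ M → 0ℚ ≤ M ×
  (∀ {a b δ} → δ ≤ 1ℚ → L x a → U x b → b < a + δ → - M ≤ a × a ≤ M)
bound x with L-inhabited x | U-inhabited x
... | p , Lp | q , Uq = M , 0≤M , λ {a} {b} {δ} δ≤1 La Ub b<a+δ →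
    (begin
      - M                      ≤⟨ p≤p+q (- M) (ℚₚ.0≤∣p∣ q) ⟩
      - M + ℚ.∣ q ∣             ≡⟨ solve 2 (λ p q → :- (p :+ q :+ con 1ℚ) :+ q := :- p :+ con (- 1ℚ)) refl ℚ.∣ p ∣ ℚ.∣ q ∣ ⟩
      - ℚ.∣ p ∣ + - 1ℚ          ≤⟨ ℚₚ.+-monoˡ-≤ (- 1ℚ) (-∣p∣≤p p) ⟩
      p + - 1ℚ                 ≤⟨ ℚₚ.+-monoˡ-≤ (- 1ℚ) (ℚₚ.<⇒≤ (L<U x Lp Ub)) ⟩
      b + - 1ℚ                 ≤⟨ ℚₚ.+-monoˡ-≤ (- 1ℚ) (ℚₚ.<⇒≤ b<a+δ) ⟩
      a + δ + - 1ℚ             ≤⟨ ℚₚ.+-monoˡ-≤ (- 1ℚ) (ℚₚ.+-monoʳ-≤ a δ≤1) ⟩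
      a + 1ℚ + - 1ℚ            ≡⟨ solve 1 (λ a → a :+ con 1ℚ :+ con (- 1ℚ) := a) refl a ⟩
      a                        ∎) ,
    (begin
      a                        ≤⟨ ℚₚ.<⇒≤ (L<U x La Uq) ⟩
      q                        ≤⟨ p≤∣p∣ q ⟩
      ℚ.∣ q ∣                   ≤⟨ p≤p+q ℚ.∣ q ∣ (ℚₚ.≤-trans (ℚₚ.0≤∣p∣ p) (p≤p+q ℚ.∣ p ∣ 0≤1)) ⟩
      ℚ.∣ q ∣ + (ℚ.∣ p ∣ + 1ℚ)   ≡⟨ solve 2 (λ p q → q :+ (p :+ con 1ℚ) := p :+ q :+ con 1ℚ) refl ℚ.∣ p ∣ ℚ.∣ q ∣ ⟩
      M                        ∎)
  where
  open ℚₚ.≤-Reasoning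
  open +-*-Solver
  M = ℚ.∣ p ∣ + ℚ.∣ q ∣ + 1ℚ
  0≤M : 0ℚ ≤ M
  0≤M = ℚₚ.≤-trans (ℚₚ.0≤∣p∣ p) (ℚₚ.≤-trans (p≤p+q ℚ.∣ p ∣ (ℚₚ.0≤∣p∣ q)) (p≤p+q (ℚ.∣ p ∣ + ℚ.∣ q ∣) 0≤1))
  -∣p∣≤p : ∀ p → - ℚ.∣ p ∣ ≤ p
  -∣p∣≤p p = subst (- ℚ.∣ p ∣ ≤_) (solve 1 (λ p → :- (:- p) := p) refl p)
    (ℚₚ.neg-antimono-≤ (subst (- p ≤_) (ℚₚ.∣-p∣≡∣p∣ p) (p≤∣p∣ (- p))))

fineness : ∀ {ε D} → 0ℚ < ε → 0ℚ < D → ∃ λ δ → 0ℚ < δ × δ ≤ 1ℚ × δ * D < ε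
fineness {ε} {D} 0<ε 0<D with divide 0<ε (ℚₚ.<-trans 0<D (p<p+q D 0<ε))
... | δ , 0<δ , eq = δ , 0<δ , δ≤1 , subst (δ * D <_) eq
    (ℚₚ.*-monoʳ-<-pos δ {{ℚ.positive 0<δ}} (p<p+q D 0<ε))
  where
  0<D+ε = ℚₚ.<-trans 0<D (p<p+q D 0<ε)
  δ≤1 : δ ≤ 1ℚ
  δ≤1 = ℚₚ.*-cancelʳ-≤-pos (D + ε) {{ℚ.positive 0<D+ε}}
    (subst₂ _≤_ (sym eq) (sym (ℚₚ.*-identityˡ (D + ε)))
      (subst (ε ≤_) (ℚₚ.+-comm ε D) (p≤p+q ε (ℚₚ.<⇒≤ 0<D))))

product-bound : ∀ {M δ a v} → - M ≤ a → a ≤ M → 0ℚ ≤ v → v ≤ δ → 0ℚ ≤ M →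
  - (M * δ) ≤ a * v × a * v ≤ M * δ
product-bound {M} {δ} {a} {v} -M≤a a≤M 0≤v v≤δ 0≤M =
  (begin
    - (M * δ)   ≤⟨ ℚₚ.neg-antimono-≤ (*-monoˡ 0≤M v≤δ) ⟩
    - (M * v)   ≡⟨ ℚₚ.neg-distribˡ-* M v ⟩
    - M * v     ≤⟨ *-monoʳ 0≤v -M≤a ⟩
    a * v       ∎) ,
  ℚₚ.≤-trans (*-monoʳ 0≤v a≤M) (*-monoˡ 0≤M v≤δ)
  where open ℚₚ.≤-Reasoning

product-fine′ : ∀ x y {Mx My a b c d δ ε} → 0ℚ ≤ Mx → 0ℚ ≤ My → 0ℚ < δ → δ ≤ 1ℚ →
  δ * (2ℚ * (1ℚ + (Mx + My))) < ε →
  L x a → U x b → b < a + δ → - Mx ≤ a × a ≤ Mx →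
  L y c → U y d → d < c + δ → - My ≤ c × c ≤ My →
  ∃ λ lo → ∃ λ hi → ProductInterval x y lo hi × hi < lo + ε
product-fine′ x y {Mx} {My} {a} {b} {c} {d} {δ} {ε} 0≤Mx 0≤My 0<δ δ≤1 δD<ε
  La Ub b<a+δ ∣a∣≤Mx Lc Ud d<c+δ ∣c∣≤My =
  lo′ , hi′ ,
  productInterval La Ub Lc Ud
    (lo 0≤e) (subst (lo′ ≤_) (sym ad) (lo″ -e≤av)) (subst (lo′ ≤_) (sym bc) (lo″ -e≤uc))
    (subst (lo′ ≤_) (sym bd) (lo″ -e≤all))
    (p≤p+q (a * c) 0≤e) (subst (_≤ hi′) (sym ad) (hi″ av≤e)) (subst (_≤ hi′) (sym bc) (hi″ uc≤e))
    (subst (_≤ hi′) (sym bd) (hi″ all≤e)) ,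
  subst (_< lo′ + ε) width (ℚₚ.+-monoʳ-< lo′ δD<ε)
  where
  open +-*-Solver
  E e u v lo′ hi′ : ℚ
  E = 1ℚ + (Mx + My)
  e = δ * E
  u = b ℚ.- a
  v = d ℚ.- c
  lo′ = a * c ℚ.- e
  hi′ = a * c + e
  width : lo′ + δ * (2ℚ * E) ≡ hi′
  width = solve 4 (λ a c E δ → a :* c :- δ :* E :+ δ :* (con 2ℚ :* E) := a :* c :+ δ :* E)
    refl a c E δ
  0≤δ = ℚₚ.<⇒≤ 0<δ
  0≤Mδ : ∀ {M} → 0ℚ ≤ M → 0ℚ ≤ M * δ
  0≤Mδ 0≤M = *-nonNeg 0≤M 0≤δ
  width≤ : ∀ {a b} → b < a + δ → b ℚ.- a ≤ δ
  width≤ {a} {b} b<a+δ = subst (b ℚ.- a ≤_) (solve 2 (λ a δ → a :+ δ :- a := δ) refl a δ)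
    (ℚₚ.+-monoˡ-≤ (- a) (ℚₚ.<⇒≤ b<a+δ))
  0≤width : ∀ {a b} → a < b → 0ℚ ≤ b ℚ.- a
  0≤width {a} {b} a<b = subst (_≤ b ℚ.- a) (ℚₚ.+-inverseʳ a) (ℚₚ.+-monoˡ-≤ (- a) (ℚₚ.<⇒≤ a<b))
  0≤u = 0≤width (L<U x La Ub)
  0≤v = 0≤width (L<U y Lc Ud)
  av = product-bound (proj₁ ∣a∣≤Mx) (proj₂ ∣a∣≤Mx) 0≤v (width≤ d<c+δ) 0≤Mx
  cu = product-bound (proj₁ ∣c∣≤My) (proj₂ ∣c∣≤My) 0≤u (width≤ b<a+δ) 0≤My
  0≤uv : 0ℚ ≤ u * v
  0≤uv = *-nonNeg 0≤u 0≤v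
  uv≤δ : u * v ≤ δ
  uv≤δ = subst (u * v ≤_) (ℚₚ.*-identityˡ δ)
    (*-mono 0≤u 0≤δ (ℚₚ.≤-trans (width≤ b<a+δ) δ≤1) (width≤ d<c+δ))
  e≡ : e ≡ Mx * δ + (My * δ + δ)
  e≡ = solve 3 (λ m n δ → δ :* (con 1ℚ :+ (m :+ n)) := m :* δ :+ (n :* δ :+ δ)) refl Mx My δ
  neg-e≡ : - e ≡ - (Mx * δ) + (- (My * δ) + - δ)
  neg-e≡ = solve 3 (λ m n δ → :- (δ :* (con 1ℚ :+ (m :+ n))) := :- (m :* δ) :+ (:- (n :* δ) :+ :- δ)) refl Mx My δ
  -≤0 : ∀ {p} → 0ℚ ≤ p → - p ≤ 0ℚ
  -≤0 = ℚₚ.neg-antimono-≤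
  sum≤e : ∀ {p q r} → p ≤ Mx * δ → q ≤ My * δ → r ≤ δ → p + (q + r) ≤ e
  sum≤e {p} {q} {r} h₁ h₂ h₃ =
    subst (p + (q + r) ≤_) (sym e≡) (ℚₚ.+-mono-≤ h₁ (ℚₚ.+-mono-≤ h₂ h₃))
  -e≤sum : ∀ {p q r} → - (Mx * δ) ≤ p → - (My * δ) ≤ q → - δ ≤ r → - e ≤ p + (q + r)
  -e≤sum {p} {q} {r} h₁ h₂ h₃ =
    subst (_≤ p + (q + r)) (sym neg-e≡) (ℚₚ.+-mono-≤ h₁ (ℚₚ.+-mono-≤ h₂ h₃))
  0≤e : 0ℚ ≤ e
  0≤e = sum≤e (0≤Mδ 0≤Mx) (0≤Mδ 0≤My) 0≤δ
  lo : 0ℚ ≤ e → lo′ ≤ a * c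
  lo h = subst (lo′ ≤_) (ℚₚ.+-identityʳ (a * c)) (ℚₚ.+-monoʳ-≤ (a * c) (-≤0 h))
  lo″ : ∀ {p} → - e ≤ p → lo′ ≤ a * c + p
  lo″ = ℚₚ.+-monoʳ-≤ (a * c)
  hi″ : ∀ {p} → p ≤ e → a * c + p ≤ hi′
  hi″ = ℚₚ.+-monoʳ-≤ (a * c)
  ad : a * d ≡ a * c + (a * v + (0ℚ + 0ℚ))
  ad = solve 3 (λ a c d → a :* d := a :* c :+ (a :* (d :- c) :+ (con 0ℚ :+ con 0ℚ))) refl a c d
  bc : b * c ≡ a * c + (0ℚ + (c * u + 0ℚ))
  bc = solve 3 (λ a b c → b :* c := a :* c :+ (con 0ℚ :+ (c :* (b :- a) :+ con 0ℚ))) refl a b c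
  bd : b * d ≡ a * c + (a * v + (c * u + u * v))
  bd = solve 4 (λ a b c d → b :* d := a :* c :+ (a :* (d :- c) :+ (c :* (b :- a) :+ (b :- a) :* (d :- c))))
    refl a b c d
  -e≤av  = -e≤sum (proj₁ av) (-≤0 (0≤Mδ 0≤My)) (-≤0 0≤δ)
  -e≤uc  = -e≤sum (-≤0 (0≤Mδ 0≤Mx)) (proj₁ cu) (-≤0 0≤δ)
  -e≤all = -e≤sum (proj₁ av) (proj₁ cu) (ℚₚ.≤-trans (-≤0 0≤δ) 0≤uv)
  av≤e   = sum≤e (proj₂ av) (0≤Mδ 0≤My) 0≤δ
  uc≤e   = sum≤e (0≤Mδ 0≤Mx) (proj₂ cu) 0≤δ
  all≤e  = sum≤e (proj₂ av) (proj₂ cu) uv≤δ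

product-fine : ∀ x y {ε} → 0ℚ < ε → ∃ λ lo → ∃ λ hi → ProductInterval x y lo hi × hi < lo + ε
product-fine x y 0<ε =
  let Mx , 0≤Mx , ∣x∣≤Mx = bound x
      My , 0≤My , ∣y∣≤My = bound y
      1≤E = p≤p+q 1ℚ (ℚₚ.≤-trans 0≤Mx (p≤p+q Mx 0≤My))
      δ , 0<δ , δ≤1 , δD<ε = fineness 0<ε (*-pos 0<2 (ℚₚ.<-≤-trans 0<1 1≤E))
      a , b , La , Ub , b<a+δ = tight x 0<δ
      c , d , Lc , Ud , d<c+δ = tight y 0<δ
  in product-fine′ x y 0≤Mx 0≤My 0<δ δ≤1 δD<ε
       La Ub b<a+δ (∣x∣≤Mx δ≤1 La Ub b<a+δ) Lc Ud d<c+δ (∣y∣≤My δ≤1 Lc Ud d<c+δ)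

infixl 7 _*ℝ_
_*ℝ_ : ℝ → ℝ → ℝ
x *ℝ y = fromIntervals (ProductInterval x y) (product-consistent x y) (product-fine x y)

grid : ℚ → ℕ → ℚ
grid δ k = ι k * δ

grid-suc : ∀ δ k → grid δ (suc k) ≡ grid δ k + δ
grid-suc δ k = trans (cong (_* δ) (ι-suc k))
  (solve 2 (λ i δ → (con 1ℚ :+ i) :* δ := i :* δ :+ δ) refl (ι k) δ)
  where open +-*-Solver

grid< : ∀ {δ} → 0ℚ < δ → ∀ k → grid δ k < grid δ (suc k)
grid< {δ} 0<δ k = subst (grid δ k <_) (sym (grid-suc δ k)) (p<p+q (grid δ k) 0<δ)

grid-narrow : ∀ {δ ε} → δ + δ < ε → ∀ k → grid δ (2 ℕ.+ k) < grid δ k + ε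
grid-narrow {δ} {ε} 2δ<ε k = subst (_< grid δ k + ε)
  (sym (trans (grid-suc δ (suc k)) (trans (cong (_+ δ) (grid-suc δ k)) (ℚₚ.+-assoc (grid δ k) δ δ))))
  (ℚₚ.+-monoʳ-< (grid δ k) 2δ<ε)

grid-nonNeg : ∀ {δ} → 0ℚ < δ → ∀ k → 0ℚ ≤ grid δ k
grid-nonNeg 0<δ k = *-nonNeg (ι-nonNeg k) (ℚₚ.<⇒≤ 0<δ)

square-< : ∀ {p q} → 0ℚ ≤ p → p < q → p * p < q * q
square-< {p} {q} 0≤p p<q = ℚₚ.≤-<-trans (*-monoˡ 0≤p (ℚₚ.<⇒≤ p<q))
  (ℚₚ.*-monoˡ-<-pos q {{ℚ.positive (ℚₚ.≤-<-trans 0≤p p<q)}} p<q)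

-- a² < x < b² with a, b ≥ 0.  The alternative a ≡ 0ℚ is needed at x = 0; it also
-- gives √ x the value 0 at negative x.
√-Interval : ℝ → ℚ → ℚ → Set
√-Interval x a b = (0ℚ ≤ a × (a ≡ 0ℚ ⊎ L x (a * a))) × (0ℚ ≤ b × U x (b * b))

√-consistent : ∀ x {a b a′ b′} → √-Interval x a b → √-Interval x a′ b′ → a ≤ b′
√-consistent x ((_ , inj₁ refl) , _) (_ , (0≤b′ , _)) = 0≤b′
√-consistent x {a} {b′ = b′} ((0≤a , inj₂ La²) , _) (_ , (0≤b′ , Ub′²)) with ≤-or-> a b′
... | inj₁ a≤b′ = a≤b′
... | inj₂ b′<a = ⊥-elim (ℚₚ.<-asym (L<U x La² Ub′²) (square-< 0≤b′ b′<a))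

√-fine′ : ∀ x {δ ε} → 0ℚ < δ → δ + δ < ε → ∀ {p} → U x p → ∀ N → ℚ.∣ p ∣ + 1ℚ ≤ grid δ N →
  ∃ λ a → ∃ λ b → √-Interval x a b × b < a + ε
√-fine′ x {δ} {ε} 0<δ 2δ<ε {p} Up N s≤ =
  let k , Ak , Bk = search {A} {B} split up (inj₁ (ℚₚ.*-zeroˡ δ)) N BN
  in grid δ k , grid δ (2 ℕ.+ k) ,
     ((grid-nonNeg 0<δ k , Ak) , (grid-nonNeg 0<δ (2 ℕ.+ k) , Bk)) , grid-narrow 2δ<ε k
  where
  open ℚₚ.≤-Reasoning
  A B : ℕ → Set
  A k = grid δ k ≡ 0ℚ ⊎ L x (grid δ k * grid δ k)
  B k = U x (grid δ k * grid δ k)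
  square-step : ∀ k → grid δ k * grid δ k < grid δ (suc k) * grid δ (suc k)
  square-step k = square-< (grid-nonNeg 0<δ k) (grid< 0<δ k)
  split : ∀ k → A k ⊎ B (suc k)
  split k = [ (λ Lk → inj₁ (inj₂ Lk)) , inj₂ ]′ (located x (square-step k))
  up : ∀ k → B k → B (suc k)
  up k = U-upper x (square-step k)
  s = ℚ.∣ p ∣ + 1ℚ
  1≤s : 1ℚ ≤ s
  1≤s = subst (1ℚ ≤_) (ℚₚ.+-comm 1ℚ ℚ.∣ p ∣) (p≤p+q 1ℚ (ℚₚ.0≤∣p∣ p))
  0≤s = ℚₚ.≤-trans 0≤1 1≤s
  BN : B N
  BN = U-upper-≤ x (begin
    p                      ≤⟨ p≤∣p∣ p ⟩
    ℚ.∣ p ∣                 ≤⟨ p≤p+q ℚ.∣ p ∣ 0≤1 ⟩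
    s                      ≡⟨ ℚₚ.*-identityˡ s ⟨
    1ℚ * s                 ≤⟨ *-mono 0≤1 (ℚₚ.≤-trans 0≤s s≤) (ℚₚ.≤-trans 1≤s s≤) s≤ ⟩
    grid δ N * grid δ N    ∎) Up

√-fine : ∀ x {ε} → 0ℚ < ε → ∃ λ a → ∃ λ b → √-Interval x a b × b < a + ε
√-fine x 0<ε =
  let δ , 0<δ , 2δ<ε = third 0<ε
      p , Up = U-inhabited x
      N , s≤ = archimedean 0<δ (ℚ.∣ p ∣ + 1ℚ)
  in √-fine′ x 0<δ 2δ<ε Up N s≤

infix 9 √_
√_ : ℝ → ℝ
√ x = fromIntervals (√-Interval x) (√-consistent x) (√-fine x)

-- lo = a / (k + 1) ≤ log₂ n and log₂ n ≤ b / (l + 1) = hi, with the inequalities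
-- written as 2 ^ a ≤ n ^ (k + 1) and n ^ (l + 1) ≤ 2 ^ b.
Log₂-Interval : ℕ → ℚ → ℚ → Set
Log₂-Interval n lo hi =
  (∃ λ a → ∃ λ k → lo ≡ + a / suc k × 2 ℕ.^ a ℕ.≤ n ℕ.^ suc k) ×
  (∃ λ b → ∃ λ l → hi ≡ + b / suc l × n ℕ.^ suc l ℕ.≤ 2 ℕ.^ b)

2^-cancel : ∀ {a b} → 2 ℕ.^ a ℕ.≤ 2 ℕ.^ b → a ℕ.≤ b
2^-cancel {a} {b} h with a ℕₚ.≤? b
... | yes a≤b = a≤b
... | no  a≰b = ⊥-elim (ℕₚ.<⇒≱ (ℕₚ.^-monoʳ-< 2 (ℕ.s≤s (ℕ.s≤s ℕ.z≤n)) (ℕₚ.≰⇒> a≰b)) h)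

log₂-consistent : ∀ n {lo hi lo′ hi′} → Log₂-Interval n lo hi → Log₂-Interval n lo′ hi′ → lo ≤ hi′
log₂-consistent n ((a , k , refl , 2^a≤) , _) (_ , (b , l , refl , ≤2^b)) =
  /-≤ (+ a) k (+ b) l (subst₂ ℤ._≤_ (ℤₚ.pos-* a (suc l)) (ℤₚ.pos-* b (suc k)) (ℤ.+≤+ (2^-cancel (begin
    2 ℕ.^ (a ℕ.* suc l)          ≡⟨ ℕₚ.^-*-assoc 2 a (suc l) ⟨
    (2 ℕ.^ a) ℕ.^ suc l          ≤⟨ ℕₚ.^-monoˡ-≤ (suc l) 2^a≤ ⟩
    (n ℕ.^ suc k) ℕ.^ suc l      ≡⟨ ℕₚ.^-*-assoc n (suc k) (suc l) ⟩
    n ℕ.^ (suc k ℕ.* suc l)      ≡⟨ cong (n ℕ.^_) (ℕₚ.*-comm (suc k) (suc l)) ⟩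
    n ℕ.^ (suc l ℕ.* suc k)      ≡⟨ ℕₚ.^-*-assoc n (suc l) (suc k) ⟨
    (n ℕ.^ suc l) ℕ.^ suc k      ≤⟨ ℕₚ.^-monoˡ-≤ (suc k) ≤2^b ⟩
    (2 ℕ.^ b) ℕ.^ suc k          ≡⟨ ℕₚ.^-*-assoc 2 b (suc k) ⟩
    2 ℕ.^ (b ℕ.* suc k)          ∎))))
  where open ℕₚ.≤-Reasoning

n≤2^n : ∀ n → n ℕ.≤ 2 ℕ.^ n
n≤2^n zero    = ℕ.z≤n
n≤2^n (suc n) = ℕₚ.+-mono-≤ (ℕₚ.m^n>0 2 n) (ℕₚ.≤-trans (n≤2^n n) (ℕₚ.m≤m+n (2 ℕ.^ n) 0))

bracket : ∀ {m} → 1 ℕ.≤ m → ∀ N → m ℕ.≤ 2 ℕ.^ N → ∃ λ a → 2 ℕ.^ a ℕ.≤ m × m ℕ.≤ 2 ℕ.^ suc a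
bracket 1≤m zero    m≤ = 0 , 1≤m , ℕₚ.≤-trans m≤ (ℕ.s≤s ℕ.z≤n)
bracket {m} 1≤m (suc N) m≤ with m ℕₚ.≤? 2 ℕ.^ N
... | yes m≤2^N = bracket 1≤m N m≤2^N
... | no  m≰2^N = N , ℕₚ.<⇒≤ (ℕₚ.≰⇒> m≰2^N) , m≤

log₂-fine : ∀ n → 1 ℕ.≤ n → ∀ {ε} → 0ℚ < ε → ∃ λ a → ∃ λ b → Log₂-Interval n a b × b < a + ε
log₂-fine n 1≤n {ε} 0<ε =
  let k , 1/k<ε = 1/suc<ε 0<ε
      a , 2^a≤ , ≤2^sa = bracket (1≤^ (suc k)) (n ℕ.^ suc k) (n≤2^n (n ℕ.^ suc k))
  in + a / suc k , + suc a / suc k , ((a , k , refl , 2^a≤) , (suc a , k , refl , ≤2^sa)) ,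
     subst (_< + a / suc k + ε)
       (trans (ℚₚ.+-comm (+ a / suc k) (+ 1 / suc k)) (sym (+-/ (+ 1) (+ a) k)))
       (ℚₚ.+-monoʳ-< (+ a / suc k) 1/k<ε)
  where
  1≤^ : ∀ k → 1 ℕ.≤ n ℕ.^ k
  1≤^ k = ℕₚ.≤-trans (ℕₚ.≤-reflexive (sym (ℕₚ.^-zeroˡ k))) (ℕₚ.^-monoˡ-≤ k 1≤n)

log₂ : (n : ℕ) .{{_ : NonZero n}} → ℝ
log₂ n = fromIntervals (Log₂-Interval n) (log₂-consistent n) (log₂-fine n (ℕ.>-nonZero⁻¹ n))

-- lo ≤ 2 ^ (a / (m + 1)) for some rational a / (m + 1) < x, and
-- 2 ^ (b / (n + 1)) ≤ hi for some rational b / (n + 1) > x.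
2^-Lower 2^-Upper : ℝ → ℚ → Set
2^-Lower x lo = 0ℚ ≤ lo × ∃ λ a → ∃ λ m → L x (a / suc m) × lo ^ suc m ≤ pow2 a
2^-Upper x hi = 0ℚ ≤ hi × ∃ λ b → ∃ λ n → U x (b / suc n) × pow2 b ≤ hi ^ suc n

2^-Interval : ℝ → ℚ → ℚ → Set
2^-Interval x lo hi = 2^-Lower x lo × 2^-Upper x hi

2^-consistent : ∀ x {lo hi lo′ hi′} → 2^-Interval x lo hi → 2^-Interval x lo′ hi′ → lo ≤ hi′
2^-consistent x {lo} {hi′ = hi} ((0≤lo , a , m , La , lo≤) , _) (_ , (0≤hi , b , n , Ub , ≤hi)) =
  ^-cancel (n ℕ.+ m ℕ.* suc n) 0≤hi (begin
    lo ^ (suc m ℕ.* suc n)   ≡⟨ ^-assocʳ lo (suc m) (suc n) ⟨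
    (lo ^ suc m) ^ suc n     ≤⟨ ^-mono (suc n) (^-nonNeg (suc m) 0≤lo) lo≤ ⟩
    pow2 a ^ suc n           ≡⟨ pow2-^ a (suc n) ⟩
    pow2 (a ℤ.* + suc n)     ≤⟨ pow2-mono (ℤₚ.<⇒≤ (/-<⁻¹ a m b n (L<U x La Ub))) ⟩
    pow2 (b ℤ.* + suc m)     ≡⟨ pow2-^ b (suc m) ⟨
    pow2 b ^ suc m           ≤⟨ ^-mono (suc m) (ℚₚ.<⇒≤ (pow2-pos b)) ≤hi ⟩
    (hi ^ suc n) ^ suc m     ≡⟨ ^-assocʳ hi (suc n) (suc m) ⟩
    hi ^ (suc n ℕ.* suc m)   ≡⟨ cong (hi ^_) (ℕₚ.*-comm (suc n) (suc m)) ⟩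
    hi ^ (suc m ℕ.* suc n)   ∎)
  where open ℚₚ.≤-Reasoning

2^-Lower-0 : ∀ x → 2^-Lower x 0ℚ
2^-Lower-0 x with L-inhabited x
... | p , Lp = ℚₚ.≤-refl , ℚ.↥ p , ℚ.denominator-1 p , subst (L x) (sym (ℚₚ.↥p/↧p≡p p)) Lp ,
  subst (_≤ pow2 (ℚ.↥ p)) (sym (ℚₚ.*-zeroˡ (0ℚ ^ ℚ.denominator-1 p))) (ℚₚ.<⇒≤ (pow2-pos (ℚ.↥ p)))

2^-located : ∀ x {y z} → 0ℚ ≤ y → y < z → 2^-Lower x y ⊎ 2^-Upper x z
2^-located x {y} {z} 0≤y y<z with ≤-or-> y 0ℚ
... | inj₁ y≤0 = inj₁ (subst (2^-Lower x) (ℚₚ.≤-antisym 0≤y y≤0) (2^-Lower-0 x))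
... | inj₂ 0<y =
  let m , 4y^m≤z^m = growth-gap 0<y y<z
      a , y^m≤ , ≤2y^m = pow2-near (^-pos (suc m) 0<y)
  in [ (λ La → inj₁ (0≤y , a , m , La , y^m≤))
     , (λ Ub → inj₂ (ℚₚ.≤-trans 0≤y (ℚₚ.<⇒≤ y<z) , + 1 ℤ.+ a , m , Ub , upper m a ≤2y^m 4y^m≤z^m))
     ]′ (located x (step a m))
  where
  open ℚₚ.≤-Reasoning
  step : ∀ a m → a / suc m < (+ 1 ℤ.+ a) / suc m
  step a m = /-< a m (+ 1 ℤ.+ a) m (ℤₚ.*-monoʳ-<-pos (+ suc m) a<1+a)
    where
    a<1+a : a ℤ.< + 1 ℤ.+ a
    a<1+a = subst (ℤ._< + 1 ℤ.+ a) (ℤₚ.+-identityˡ a) (ℤₚ.+-monoˡ-< a (ℤ.+<+ (ℕ.s≤s ℕ.z≤n)))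
  upper : ∀ m a → pow2 a ≤ 2ℚ * y ^ suc m → (2ℚ * 2ℚ) * y ^ suc m ≤ z ^ suc m →
          pow2 (+ 1 ℤ.+ a) ≤ z ^ suc m
  upper m a h₁ h₂ = begin
    pow2 (+ 1 ℤ.+ a)           ≡⟨ pow2-suc a ⟩
    2ℚ * pow2 a                ≤⟨ *-monoˡ 0≤2 h₁ ⟩
    2ℚ * (2ℚ * y ^ suc m)      ≡⟨ ℚₚ.*-assoc 2ℚ 2ℚ (y ^ suc m) ⟨
    (2ℚ * 2ℚ) * y ^ suc m      ≤⟨ h₂ ⟩
    z ^ suc m                  ∎

2^-fine′ : ∀ x {δ ε} → 0ℚ < δ → δ + δ < ε → ∀ {b} → U x (b / 1) → ∀ N → pow2 b ≤ grid δ N →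
  ∃ λ lo → ∃ λ hi → 2^-Interval x lo hi × hi < lo + ε
2^-fine′ x {δ} 0<δ 2δ<ε {b} Ub N pow2b≤ =
  let k , Ak , Bk = search {A} {B} split up A0 N BN
  in grid δ k , grid δ (2 ℕ.+ k) , (Ak , Bk) , grid-narrow 2δ<ε k
  where
  A B : ℕ → Set
  A k = 2^-Lower x (grid δ k)
  B k = 2^-Upper x (grid δ k)
  split : ∀ k → A k ⊎ B (suc k)
  split k = 2^-located x (grid-nonNeg 0<δ k) (grid< 0<δ k)
  up : ∀ k → B k → B (suc k)
  up k (0≤g , c , n , Uc , h) = grid-nonNeg 0<δ (suc k) , c , n , Uc ,
    ℚₚ.≤-trans h (^-mono (suc n) 0≤g (ℚₚ.<⇒≤ (grid< 0<δ k)))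
  A0 : A 0
  A0 = subst (2^-Lower x) (sym (ℚₚ.*-zeroˡ δ)) (2^-Lower-0 x)
  BN : B N
  BN = grid-nonNeg 0<δ N , b , 0 , Ub , subst (pow2 b ≤_) (sym (ℚₚ.*-identityʳ (grid δ N))) pow2b≤

2^-fine : ∀ x {ε} → 0ℚ < ε → ∃ λ lo → ∃ λ hi → 2^-Interval x lo hi × hi < lo + ε
2^-fine x 0<ε =
  let δ , 0<δ , 2δ<ε = third 0<ε
      p , Up = U-inhabited x
      b = + ℤ.∣ ℚ.↥ p ∣
      N , pow2b≤ = archimedean 0<δ (pow2 b)
  in 2^-fine′ x 0<δ 2δ<ε {b} (U-upper-≤ x (x≤ι p) Up) N pow2b≤

infix 9 2^_
2^_ : ℝ → ℝ
2^ x = fromIntervals (2^-Interval x) (2^-consistent x) (2^-fine x)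

Point : Set₁
Point = ℝ × ℝ

infix 4 _≃ₚ_
_≃ₚ_ : Point → Point → Set
(x , y) ≃ₚ (x′ , y′) = x ≃ x′ × y ≃ y′

record Rectangle : Set₁ where
  field
    left right bottom top : ℝ
    left<right : left <ℝ right
    bottom<top : bottom <ℝ top

infix 4 _∈ᴿ_
_∈ᴿ_ : Point → Rectangle → Set
(x , y) ∈ᴿ R = (left ≤ℝ x × x ≤ℝ right) × (bottom ≤ℝ y × y ≤ℝ top)
  where open Rectangle R

-- An n-element subset of the plane, given by an injective enumeration.
record PointSet (n : ℕ) : Set₁ where
  field
    point    : Fin n → Point
    distinct : ∀ {i j} → point i ≃ₚ point j → i ≡ j

record Graph (n : ℕ) (ℓ : Level) : Set (Level.suc ℓ) where
  field
    _~_      : Rel (Fin n) ℓ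
    ~-sym    : Symmetric _~_
    ~-irrefl : ∀ {i} → ¬ (i ~ i)

module _ {n : ℕ} {ℓ : Level} (G : Graph n ℓ) where
  open Graph G

  Independent : Subset n → Set ℓ
  Independent S = ∀ {i j} → i ∈ S → j ∈ S → ¬ (i ~ j)

  IsIndependenceNumber : ℕ → Set ℓ
  IsIndependenceNumber α =
    (∃ λ S → Independent S × ∣ S ∣ ≡ α) × (∀ S → Independent S → ∣ S ∣ ℕ.≤ α)

  Colorable : ℕ → Set ℓ
  Colorable k = ∃ λ (color : Fin n → Fin k) → ∀ {i j} → i ~ j → color i ≢ color j

  IsChromaticNumber : ℕ → Set ℓ
  IsChromaticNumber χ = Colorable χ × (∀ k → Colorable k → χ ℕ.≤ k)

boxDelaunay : ∀ {n} → PointSet n → Graph n (Level.suc Level.zero)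
boxDelaunay P = record
  { _~_      = λ i j → i ≢ j × ∃ λ R → point i ∈ᴿ R × point j ∈ᴿ R ×
                       (∀ k → k ≢ i → k ≢ j → ¬ (point k ∈ᴿ R))
  ; ~-sym    = λ { (i≢j , R , i∈R , j∈R , empty) →
                   (λ j≡i → i≢j (sym j≡i)) , R , j∈R , i∈R , λ k k≢j k≢i → empty k k≢i k≢j }
  ; ~-irrefl = λ { (i≢i , _) → i≢i refl }
  }
  where open PointSet P

{-# OPTIONS --safe #-}
module Submission where

open import Defs
open import Data.Nat using (ℕ; NonZero)
open import Data.Product using (∃; _×_)

-- The points have m digits from {0, …, K - 1}: x compares the digits from the first
-- to the last and y from the last to the first.  A line consists of the points which
-- differ in one digit only; its points are coloured with two colours, each colour class
-- is made decreasing, and one class is put to the left of the other, so that a point of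
-- the left class and a higher point of the right class always span an empty rectangle.
-- Given T on a line, at most (K + 1) 2^(K - |T|) of the 2^K colourings leave T without
-- such a pair, since along T all points of one colour must precede those of the other.
-- Adding one digit at a time and averaging over the colourings bounds the weighted count
-- of the independent sets A, in which A has weight a^|A| b^(N - |A|), by doubling b for
-- each digit.  With K = 2^(2d), m = 2d, a = 2^d and b = 1 at the top this leaves only sets
-- of size at most 8 N / 2^d, where N is about 2^(4d²).  Finally χ ≥ n / α.

-- Real arithmetic: from integer inequalities to inequalities between cuts.

module Reals where

  open import Data.Nat as ℕ using (zero; suc; z≤n; s≤s)
  import Data.Nat.Properties as ℕₚ
  open import Data.Integer as ℤ using (+_; -[1+_])
  import Data.Integer.Properties as ℤₚ
  open import Data.Rational as ℚ using (ℚ; 0ℚ; 1ℚ; ½; _+_; _*_; -_; _≤_; _<_; _/_)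
  import Data.Rational.Properties as ℚₚ
  open import Data.Rational.Solver using (module +-*-Solver)
  open import Algebra.Bundles using (CommutativeRing)
  open import Algebra.Properties.Semiring.Exp (CommutativeRing.semiring ℚₚ.+-*-commutativeRing)
    using (_^_; ^-assocʳ)
  open import Data.Product using (_,_; proj₂)
  open import Data.Sum using (inj₁; inj₂)
  open import Relation.Binary.PropositionalEquality
  open ℝ

  ι-mono-≤ : ∀ {m n} → m ℕ.≤ n → ι m ≤ ι n
  ι-mono-≤ {m} {n} m≤n = /-≤ (+ m) 0 (+ n) 0
    (subst₂ ℤ._≤_ (sym (ℤₚ.*-identityʳ (+ m))) (sym (ℤₚ.*-identityʳ (+ n))) (ℤ.+≤+ m≤n))

  ι-mono-< : ∀ {m n} → m ℕ.< n → ι m < ι n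
  ι-mono-< {m} {n} m<n = /-< (+ m) 0 (+ n) 0
    (subst₂ ℤ._<_ (sym (ℤₚ.*-identityʳ (+ m))) (sym (ℤₚ.*-identityʳ (+ n))) (ℤ.+<+ m<n))

  ι-+ : ∀ m n → ι (m ℕ.+ n) ≡ ι m + ι n
  ι-+ m n = +-/ (+ m) (+ n) 0

  ι-* : ∀ m n → ι (m ℕ.* n) ≡ ι m * ι n
  ι-* zero    n = sym (ℚₚ.*-zeroˡ (ι n))
  ι-* (suc m) n = begin
    ι (n ℕ.+ m ℕ.* n)     ≡⟨ ι-+ n (m ℕ.* n) ⟩
    ι n + ι (m ℕ.* n)     ≡⟨ cong (_+_ (ι n)) (ι-* m n) ⟩
    ι n + ι m * ι n       ≡⟨ solve 2 (λ m n → n :+ m :* n := (con 1ℚ :+ m) :* n) refl (ι m) (ι n) ⟩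
    (1ℚ + ι m) * ι n      ≡⟨ cong (_* ι n) (sym (ι-suc m)) ⟩
    ι (suc m) * ι n       ∎
    where
    open ≡-Reasoning
    open +-*-Solver

  ι-^ : ∀ m n → ι (m ℕ.^ n) ≡ ι m ^ n
  ι-^ m zero    = refl
  ι-^ m (suc n) = trans (ι-* m (m ℕ.^ n)) (cong (_*_ (ι m)) (ι-^ m n))

  ι-pos : ∀ {n} → 1 ℕ.≤ n → 0ℚ < ι n
  ι-pos 1≤n = ℚₚ.<-≤-trans 0<1 (ι-mono-≤ 1≤n)

  unit : ℕ → ℚ
  unit e = + 1 / suc e

  unit-pos : ∀ e → 0ℚ < unit e
  unit-pos e = ℚₚ.positive⁻¹ (unit e) {{ℚₚ.normalize-pos 1 (suc e)}}

  unit-* : ∀ e t → unit e * ι t ≡ + t / suc e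
  unit-* e zero    = trans (ℚₚ.*-zeroʳ (unit e)) (ℚₚ.≤-antisym
    (/-≤ (+ 0) 0 (+ 0) e (ℤₚ.≤-reflexive refl)) (/-≤ (+ 0) e (+ 0) 0 (ℤₚ.≤-reflexive refl)))
  unit-* e (suc t) = begin
    unit e * ι (suc t)          ≡⟨ cong (unit e *_) (ι-suc t) ⟩
    unit e * (1ℚ + ι t)         ≡⟨ solve 2 (λ ε t → ε :* (con 1ℚ :+ t) := ε :+ ε :* t) refl (unit e) (ι t) ⟩
    unit e + unit e * ι t       ≡⟨ cong (_+_ (unit e)) (unit-* e t) ⟩
    unit e + + t / suc e        ≡⟨ sym (+-/ (+ 1) (+ t) e) ⟩
    + suc t / suc e        ∎
    where
    open ≡-Reasoning
    open +-*-Solver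

  ^-distribʳ-*ℚ : ∀ p q n → (p * q) ^ n ≡ p ^ n * q ^ n
  ^-distribʳ-*ℚ p q zero    = refl
  ^-distribʳ-*ℚ p q (suc n) = trans (cong ((p * q) *_) (^-distribʳ-*ℚ p q n))
    (solve 4 (λ p q r s → (p :* q) :* (r :* s) := (p :* r) :* (q :* s)) refl p q (p ^ n) (q ^ n))
    where open +-*-Solver

  *-cancelˡ-< : ∀ {p q r} → 0ℚ < p → p * q < p * r → q < r
  *-cancelˡ-< {p} 0<p = ℚₚ.*-cancelˡ-<-nonNeg p {{ℚ.nonNegative (ℚₚ.<⇒≤ 0<p)}}

  -- An inequality between cuts is tested at every rational, also at negative ones, while the
  -- approximations built below have to be nonnegative.
  clip : ∀ {p q} → 0ℚ < p → q < p → ∃ λ r → q ≤ r × 0ℚ ≤ r × r < p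
  clip {p} {q} 0<p q<p with ≤-or-> 0ℚ q
  ... | inj₁ 0≤q = q , ℚₚ.≤-refl , 0≤q , q<p
  ... | inj₂ q<0 = 0ℚ , ℚₚ.<⇒≤ q<0 , ℚₚ.≤-refl , 0<p

  -- Density of the rationals followed by division by `p`. It makes room for the strict inequalities
  -- that membership in a cut demands; `grow` is its dual.
  shrink : ∀ {p q s} → 0ℚ < p → 0ℚ ≤ q → q < p * s → ∃ λ s′ → 0ℚ < s′ × s′ < s × q < p * s′
  shrink {p} {q} {s} 0<p 0≤q q<ps with ℚₚ.<-dense q<ps
  ... | r , q<r , r<ps with divide (ℚₚ.≤-<-trans 0≤q q<r) 0<p
  ... | δ , 0<δ , δp≡r = δ , 0<δ , *-cancelˡ-< 0<p (subst (_< p * s) r≡ r<ps) , subst (q <_) r≡ q<r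
    where r≡ = trans (sym δp≡r) (ℚₚ.*-comm δ p)

  grow : ∀ {p r s} → 0ℚ < p → 0ℚ ≤ s → p * s < r → ∃ λ s′ → s < s′ × p * s′ < r
  grow {p} {r} {s} 0<p 0≤s ps<r with ℚₚ.<-dense ps<r
  ... | q , ps<q , q<r with divide (ℚₚ.≤-<-trans (*-nonNeg (ℚₚ.<⇒≤ 0<p) 0≤s) ps<q) 0<p
  ... | δ , _ , δp≡q = δ , *-cancelˡ-< 0<p (subst (p * s <_) q≡ ps<q) , subst (_< r) q≡ q<r
    where q≡ = trans (sym δp≡q) (ℚₚ.*-comm δ p)

  log₂-upper : ∀ n .{{_ : NonZero n}} {b r} → n ℕ.≤ 2 ℕ.^ b → ι b < r → U (log₂ n) r
  log₂-upper n {b} n≤2^b b<r = + 0 / 1 , ι b ,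
    ( (0 , 0 , refl , ℕₚ.m^n>0 n 1)
    , (b , 0 , refl , ℕₚ.≤-trans (ℕₚ.≤-reflexive (ℕₚ.*-identityʳ n)) n≤2^b)) , b<r

  √-upper : ∀ x {t r} → 0ℚ ≤ t → (∀ {q} → t * t < q → U x q) → t < r → U (√ x) r
  √-upper x {t} 0≤t x≤t² t<r with ℚₚ.<-dense t<r
  ... | b , t<b , b<r = 0ℚ , b ,
    ((ℚₚ.≤-refl , inj₁ refl) , (ℚₚ.≤-trans 0≤t (ℚₚ.<⇒≤ t<b) , x≤t² (square-< 0≤t t<b))) , b<r

  *-upper : ∀ {ε t r} s → 0ℚ < ε → 0ℚ ≤ t → (∀ {q} → t < q → U s q) → ε * t < r →
    U (fromℚ ε *ℝ s) r
  *-upper {ε} {t} {r} s 0<ε 0≤t s≤t εt<r with grow 0<ε 0≤t εt<r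
  ... | d , t<d , εd<r with grow (ℚₚ.≤-<-trans 0≤t t<d) (ℚₚ.<⇒≤ 0<ε) (subst (_< r) (ℚₚ.*-comm ε d) εd<r)
  ... | b , ε<b , db<r with L-inhabited s
  -- An arbitrary lower bound `c` of `s` completes the interval. It may be negative, so the lower
  -- end is the minimum of `0ℚ` and `b * c`.
  ... | c , Lc = 0ℚ ℚ.⊓ (b * c) , b * d ,
    productInterval {a = 0ℚ} {b} {c} {d} 0<ε ε<b Lc Ud
      (ℚₚ.≤-trans (ℚₚ.p⊓q≤p 0ℚ (b * c)) (ℚₚ.≤-reflexive (sym (ℚₚ.*-zeroˡ c))))
      (ℚₚ.≤-trans (ℚₚ.p⊓q≤p 0ℚ (b * c)) (ℚₚ.≤-reflexive (sym (ℚₚ.*-zeroˡ d))))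
      (ℚₚ.p⊓q≤q 0ℚ (b * c))
      (ℚₚ.≤-trans (ℚₚ.p⊓q≤p 0ℚ (b * c)) 0≤bd)
      (ℚₚ.≤-trans (ℚₚ.≤-reflexive (ℚₚ.*-zeroˡ c)) 0≤bd)
      (ℚₚ.≤-trans (ℚₚ.≤-reflexive (ℚₚ.*-zeroˡ d)) 0≤bd)
      (*-monoˡ 0≤b (ℚₚ.<⇒≤ (L<U s Lc Ud)))
      ℚₚ.≤-refl ,
    subst (_< r) (ℚₚ.*-comm d b) db<r
    where
    Ud = s≤t t<d
    0≤b = ℚₚ.<⇒≤ (ℚₚ.<-trans 0<ε ε<b)
    0≤bd = *-nonNeg 0≤b (ℚₚ.≤-trans 0≤t (ℚₚ.<⇒≤ t<d))

  -- The hypothesis on `y` encodes y ≤ t / (e + 1). A lower approximation `lo` comes with a fraction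
  -- a / (m + 1) below `y`, and raising to the power (m + 1)(e + 1) clears both roots.
  2^-upper-bound : ∀ y e t {χ} → (∀ {r} → + t / suc e < r → U y r) → 0ℚ ≤ χ → 2ℚ ^ t ≤ χ ^ suc e →
    2^ y ≤ℝ fromℚ χ
  2^-upper-bound y e t {χ} y≤ 0≤χ 2^t≤ q (lo , _ , ((0≤lo , a , m , La , lo≤) , _) , q<lo) =
    ℚₚ.<-≤-trans q<lo (^-cancel (e ℕ.+ m ℕ.* suc e) 0≤χ (begin
      lo ^ (suc m ℕ.* suc e)   ≡⟨ ^-assocʳ lo (suc m) (suc e) ⟨
      (lo ^ suc m) ^ suc e     ≤⟨ ^-mono (suc e) (^-nonNeg (suc m) 0≤lo) lo≤ ⟩
      pow2 a ^ suc e           ≡⟨ pow2-^ a (suc e) ⟩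
      pow2 (a ℤ.* + suc e)     ≤⟨ pow2-mono a≤ ⟩
      pow2 (+ t ℤ.* + suc m)   ≡⟨ pow2-^ (+ t) (suc m) ⟨
      (2ℚ ^ t) ^ suc m         ≤⟨ ^-mono (suc m) (^-nonNeg t 0≤2) 2^t≤ ⟩
      (χ ^ suc e) ^ suc m      ≡⟨ ^-assocʳ χ (suc e) (suc m) ⟩
      χ ^ (suc e ℕ.* suc m)    ≡⟨ cong (χ ^_) (ℕₚ.*-comm (suc e) (suc m)) ⟩
      χ ^ (suc m ℕ.* suc e)    ∎))
    where
    open ℚₚ.≤-Reasoning
    a≤ : a ℤ.* + suc e ℤ.≤ + t ℤ.* + suc m
    a≤ = ℤₚ.≮⇒≥ λ lt → disjoint y La (y≤ (/-< (+ t) e a m lt))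

  -- Here ρ ≤ 2 ^ (-t / (e + 1)). Cuts are open, so a fraction strictly below -t / (e + 1) is
  -- needed; it is -(t (M + 1) + 1) / ((e + 1)(M + 1)). The extra 1 in its numerator costs a factor
  -- 2, which the gap between `lo` and `ρ` pays for.
  2^-Lower-below : ∀ y e t {ρ lo} M → (∀ {r} → + t / suc e < r → U y r) → 0ℚ < ρ →
    ρ ^ suc e * 2ℚ ^ t ≤ 1ℚ → 0ℚ ≤ lo → (2ℚ * 2ℚ) * lo ^ suc M ≤ ρ ^ suc M → 2^-Lower (-ℝ y) lo
  2^-Lower-below y e t {ρ} {lo} M y≤ 0<ρ ρ≤ 0≤lo 4lo≤ρ =
    0≤lo , -[1+ b ] , m , lower , lo≤
    where
    open ℚₚ.≤-Reasoning
    b m : ℕ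
    b = t ℕ.* suc M
    m = M ℕ.+ e ℕ.* suc M
    neg² : ∀ p → - (- p) ≡ p
    neg² = solve 1 (λ p → :- (:- p) := p) refl
      where open +-*-Solver
    lower : U y (- (-[1+ b ] / suc m))
    lower = subst (U y) (sym (neg² (+ suc b / suc m))) (y≤ (/-< (+ t) e (+ suc b) m
      (subst₂ ℤ._<_ (ℤₚ.pos-* t (suc m)) (ℤₚ.pos-* (suc b) (suc e)) (ℤ.+<+ (lt t (suc M) (suc e))))))
      where
      lt : ∀ t M E .{{_ : NonZero E}} → t ℕ.* (E ℕ.* M) ℕ.< suc (t ℕ.* M) ℕ.* E
      lt t M E = subst (ℕ._< suc (t ℕ.* M) ℕ.* E)
        (trans (ℕₚ.*-assoc t M E) (cong (t ℕ.*_) (ℕₚ.*-comm M E))) (ℕₚ.*-monoˡ-< E (ℕₚ.n<1+n (t ℕ.* M)))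
    X Y : ℚ
    X = lo ^ suc M
    Y = ρ ^ suc M
    0≤X = ^-nonNeg (suc M) 0≤lo
    X≤ : X ≤ ½ * Y
    X≤ = begin
      X                        ≤⟨ p≤p+q X 0≤X ⟩
      X + X                    ≡⟨ solve 1 (λ X → X :+ X := con ½ :* ((con 2ℚ :* con 2ℚ) :* X)) refl X ⟩
      ½ * ((2ℚ * 2ℚ) * X)      ≤⟨ *-monoˡ (ℚₚ.nonNegative⁻¹ ½) 4lo≤ρ ⟩
      ½ * Y                    ∎
      where open +-*-Solver
    ρ^≤ : ρ ^ suc e ≤ ½ ^ t
    ρ^≤ = ℚₚ.*-cancelʳ-≤-pos (2ℚ ^ t) {{ℚ.positive (^-pos t 0<2)}} (begin
      ρ ^ suc e * 2ℚ ^ t       ≤⟨ ρ≤ ⟩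
      1ℚ                       ≡⟨ 1^ t ⟨
      (½ * 2ℚ) ^ t             ≡⟨ ^-distribʳ-*ℚ ½ 2ℚ t ⟩
      ½ ^ t * 2ℚ ^ t           ∎)
      where
      1^ : ∀ n → (½ * 2ℚ) ^ n ≡ 1ℚ
      1^ zero    = refl
      1^ (suc n) = trans (ℚₚ.*-identityˡ _) (1^ n)
    Y^≤ : Y ^ suc e ≤ ½ ^ b
    Y^≤ = begin
      (ρ ^ suc M) ^ suc e        ≡⟨ ^-assocʳ ρ (suc M) (suc e) ⟩
      ρ ^ (suc M ℕ.* suc e)      ≡⟨ cong (ρ ^_) (ℕₚ.*-comm (suc M) (suc e)) ⟩
      ρ ^ (suc e ℕ.* suc M)      ≡⟨ ^-assocʳ ρ (suc e) (suc M) ⟨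
      (ρ ^ suc e) ^ suc M        ≤⟨ ^-mono (suc M) (^-nonNeg (suc e) (ℚₚ.<⇒≤ 0<ρ)) ρ^≤ ⟩
      (½ ^ t) ^ suc M            ≡⟨ ^-assocʳ ½ t (suc M) ⟩
      ½ ^ b                      ∎
    lo≤ : lo ^ suc m ≤ pow2 -[1+ b ]
    lo≤ = begin
      lo ^ (suc e ℕ.* suc M)     ≡⟨ cong (lo ^_) (ℕₚ.*-comm (suc e) (suc M)) ⟩
      lo ^ (suc M ℕ.* suc e)     ≡⟨ ^-assocʳ lo (suc M) (suc e) ⟨
      X ^ suc e                  ≤⟨ ^-mono (suc e) 0≤X X≤ ⟩
      (½ * Y) ^ suc e            ≡⟨ ^-distribʳ-*ℚ ½ Y (suc e) ⟩
      ½ ^ suc e * Y ^ suc e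
        ≤⟨ *-mono (^-nonNeg (suc e) (ℚₚ.nonNegative⁻¹ ½)) (^-nonNeg b (ℚₚ.nonNegative⁻¹ ½))
             (pow2-mono (ℤ.-≤- {e} {0} z≤n)) Y^≤ ⟩
      ½ * ½ ^ b                  ∎

  2^-lower-bound : ∀ y e t {ρ} → (∀ {r} → + t / suc e < r → U y r) → 0ℚ < ρ → ρ ^ suc e * 2ℚ ^ t ≤ 1ℚ →
    fromℚ ρ ≤ℝ 2^ (-ℝ y)
  2^-lower-bound y e t {ρ} y≤ 0<ρ ρ≤ q q<ρ =
    let q′ , q≤q′ , 0≤q′ , q′<ρ = clip 0<ρ q<ρ
        lo , q′<lo , lo<ρ = ℚₚ.<-dense q′<ρ
        M , 4lo≤ρ = growth-gap (ℚₚ.≤-<-trans 0≤q′ q′<lo) lo<ρ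
        -- An interval must also have an upper end, and any one will do.
        _ , hi , (_ , upper) , _ = 2^-fine (-ℝ y) 0<1
    in lo , hi ,
       (2^-Lower-below y e t M y≤ 0<ρ ρ≤ (ℚₚ.≤-trans 0≤q′ (ℚₚ.<⇒≤ q′<lo)) 4lo≤ρ , upper) ,
       ℚₚ.≤-<-trans q≤q′ q′<lo

  product-lower′ : ∀ {n n′ ρ′ d} y → 0ℚ < n′ → n′ < n → 0ℚ < ρ′ → L y ρ′ → U y d →
    ∃ (ProductInterval (fromℚ n) y (n′ * ρ′))
  product-lower′ {n} {n′} {ρ′} {d} y 0<n′ n′<n 0<ρ′ Lρ′ Ud = b * d ,
    productInterval {a = n′} {b} {ρ′} {d} n′<n n<b Lρ′ Ud
      ℚₚ.≤-refl n′ρ′≤n′d n′ρ′≤bρ′ (ℚₚ.≤-trans n′ρ′≤n′d n′d≤bd)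
      (ℚₚ.≤-trans n′ρ′≤n′d n′d≤bd) n′d≤bd (*-monoˡ (ℚₚ.<⇒≤ (ℚₚ.<-trans 0<n′ (ℚₚ.<-trans n′<n n<b))) (ℚₚ.<⇒≤ ρ′<d)) ℚₚ.≤-refl
    where
    b = n + 1ℚ
    n<b = p<p+q n 0<1
    ρ′<d = L<U y Lρ′ Ud
    n′≤b = ℚₚ.<⇒≤ (ℚₚ.<-trans n′<n n<b)
    n′ρ′≤n′d = *-monoˡ (ℚₚ.<⇒≤ 0<n′) (ℚₚ.<⇒≤ ρ′<d)
    n′ρ′≤bρ′ = *-monoʳ (ℚₚ.<⇒≤ 0<ρ′) n′≤b
    n′d≤bd = *-monoʳ (ℚₚ.<⇒≤ (ℚₚ.<-trans 0<ρ′ ρ′<d)) n′≤b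

  -- Both factors have to be approximated strictly from below, so the slack between `q` and `n * ρ`
  -- is shared: first `ρ` is lowered, then `n`.
  product-lower : ∀ {n ρ} y → 0ℚ < n → 0ℚ < ρ → fromℚ ρ ≤ℝ y → fromℚ (n * ρ) ≤ℝ fromℚ n *ℝ y
  product-lower {n} {ρ} y 0<n 0<ρ ρ≤y q q<nρ =
    let q′ , q≤q′ , 0≤q′ , q′<nρ = clip (*-pos 0<n 0<ρ) q<nρ
        ρ′ , 0<ρ′ , ρ′<ρ , q′<nρ′ = shrink 0<n 0≤q′ q′<nρ
        n′ , 0<n′ , n′<n , q′<ρ′n′ = shrink 0<ρ′ 0≤q′ (subst (q′ <_) (ℚₚ.*-comm n ρ′) q′<nρ′)
        hi , interval = product-lower′ y 0<n′ n′<n 0<ρ′ (ρ≤y ρ′ ρ′<ρ) (proj₂ (U-inhabited y))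
    in n′ * ρ′ , hi , interval , ℚₚ.≤-<-trans q≤q′ (subst (q′ <_) (ℚₚ.*-comm ρ′ n′) q′<ρ′n′)

  ratio-bound : ∀ e t {n α} → 0ℚ < ι n → α ℕ.^ suc e ℕ.* 2 ℕ.^ t ℕ.≤ n ℕ.^ suc e →
    ∀ {ρ} → ρ * ι n ≡ ι α → ρ ^ suc e * 2ℚ ^ t ≤ 1ℚ
  ratio-bound e t {n} {α} 0<n h {ρ} ρn≡α =
    ℚₚ.*-cancelʳ-≤-pos (ι n ^ suc e) {{ℚ.positive (^-pos (suc e) 0<n)}} (begin
      ρ ^ suc e * 2ℚ ^ t * ι n ^ suc e
        ≡⟨ solve 3 (λ p q r → p :* q :* r := p :* r :* q) refl (ρ ^ suc e) (2ℚ ^ t) (ι n ^ suc e) ⟩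
      ρ ^ suc e * ι n ^ suc e * 2ℚ ^ t
        ≡⟨ cong (_* 2ℚ ^ t) (trans (sym (^-distribʳ-*ℚ ρ (ι n) (suc e))) (cong (_^ suc e) ρn≡α)) ⟩
      ι α ^ suc e * 2ℚ ^ t
        ≡⟨ cong₂ _*_ (sym (ι-^ α (suc e))) (sym (ι-^ 2 t)) ⟩
      ι (α ℕ.^ suc e) * ι (2 ℕ.^ t)
        ≡⟨ sym (ι-* (α ℕ.^ suc e) (2 ℕ.^ t)) ⟩
      ι (α ℕ.^ suc e ℕ.* 2 ℕ.^ t)
        ≤⟨ ι-mono-≤ h ⟩
      ι (n ℕ.^ suc e)
        ≡⟨ trans (ι-^ n (suc e)) (sym (ℚₚ.*-identityˡ _)) ⟩
      1ℚ * ι n ^ suc e ∎)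
    where
    open ℚₚ.≤-Reasoning
    open +-*-Solver

  -- `ε` stands for the constant c and `ℓ` for log₂ n. From ℓ ≤ t² the exponent c √ℓ is at most t /
  -- (e + 1), which reduces both real bounds to inequalities between natural numbers.
  module _ {ε : ℚ} (0<ε : 0ℚ < ε) (e t : ℕ) (εt≡ : ε * ι t ≡ + t / suc e)
    (ℓ : ℝ) (ℓ-upper : ∀ {q} → ι t * ι t < q → U ℓ q) where

    √ℓ-upper : ∀ {q} → ι t < q → U (√ ℓ) q
    √ℓ-upper {q} = √-upper ℓ {ι t} {q} (ι-nonNeg t) ℓ-upper

    exponent-upper : ∀ {r} → + t / suc e < r → U (fromℚ ε *ℝ √ ℓ) r
    exponent-upper {r} t/e<r = *-upper {ε} {ι t} {r} (√ ℓ) 0<ε (ι-nonNeg t) √ℓ-upper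
      (subst (_< r) (sym εt≡) t/e<r)

    2^≤ : ∀ {χ} → 2 ℕ.^ t ℕ.≤ χ ℕ.^ suc e → 2^ (fromℚ ε *ℝ √ ℓ) ≤ℝ fromℕ χ
    2^≤ {χ} h = 2^-upper-bound (fromℚ ε *ℝ √ ℓ) e t exponent-upper (ι-nonNeg χ)
      (subst₂ _≤_ (ι-^ 2 t) (ι-^ χ (suc e)) (ι-mono-≤ h))

    ≤n2^- : ∀ {n α} → 1 ℕ.≤ n → 1 ℕ.≤ α → α ℕ.^ suc e ℕ.* 2 ℕ.^ t ℕ.≤ n ℕ.^ suc e →
      fromℕ α ≤ℝ fromℕ n *ℝ 2^ (-ℝ (fromℚ ε *ℝ √ ℓ))
    ≤n2^- {n} {α} 1≤n 1≤α h q q<α =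
      let 0<n = ι-pos {n} 1≤n
          ρ , 0<ρ , ρn≡α = divide {ι α} {ι n} (ι-pos {α} 1≤α) 0<n
      in product-lower {ι n} {ρ} (2^ (-ℝ (fromℚ ε *ℝ √ ℓ))) 0<n 0<ρ
           (2^-lower-bound (fromℚ ε *ℝ √ ℓ) e t {ρ} exponent-upper 0<ρ (ratio-bound e t {n} {α} 0<n h {ρ} ρn≡α))
           q (subst (q <_) (trans (sym ρn≡α) (ℚₚ.*-comm ρ (ι n))) q<α)

open Reals

open import Data.Nat as ℕ
  using (zero; suc; _+_; _*_; _^_; _∸_; _/_; _%_; _≤_; _<_; _≤?_; z≤n; s≤s; _⊓_; _⊔_; >-nonZero)
import Data.Nat.Properties as ℕₚ
import Data.Nat.DivMod as DivMod
open import Data.Nat.Tactic.RingSolver using (solve-∀)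
import Data.Rational as ℚ
import Data.Rational.Properties as ℚₚ
open import Data.Bool using (Bool; true; false; if_then_else_)
open import Data.Fin as Fin
  using (Fin; zero; suc; combine; remQuot; toℕ; fromℕ<; opposite; finToFun; funToFin)
import Data.Fin.Properties as Finₚ
open import Data.Fin.Subset using (Subset; _∈_; ∣_∣; ⁅_⁆) renaming (⊥ to ∅)
import Data.Fin.Subset.Properties as Subsetₚ
open import Data.Product using (_,_; proj₁; proj₂)
open import Data.Sum as Sum using (_⊎_; inj₁; inj₂; [_,_]′)
open import Data.Empty using (⊥; ⊥-elim)
open import Data.Vec using (Vec; []; _∷_; lookup; tabulate; concat; _++_)
import Data.Vec.Properties as Vecₚ
open import Function using (_∘_; Injective)
open import Level using (Level)
open import Relation.Nullary using (¬_; yes; no; Dec; does)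
open import Relation.Nullary.Decidable using (map′; _×-dec_; _⊎-dec_; _→-dec_; ¬?; toWitness)
open import Relation.Binary.Definitions using (tri<; tri≈; tri>)
open import Relation.Binary.PropositionalEquality
open import Algebra.Properties.CommutativeMonoid.Sum ℕₚ.+-0-commutativeMonoid
  using (sum; sum-cong-≗; ∑-distrib-+)
open import Algebra.Properties.CommutativeMonoid.Sum ℕₚ.*-1-commutativeMonoid using ()
  renaming (sum to ∏; sum-cong-≗ to ∏-cong; ∑-distrib-+ to ∏-distrib-*; ∑-comm to ∏-comm)

-- Planar configurations on a grid and their covering pairs.

record Config (I : Set) : Set where
  field
    {width height} : ℕ
    x              : I → Fin width
    y              : I → Fin height
    x-injective    : Injective _≡_ _≡_ x
    y-injective    : Injective _≡_ _≡_ y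

  -- The covering relation of the dominance order: such i and j are the lower
  -- left and upper right corners of a rectangle which is empty otherwise.
  Cover : I → I → Set
  Cover i j = x i Fin.< x j × y i Fin.< y j ×
    (∀ k → x i Fin.≤ x k → x k Fin.≤ x j → y i Fin.≤ y k → y k Fin.≤ y j → k ≡ i ⊎ k ≡ j)


open Config using (Cover)

pull : ∀ {I J : Set} (f : J → I) → Injective _≡_ _≡_ f → Config I → Config J
pull f f-inj P = record
  { x = x ∘ f ; y = y ∘ f
  ; x-injective = f-inj ∘ x-injective ; y-injective = f-inj ∘ y-injective }
  where open Config P

pull-Cover : ∀ {I J : Set} {f : J → I} (f-inj : Injective _≡_ _≡_ f) (P : Config I) {i j} →
  Cover P (f i) (f j) → Cover (pull f f-inj P) i j
pull-Cover {f = f} f-inj P {i} {j} (x< , y< , cover) =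
  x< , y< , λ k a b c d → Sum.map f-inj f-inj (cover (f k) a b c d)

combine-lex : ∀ {m n} (i i′ : Fin m) (j j′ : Fin n) → combine i j Fin.≤ combine i′ j′ →
  i Fin.< i′ ⊎ i ≡ i′ × j Fin.≤ j′
combine-lex {n = n} i i′ j j′ h with Finₚ.<-cmp i i′
... | tri< i<i′ _ _ = inj₁ i<i′
... | tri> _ _ i>i′ = ⊥-elim (ℕₚ.<⇒≱ (Finₚ.combine-monoˡ-< j′ j i>i′) h)
... | tri≈ _ refl _ = inj₂ (refl , ℕₚ.+-cancelˡ-≤ (n * toℕ i) _ _
  (subst₂ _≤_ (Finₚ.toℕ-combine i j) (Finₚ.toℕ-combine i j′) h))

combine-monoʳ-< : ∀ {m n} (i : Fin m) {j k : Fin n} → j Fin.< k → combine i j Fin.< combine i k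
combine-monoʳ-< {n = n} i {j} {k} j<k = subst₂ _<_
  (sym (Finₚ.toℕ-combine i j)) (sym (Finₚ.toℕ-combine i k)) (ℕₚ.+-monoʳ-< (n * toℕ i) j<k)

opposite-cancel-≤ : ∀ {n} {i j : Fin n} → opposite i Fin.≤ opposite j → j Fin.≤ i
opposite-cancel-≤ {n} {i} {j} h = ℕₚ.≮⇒≥ λ i<j → ℕₚ.<⇒≱
  (subst₂ _<_ (sym (Finₚ.opposite-prop j)) (sym (Finₚ.opposite-prop i))
    (ℕₚ.∸-monoʳ-< (s≤s i<j) (Finₚ.toℕ<n j))) h

opposite-injective : ∀ {n} {i j : Fin n} → opposite i ≡ opposite j → i ≡ j
opposite-injective {i = i} {j} eq =
  trans (sym (Finₚ.opposite-involutive i)) (trans (cong opposite eq) (Finₚ.opposite-involutive j))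

side : Bool → Fin 2
side false = zero
side true  = suc zero

-- Adding a digit: stacked copies and coloured lines.

module _ {I : Set} {K : ℕ} (P : Config I) (c : I → Vec Bool K) where
  open Config P hiding (Cover)

  colour : I → Fin K → Fin 2
  colour i w = side (lookup (c i) w)

  -- K interleaved copies of P.  The points (·, i) form a line; the second digit of the
  -- x-coordinate puts its colour class false to the left of its colour class true, and the
  -- third reverses each class.
  stack : Config (Fin K × I)
  stack = record
    { x = λ (w , i) → combine (x i) (combine (colour i w) (opposite w))
    ; y = λ (w , i) → combine w (y i)
    ; x-injective = x-inj
    ; y-injective = λ { {w , i} {w′ , i′} eq → let w≡ , yi≡ = Finₚ.combine-injective w (y i) w′ (y i′) eq in
        cong₂ _,_ w≡ (y-injective yi≡) }
    }
    where
    x-inj : Injective _≡_ _≡_ (λ ((w , i) : Fin K × I) → combine (x i) (combine (colour i w) (opposite w)))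
    x-inj {w , i} {w′ , i′} eq with Finₚ.combine-injective (x i) _ (x i′) _ eq
    ... | xi≡ , eq′ with x-injective xi≡
    ... | refl = cong (_, i) (opposite-injective
      (Finₚ.combine-injectiveʳ (colour i w) (opposite w) (colour i w′) (opposite w′) eq′))

  private module S = Config stack

  -- The copy is the leading digit of `y`, so whatever lies between two points of copy `w` in height
  -- belongs to copy `w`; there the leading digit of `x` reduces emptiness to that in `P`.
  stack-copy : ∀ w {i j} → Cover P i j → Cover stack (w , i) (w , j)
  stack-copy w {i} {j} (x< , y< , cover) =
    Finₚ.combine-monoˡ-< _ _ x< , combine-monoʳ-< w y< , λ { (v , k) → between v k }
    where
    lex-≤ : ∀ {m n} (a a′ : Fin m) (b b′ : Fin n) → combine a b Fin.≤ combine a′ b′ → a Fin.≤ a′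
    lex-≤ a a′ b b′ h with combine-lex a a′ b b′ h
    ... | inj₁ a<a′       = ℕₚ.<⇒≤ a<a′
    ... | inj₂ (refl , _) = ℕₚ.≤-refl
    between : ∀ v k → S.x (w , i) Fin.≤ S.x (v , k) → S.x (v , k) Fin.≤ S.x (w , j) →
      S.y (w , i) Fin.≤ S.y (v , k) → S.y (v , k) Fin.≤ S.y (w , j) →
      (v , k) ≡ (w , i) ⊎ (v , k) ≡ (w , j)
    between v k x₁ x₂ y₁ y₂ with combine-lex w v (y i) (y k) y₁ | combine-lex v w (y k) (y j) y₂
    ... | inj₁ w<v | inj₁ v<w           = ⊥-elim (ℕₚ.<-asym w<v v<w)
    ... | inj₁ w<v | inj₂ (refl , _)    = ⊥-elim (ℕₚ.<-irrefl refl w<v)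
    ... | inj₂ (refl , _) | inj₁ v<w    = ⊥-elim (ℕₚ.<-irrefl refl v<w)
    ... | inj₂ (refl , yi≤) | inj₂ (_ , ≤yj) = Sum.map (cong (w ,_)) (cong (w ,_))
      (cover k (lex-≤ (x i) (x k) _ _ x₁) (lex-≤ (x k) (x j) _ _ x₂) yi≤ ≤yj)

  -- The leading digit of `x` confines the rectangle to line `i`. A point of colour false in it is
  -- to the right of `v`, hence not higher because its class decreases, and also not lower, so it is
  -- `v`. Colour true leads to `w` in the same way.
  stack-line : ∀ i {v w} → v Fin.< w → lookup (c i) v ≡ false → lookup (c i) w ≡ true →
    Cover stack (v , i) (w , i)
  stack-line i {v} {w} v<w cv cw =
    combine-monoʳ-< (x i) (Finₚ.combine-monoˡ-< (opposite v) (opposite w) side<) ,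
    Finₚ.combine-monoˡ-< (y i) (y i) v<w , λ { (u , k) → between u k }
    where
    side< : colour i v Fin.< colour i w
    side< rewrite cv | cw = s≤s z≤n
    between : ∀ u k → S.x (v , i) Fin.≤ S.x (u , k) → S.x (u , k) Fin.≤ S.x (w , i) →
      S.y (v , i) Fin.≤ S.y (u , k) → S.y (u , k) Fin.≤ S.y (w , i) →
      (u , k) ≡ (v , i) ⊎ (u , k) ≡ (w , i)
    between u k x₁ x₂ y₁ y₂
      with combine-lex (x i) (x k) _ _ x₁ | combine-lex (x k) (x i) _ _ x₂
    ... | inj₁ i<k | inj₁ k<i        = ⊥-elim (ℕₚ.<-asym i<k k<i)
    ... | inj₁ i<k | inj₂ (k≡i , _)  = ⊥-elim (ℕₚ.<-irrefl (cong toℕ (sym k≡i)) i<k)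
    ... | inj₂ (i≡k , _) | inj₁ k<i  = ⊥-elim (ℕₚ.<-irrefl (cong toℕ (sym i≡k)) k<i)
    ... | inj₂ (xi≡xk , x₁′) | inj₂ (_ , x₂′) with x-injective xi≡xk
    ... | refl = by-colour (lookup (c i) u) refl
      where
      y-≤ : ∀ {a b : Fin K} → combine a (y i) Fin.≤ combine b (y i) → a Fin.≤ b
      y-≤ {a} {b} h with combine-lex a b (y i) (y i) h
      ... | inj₁ a<b        = ℕₚ.<⇒≤ a<b
      ... | inj₂ (refl , _) = ℕₚ.≤-refl
      by-colour : ∀ b → lookup (c i) u ≡ b → (u , i) ≡ (v , i) ⊎ (u , i) ≡ (w , i)
      by-colour false cu with combine-lex (colour i v) (colour i u) _ _ x₁′
      ... | inj₁ cv<cu   = ⊥-elim (ℕₚ.<-irrefl (cong (toℕ ∘ side) (trans cv (sym cu))) cv<cu)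
      ... | inj₂ (_ , h)  = inj₁ (cong (_, i) (Finₚ.≤-antisym (opposite-cancel-≤ {i = v} h) (y-≤ y₁)))
      by-colour true cu with combine-lex (colour i u) (colour i w) _ _ x₂′
      ... | inj₁ cu<cw   = ⊥-elim (ℕₚ.<-irrefl (cong (toℕ ∘ side) (trans cu (sym cw))) cu<cw)
      ... | inj₂ (_ , h)  = inj₂ (cong (_, i) (Finₚ.≤-antisym (y-≤ y₂) (opposite-cancel-≤ {i = u} h)))

-- Finite products and sums over all subsets.

∏-mono : ∀ {n} {f g : Fin n → ℕ} → (∀ i → f i ≤ g i) → ∏ f ≤ ∏ g
∏-mono {zero}  f≤g = ℕₚ.≤-refl
∏-mono {suc n} f≤g = ℕₚ.*-mono-≤ (f≤g zero) (∏-mono (f≤g ∘ suc))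

∏-const : ∀ n a → ∏ {n} (λ _ → a) ≡ a ^ n
∏-const zero    a = refl
∏-const (suc n) a = cong (a *_) (∏-const n a)

∏-pos : ∀ {n} {f : Fin n → ℕ} → (∀ i → 1 ≤ f i) → 1 ≤ ∏ f
∏-pos {n} 1≤f = ℕₚ.≤-trans (ℕₚ.≤-reflexive (sym (trans (∏-const n 1) (ℕₚ.^-zeroˡ n)))) (∏-mono 1≤f)

sumBool : (Bool → ℕ) → ℕ
sumBool f = f true + f false

-- The summation `S` over a single entry is a parameter: `sumBool` yields sums over subsets, and
-- `∑ₛ` yields sums over tuples of subsets, as which the subsets of a stack are viewed.
sumVec : ∀ {A : Set} → ((A → ℕ) → ℕ) → ∀ n → (Vec A n → ℕ) → ℕ
sumVec S zero    f = f []
sumVec S (suc n) f = S λ a → sumVec S n λ v → f (a ∷ v)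

∑ₛ : ∀ {n} → (Subset n → ℕ) → ℕ
∑ₛ {n} = sumVec sumBool n

∑ₛ-cong : ∀ {n} {f g : Subset n → ℕ} → (∀ A → f A ≡ g A) → ∑ₛ f ≡ ∑ₛ g
∑ₛ-cong {zero}  f≗g = f≗g []
∑ₛ-cong {suc n} f≗g = cong₂ _+_ (∑ₛ-cong (f≗g ∘ (true ∷_))) (∑ₛ-cong (f≗g ∘ (false ∷_)))

∑ₛ-mono : ∀ {n} {f g : Subset n → ℕ} → (∀ A → f A ≤ g A) → ∑ₛ f ≤ ∑ₛ g
∑ₛ-mono {zero}  f≤g = f≤g []
∑ₛ-mono {suc n} f≤g = ℕₚ.+-mono-≤ (∑ₛ-mono (f≤g ∘ (true ∷_))) (∑ₛ-mono (f≤g ∘ (false ∷_)))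

∑ₛ-*ˡ : ∀ {n} a (f : Subset n → ℕ) → ∑ₛ (λ A → a * f A) ≡ a * ∑ₛ f
∑ₛ-*ˡ {zero}  a f = refl
∑ₛ-*ˡ {suc n} a f = trans
  (cong₂ _+_ (∑ₛ-*ˡ a (f ∘ (true ∷_))) (∑ₛ-*ˡ a (f ∘ (false ∷_)))) (sym (ℕₚ.*-distribˡ-+ a _ _))

∑ₛ-*ʳ : ∀ {n} (f : Subset n → ℕ) a → ∑ₛ (λ A → f A * a) ≡ ∑ₛ f * a
∑ₛ-*ʳ f a = trans (∑ₛ-cong λ A → ℕₚ.*-comm (f A) a) (trans (∑ₛ-*ˡ a f) (ℕₚ.*-comm a _))

∑ₛ-+ : ∀ {n} (f g : Subset n → ℕ) → ∑ₛ (λ A → f A + g A) ≡ ∑ₛ f + ∑ₛ g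
∑ₛ-+ {zero}  f g = refl
∑ₛ-+ {suc n} f g = trans
  (cong₂ _+_ (∑ₛ-+ (f ∘ (true ∷_)) (g ∘ (true ∷_))) (∑ₛ-+ (f ∘ (false ∷_)) (g ∘ (false ∷_))))
  (interchange (∑ₛ (f ∘ (true ∷_))) (∑ₛ (g ∘ (true ∷_))) (∑ₛ (f ∘ (false ∷_))) (∑ₛ (g ∘ (false ∷_))))
  where
  interchange : ∀ a b c d → (a + b) + (c + d) ≡ (a + c) + (b + d)
  interchange = solve-∀

∑ₛ-comm : ∀ {m n} (f : Subset m → Subset n → ℕ) →
  ∑ₛ (λ A → ∑ₛ λ B → f A B) ≡ ∑ₛ (λ B → ∑ₛ λ A → f A B)
∑ₛ-comm {zero}  f = refl
∑ₛ-comm {suc m} f = trans (cong₂ _+_ (∑ₛ-comm (f ∘ (true ∷_))) (∑ₛ-comm (f ∘ (false ∷_))))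
  (sym (∑ₛ-+ (λ B → ∑ₛ λ A → f (true ∷ A) B) (λ B → ∑ₛ λ A → f (false ∷ A) B)))

f≤∑ₛf : ∀ {n} (f : Subset n → ℕ) A → f A ≤ ∑ₛ f
f≤∑ₛf f []          = ℕₚ.≤-refl
f≤∑ₛf f (true ∷ A)  = ℕₚ.≤-trans (f≤∑ₛf (f ∘ (true ∷_)) A) (ℕₚ.m≤m+n _ _)
f≤∑ₛf f (false ∷ A) = ℕₚ.≤-trans (f≤∑ₛf (f ∘ (false ∷_)) A) (ℕₚ.m≤n+m _ _)

∑ₛ-++ : ∀ m {n} (f : Subset (m + n) → ℕ) → ∑ₛ f ≡ ∑ₛ {m} λ A → ∑ₛ {n} λ B → f (A ++ B)
∑ₛ-++ zero    f = refl
∑ₛ-++ (suc m) f = cong₂ _+_ (∑ₛ-++ m (f ∘ (true ∷_))) (∑ₛ-++ m (f ∘ (false ∷_)))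

∑ₛ-concat : ∀ K {N} (f : Subset (K * N) → ℕ) → ∑ₛ f ≡ sumVec (∑ₛ {N}) K (f ∘ concat)
∑ₛ-concat zero    f = refl
∑ₛ-concat (suc K) {N} f = trans (∑ₛ-++ N f) (∑ₛ-cong λ A → ∑ₛ-concat K (λ B → f (A ++ B)))

sumVec-cong : ∀ {N} K {f g : Vec (Subset N) K → ℕ} → (∀ v → f v ≡ g v) →
  sumVec ∑ₛ K f ≡ sumVec ∑ₛ K g
sumVec-cong zero    f≗g = f≗g []
sumVec-cong (suc K) f≗g = ∑ₛ-cong λ A → sumVec-cong K (f≗g ∘ (A ∷_))

sumVec-*ˡ : ∀ {N} K a (f : Vec (Subset N) K → ℕ) → sumVec ∑ₛ K (λ v → a * f v) ≡ a * sumVec ∑ₛ K f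
sumVec-*ˡ zero    a f = refl
sumVec-*ˡ (suc K) a f = trans (∑ₛ-cong λ A → sumVec-*ˡ K a (f ∘ (A ∷_))) (∑ₛ-*ˡ a (λ A → sumVec ∑ₛ K (f ∘ (A ∷_))))

-- Distributivity: the entries of a tuple vary independently.
sumVec-∏ : ∀ {N} K (f : Subset N → ℕ) → sumVec ∑ₛ K (λ v → ∏ (f ∘ lookup v)) ≡ ∑ₛ f ^ K
sumVec-∏ zero    f = refl
sumVec-∏ (suc K) f = trans
  (∑ₛ-cong λ A → trans (sumVec-*ˡ K (f A) _) (cong (f A *_) (sumVec-∏ K f))) (∑ₛ-*ʳ f _)

twice : ∀ a b → 2 * a * b ≡ a * b + a * b
twice = solve-∀

-- The cheaper of the two witnesses serves for both halves. This is the expectation argument with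
-- the division cleared.
average : ∀ {n} (f : Subset n → ℕ) → ∃ λ A → 2 ^ n * f A ≤ ∑ₛ f
average {zero}  f = [] , ℕₚ.≤-reflexive (ℕₚ.*-identityˡ (f []))
average {suc n} f with average (f ∘ (true ∷_)) | average (f ∘ (false ∷_))
... | A , A≤ | B , B≤ with ℕₚ.≤-total (f (true ∷ A)) (f (false ∷ B))
... | inj₁ fA≤fB = true ∷ A , ℕₚ.≤-trans (ℕₚ.≤-reflexive (twice (2 ^ n) _))
  (ℕₚ.+-mono-≤ A≤ (ℕₚ.≤-trans (ℕₚ.*-monoʳ-≤ (2 ^ n) fA≤fB) B≤))
... | inj₂ fB≤fA = false ∷ B , ℕₚ.≤-trans (ℕₚ.≤-reflexive (twice (2 ^ n) _))
  (ℕₚ.+-mono-≤ (ℕₚ.≤-trans (ℕₚ.*-monoʳ-≤ (2 ^ n) fB≤fA) A≤) B≤)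

-- The colourings of the lines are fixed one at a time (method of conditional
-- expectations), so that no probability space of all colourings is needed.
derandomize : ∀ {m K} N (W : Subset m → ℕ) (T : Fin N → Subset m → Subset K)
  (g : Subset K → Subset K → ℕ) → ∃ λ (c : Fin N → Subset K) →
  (2 ^ K) ^ N * ∑ₛ (λ A → W A * ∏ λ i → g (c i) (T i A)) ≤
  ∑ₛ (λ A → W A * ∏ λ i → ∑ₛ λ b → g b (T i A))
derandomize zero W T g = (λ ()) , ℕₚ.≤-reflexive (ℕₚ.*-identityˡ _)
derandomize {m} {K} (suc N) W T g = c , (begin
  2 ^ K * (2 ^ K) ^ N * ∑ₛ (λ A → W A * (g b (T zero A) * ∏ (λ i → g (c′ i) (T (suc i) A))))
    ≡⟨ cong (2 ^ K * (2 ^ K) ^ N *_) (∑ₛ-cong λ A → sym (ℕₚ.*-assoc (W A) _ _)) ⟩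
  2 ^ K * (2 ^ K) ^ N * ∑ₛ (λ A → W A * g b (T zero A) * ∏ (λ i → g (c′ i) (T (suc i) A)))
    ≡⟨ ℕₚ.*-assoc (2 ^ K) _ _ ⟩
  2 ^ K * ((2 ^ K) ^ N * ∑ₛ (λ A → W A * g b (T zero A) * ∏ (λ i → g (c′ i) (T (suc i) A))))
    ≤⟨ ℕₚ.*-monoʳ-≤ (2 ^ K) (proj₂ rest) ⟩
  2 ^ K * ∑ₛ (λ A → W A * g b (T zero A) * R A)
    ≤⟨ proj₂ first ⟩
  ∑ₛ (λ b → ∑ₛ λ A → W A * g b (T zero A) * R A)
    ≡⟨ ∑ₛ-comm (λ b A → W A * g b (T zero A) * R A) ⟩
  ∑ₛ (λ A → ∑ₛ λ b → W A * g b (T zero A) * R A)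
    ≡⟨ (∑ₛ-cong λ A → trans (∑ₛ-*ʳ (λ b → W A * g b (T zero A)) (R A))
         (trans (cong (_* R A) (∑ₛ-*ˡ (W A) (λ b → g b (T zero A)))) (ℕₚ.*-assoc (W A) _ _))) ⟩
  ∑ₛ (λ A → W A * (∑ₛ (λ b → g b (T zero A)) * R A))
    ∎)
  where
  open ℕₚ.≤-Reasoning
  R : Subset m → ℕ
  R A = ∏ λ i → ∑ₛ λ b → g b (T (suc i) A)
  first = average λ b → ∑ₛ λ A → W A * g b (T zero A) * R A
  b = proj₁ first
  rest = derandomize N (λ A → W A * g b (T zero A)) (T ∘ suc) g
  c′ = proj₁ rest
  c : Fin (suc N) → Subset K
  c zero    = b
  c (suc i) = c′ i

-- Weights of sets, and the count of colourings compatible with a set.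

pick : ℕ → ℕ → Bool → ℕ
pick a b t = if t then a else b

-- As a product over positions, the weight splits over columns and can be regrouped between rows and
-- columns.
weight : ∀ {n} → ℕ → ℕ → Subset n → ℕ
weight a b A = ∏ λ i → pick a b (lookup A i)

∑ₛ-weight : ∀ n a b → ∑ₛ {n} (weight a b) ≡ (a + b) ^ n
∑ₛ-weight zero    a b = refl
∑ₛ-weight (suc n) a b = trans
  (cong₂ _+_ (trans (∑ₛ-*ˡ {n} a (weight a b)) (cong (a *_) (∑ₛ-weight n a b)))
             (trans (∑ₛ-*ˡ {n} b (weight a b)) (cong (b *_) (∑ₛ-weight n a b))))
  (sym (ℕₚ.*-distribʳ-+ _ a b))

weight-++ : ∀ {m n} a b (A : Subset m) (B : Subset n) →
  weight a b (A ++ B) ≡ weight a b A * weight a b B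
weight-++ a b []      B = sym (ℕₚ.*-identityˡ _)
weight-++ a b (t ∷ A) B =
  trans (cong (pick a b t *_) (weight-++ a b A B)) (sym (ℕₚ.*-assoc (pick a b t) _ _))

weight-concat : ∀ {K N} a b (v : Vec (Subset N) K) →
  weight a b (concat v) ≡ ∏ λ w → weight a b (lookup v w)
weight-concat a b []      = refl
weight-concat a b (A ∷ v) =
  trans (weight-++ a b A (concat v)) (cong (weight a b A *_) (weight-concat a b v))

-- The count of compatible colourings contributes a factor 2 for every absent point. This is how `b`
-- doubles with each digit.
weight-double : ∀ {n} a b (A : Subset n) → weight a b A * weight 1 2 A ≡ weight a (2 * b) A
weight-double a b A = trans
  (sym (∏-distrib-* (λ i → pick a b (lookup A i)) (λ i → pick 1 2 (lookup A i))))
  (∏-cong λ i → pick-double (lookup A i))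
  where
  pick-double : ∀ t → pick a b t * pick 1 2 t ≡ pick a (2 * b) t
  pick-double true  = ℕₚ.*-identityʳ a
  pick-double false = ℕₚ.*-comm b 2

weight-∣∣ : ∀ {n} a (A : Subset n) → weight a 1 A ≡ a ^ ∣ A ∣
weight-∣∣ a []          = refl
weight-∣∣ a (true ∷ A)  = cong (a *_) (weight-∣∣ a A)
weight-∣∣ a (false ∷ A) = trans (ℕₚ.*-identityˡ _) (weight-∣∣ a A)

-- isDescending c T ≡ 1 if, along T, the colour true always precedes the colour false, that
-- is, if T contains no covering pair of a line with colouring c; otherwise it is 0.
isAllFalse isDescending : ∀ {K} → Subset K → Subset K → ℕ
isAllFalse []          []          = 1
isAllFalse (true ∷ c)  (true ∷ T)  = 0
isAllFalse (false ∷ c) (true ∷ T)  = isAllFalse c T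
isAllFalse (_ ∷ c)     (false ∷ T) = isAllFalse c T
isDescending []          []          = 1
isDescending (true ∷ c)  (true ∷ T)  = isDescending c T
isDescending (false ∷ c) (true ∷ T)  = isAllFalse c T
isDescending (_ ∷ c)     (false ∷ T) = isDescending c T

-- A colouring is forced on `T` and free elsewhere, and `weight 1 2 T` is 2^(K - |T|).
∑-isAllFalse : ∀ {K} (T : Subset K) → ∑ₛ (λ c → isAllFalse c T) ≡ weight 1 2 T
∑-isAllFalse []          = refl
∑-isAllFalse {suc K} (true ∷ T)  = trans (cong₂ _+_ (∑0 K) (∑-isAllFalse T)) (sym (ℕₚ.*-identityˡ _))
  where
  ∑0 : ∀ n → ∑ₛ {n} (λ _ → 0) ≡ 0
  ∑0 n = ∑ₛ-*ˡ {n} 0 (λ _ → 0)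
∑-isAllFalse (false ∷ T) = trans (cong₂ _+_ (∑-isAllFalse T) (∑-isAllFalse T))
  (cong (weight 1 2 T +_) (sym (ℕₚ.+-identityʳ _)))

-- Along `T` only the place of the switch from true to false can be chosen, in |T| + 1 ways. The
-- cruder factor `suc K` is independent of `T` and can therefore be taken out of a sum over sets.
∑-isDescending : ∀ {K} (T : Subset K) → ∑ₛ (λ c → isDescending c T) ≤ suc K * weight 1 2 T
∑-isDescending []                  = ℕₚ.≤-refl
∑-isDescending {suc K} (true ∷ T)  = begin
  ∑ₛ (λ c → isDescending c T) + ∑ₛ (λ c → isAllFalse c T)
    ≤⟨ ℕₚ.+-mono-≤ (∑-isDescending T) (ℕₚ.≤-reflexive (∑-isAllFalse T)) ⟩
  suc K * weight 1 2 T + weight 1 2 T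
    ≡⟨ rearrange K (weight 1 2 T) ⟩
  suc (suc K) * (1 * weight 1 2 T) ∎
  where
  open ℕₚ.≤-Reasoning
  rearrange : ∀ k w → suc k * w + w ≡ suc (suc k) * (1 * w)
  rearrange = solve-∀
∑-isDescending {suc K} (false ∷ T) = begin
  ∑ₛ (λ c → isDescending c T) + ∑ₛ (λ c → isDescending c T)
    ≤⟨ ℕₚ.+-mono-≤ (∑-isDescending T) (∑-isDescending T) ⟩
  suc K * weight 1 2 T + suc K * weight 1 2 T
    ≡⟨ rearrange K (weight 1 2 T) ⟩
  suc K * (2 * weight 1 2 T)
    ≤⟨ ℕₚ.*-monoˡ-≤ (2 * weight 1 2 T) (ℕₚ.n≤1+n (suc K)) ⟩
  suc (suc K) * (2 * weight 1 2 T) ∎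
  where
  open ℕₚ.≤-Reasoning
  rearrange : ∀ k w → suc k * w + suc k * w ≡ suc k * (2 * w)
  rearrange = solve-∀

infix 4 _∈ᵇ_
_∈ᵇ_ : ∀ {n} → Fin n → Subset n → Set
i ∈ᵇ A = lookup A i ≡ true

isAllFalse-pos : ∀ {K} (c T : Subset K) → (∀ w → w ∈ᵇ T → lookup c w ≡ true → ⊥) → 1 ≤ isAllFalse c T
isAllFalse-pos []          []          h = ℕₚ.≤-refl
isAllFalse-pos (true ∷ c)  (true ∷ T)  h = ⊥-elim (h zero refl refl)
isAllFalse-pos (false ∷ c) (true ∷ T)  h = isAllFalse-pos c T (h ∘ suc)
isAllFalse-pos (true ∷ c)  (false ∷ T) h = isAllFalse-pos c T (h ∘ suc)
isAllFalse-pos (false ∷ c) (false ∷ T) h = isAllFalse-pos c T (h ∘ suc)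

isDescending-pos : ∀ {K} (c T : Subset K) →
  (∀ v w → v Fin.< w → v ∈ᵇ T → w ∈ᵇ T → lookup c v ≡ false → lookup c w ≡ true → ⊥) →
  1 ≤ isDescending c T
isDescending-pos []          []          h = ℕₚ.≤-refl
isDescending-pos (true ∷ c)  (true ∷ T)  h = isDescending-pos c T λ v w v<w → h (suc v) (suc w) (s≤s v<w)
isDescending-pos (false ∷ c) (true ∷ T)  h = isAllFalse-pos c T λ w w∈ cw →
  h zero (suc w) (s≤s z≤n) refl w∈ refl cw
isDescending-pos (true ∷ c)  (false ∷ T) h = isDescending-pos c T λ v w v<w → h (suc v) (suc w) (s≤s v<w)
isDescending-pos (false ∷ c) (false ∷ T) h = isDescending-pos c T λ v w v<w → h (suc v) (suc w) (s≤s v<w)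

-- The weighted count of cover-free sets and its inductive step.

CoverFree : ∀ {n} → Config (Fin n) → Subset n → Set
CoverFree P A = ∀ {i j} → i ∈ᵇ A → j ∈ᵇ A → ¬ Cover P i j

-- χ dominates the indicator function of the sets without covering pairs.
record Construction (N a b s B : ℕ) : Set where
  field
    config  : Config (Fin N)
    χ       : Subset N → ℕ
    χ-pos   : ∀ A → CoverFree config A → 1 ≤ χ A
    ∑-bound : s * ∑ₛ (λ A → weight a b A * χ A) ≤ B

chain : ∀ n → Config (Fin n)
chain n = record { x = λ i → i ; y = λ i → i ; x-injective = λ eq → eq ; y-injective = λ eq → eq }

-- The trivial `χ` suffices here, since all savings come from the steps. The free size `n` later
-- yields every multiple of a power of `K`.
base : ∀ n a b → Construction n a b 1 ((a + b) ^ n)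
base n a b = record
  { config = chain n ; χ = λ _ → 1 ; χ-pos = λ _ _ → ℕₚ.≤-refl
  ; ∑-bound = ℕₚ.≤-reflexive (trans (ℕₚ.*-identityˡ _)
      (trans (∑ₛ-cong {n} λ A → ℕₚ.*-identityʳ _) (∑ₛ-weight n a b))) }

remQuot-injective : ∀ K N → Injective _≡_ _≡_ (remQuot {K} N)
remQuot-injective K N {i} {j} eq = trans (sym (Finₚ.combine-remQuot {K} N i))
  (trans (cong (λ (v , k) → combine v k) eq) (Finₚ.combine-remQuot {K} N j))

module Step {N : ℕ} (K a b s B : ℕ) (C : Construction N a (2 * b) s B) where
  open Construction C

  column : Subset (K * N) → Fin K → Subset N
  column A w = tabulate λ i → lookup A (combine w i)

  row : Fin N → Subset (K * N) → Subset K
  row i A = tabulate λ w → lookup A (combine w i)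

  -- The factors which do not depend on the colourings, and which can thus be fixed before
  -- `derandomize` chooses these.
  W : Subset (K * N) → ℕ
  W A = weight a b A * ∏ (χ ∘ column A)

  choice = derandomize N W row isDescending
  c = proj₁ choice

  config′ : Config (Fin (K * N))
  config′ = pull (remQuot {K} N) (remQuot-injective K N) (stack config c)

  -- One factor for each copy, justified by `stack-copy`, and one for each line, justified by
  -- `stack-line`.
  χ′ : Subset (K * N) → ℕ
  χ′ A = ∏ (χ ∘ column A) * ∏ (λ i → isDescending (c i) (row i A))

  χ′-pos : ∀ A → CoverFree config′ A → 1 ≤ χ′ A
  χ′-pos A free = ℕₚ.*-mono-≤
    (∏-pos λ w → χ-pos (column A w) λ {i} {j} i∈ j∈ i⋖j →
      free (trans (sym (Vecₚ.lookup∘tabulate _ i)) i∈) (trans (sym (Vecₚ.lookup∘tabulate _ j)) j∈)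
        (lift (stack-copy config c w i⋖j)))
    (∏-pos λ i → isDescending-pos (c i) (row i A) λ v w v<w v∈ w∈ cv cw →
      free (trans (sym (Vecₚ.lookup∘tabulate _ v)) v∈) (trans (sym (Vecₚ.lookup∘tabulate _ w)) w∈)
        (lift (stack-line config c i v<w cv cw)))
    where
    lift : ∀ {v w i j} → Cover (stack config c) (v , i) (w , j) →
           Cover config′ (combine v i) (combine w j)
    lift {v} {w} {i} {j} cov = pull-Cover (remQuot-injective K N) (stack config c)
      (subst₂ (Cover (stack config c)) (sym (Finₚ.remQuot-combine v i)) (sym (Finₚ.remQuot-combine w j)) cov)

  Z = ∑ₛ λ A → weight a (2 * b) A * χ A

  column-concat : ∀ (v : Vec (Subset N) K) w → column (concat v) w ≡ lookup v w
  column-concat v w = trans (Vecₚ.tabulate-cong (Vecₚ.lookup-concat v w)) (Vecₚ.tabulate∘lookup _)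

  rows-columns : ∀ (v : Vec (Subset N) K) →
    ∏ (λ i → weight 1 2 (row i (concat v))) ≡ ∏ (λ w → weight 1 2 (lookup v w))
  rows-columns v = trans
    (∏-cong λ i → ∏-cong λ w → cong (pick 1 2)
      (trans (Vecₚ.lookup∘tabulate _ w) (Vecₚ.lookup-concat v w i)))
    (∏-comm λ i w → pick 1 2 (lookup (lookup v w) i))

  -- Regrouping the line factors by columns turns the summand into a product over the copies, with
  -- `b` doubled. Only in this form does the sum over all sets become a `K`-th power.
  factor : ∀ (v : Vec (Subset N) K) →
    W (concat v) * ∏ (λ i → suc K * weight 1 2 (row i (concat v))) ≡
    suc K ^ N * ∏ (λ w → weight a (2 * b) (lookup v w) * χ (lookup v w))
  factor v = begin
    W (concat v) * ∏ (λ i → suc K * weight 1 2 (row i (concat v)))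
      ≡⟨ cong₂ (λ p q → p * ∏ χs′ * q) (weight-concat a b v)
           (trans (∏-distrib-* (λ _ → suc K) (λ i → weight 1 2 (row i (concat v))))
                  (cong₂ _*_ (∏-const N (suc K)) (rows-columns v))) ⟩
    ∏ ws * ∏ χs′ * (suc K ^ N * ∏ us)
      ≡⟨ cong (λ p → ∏ ws * p * (suc K ^ N * ∏ us)) (∏-cong λ w → cong χ (column-concat v w)) ⟩
    ∏ ws * ∏ χs * (suc K ^ N * ∏ us)
      ≡⟨ rearrange (∏ ws) (∏ χs) (suc K ^ N) (∏ us) ⟩
    suc K ^ N * (∏ ws * ∏ us * ∏ χs)
      ≡⟨ cong (λ p → suc K ^ N * (p * ∏ χs)) (sym (∏-distrib-* ws us)) ⟩
    suc K ^ N * (∏ (λ w → ws w * us w) * ∏ χs)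
      ≡⟨ cong (λ p → suc K ^ N * (p * ∏ χs)) (∏-cong λ w → weight-double a b (lookup v w)) ⟩
    suc K ^ N * (∏ (λ w → weight a (2 * b) (lookup v w)) * ∏ χs)
      ≡⟨ cong (suc K ^ N *_) (sym (∏-distrib-* (λ w → weight a (2 * b) (lookup v w)) χs)) ⟩
    suc K ^ N * ∏ (λ w → weight a (2 * b) (lookup v w) * χ (lookup v w)) ∎
    where
    open ≡-Reasoning
    ws us χs χs′ : Fin K → ℕ
    ws w  = weight a b (lookup v w)
    us w  = weight 1 2 (lookup v w)
    χs w  = χ (lookup v w)
    χs′ w = χ (column (concat v) w)
    rearrange : ∀ p q r s → p * q * (r * s) ≡ r * (p * s * q)
    rearrange = solve-∀

  step-bound : (2 ^ K) ^ N * ∑ₛ (λ A → weight a b A * χ′ A) ≤ suc K ^ N * Z ^ K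
  step-bound = begin
    (2 ^ K) ^ N * ∑ₛ (λ A → weight a b A * χ′ A)
      ≡⟨ cong ((2 ^ K) ^ N *_) (∑ₛ-cong {K * N} λ A → sym (ℕₚ.*-assoc (weight a b A)
           (∏ (χ ∘ column A)) (∏ λ i → isDescending (c i) (row i A)))) ⟩
    (2 ^ K) ^ N * ∑ₛ (λ A → W A * ∏ (λ i → isDescending (c i) (row i A)))
      ≤⟨ proj₂ choice ⟩
    ∑ₛ (λ A → W A * ∏ λ i → ∑ₛ λ b → isDescending b (row i A))
      ≤⟨ ∑ₛ-mono (λ A → ℕₚ.*-monoʳ-≤ (W A) (∏-mono λ i → ∑-isDescending (row i A))) ⟩
    ∑ₛ (λ A → W A * ∏ λ i → suc K * weight 1 2 (row i A))
      ≡⟨ ∑ₛ-concat K (λ A → W A * ∏ λ i → suc K * weight 1 2 (row i A)) ⟩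
    sumVec (∑ₛ {N}) K (λ v → W (concat v) * ∏ (λ i → suc K * weight 1 2 (row i (concat v))))
      ≡⟨ sumVec-cong K factor ⟩
    sumVec (∑ₛ {N}) K (λ v → suc K ^ N * ∏ (λ w → weight a (2 * b) (lookup v w) * χ (lookup v w)))
      ≡⟨ sumVec-*ˡ K (suc K ^ N) (λ v → ∏ (λ w → weight a (2 * b) (lookup v w) * χ (lookup v w))) ⟩
    suc K ^ N * sumVec (∑ₛ {N}) K (λ v → ∏ (λ w → weight a (2 * b) (lookup v w) * χ (lookup v w)))
      ≡⟨ cong (suc K ^ N *_) (sumVec-∏ K (λ A → weight a (2 * b) A * χ A)) ⟩
    suc K ^ N * Z ^ K ∎
    where open ℕₚ.≤-Reasoning

^-distribʳ-* : ∀ a b n → (a * b) ^ n ≡ a ^ n * b ^ n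
^-distribʳ-* a b zero    = refl
^-distribʳ-* a b (suc n) =
  trans (cong (a * b *_) (^-distribʳ-* a b n)) (interchange a b (a ^ n) (b ^ n))
  where
  interchange : ∀ a b c d → a * b * (c * d) ≡ a * c * (b * d)
  interchange = solve-∀

-- The denominators of the averages are collected in the scale `s`, which keeps the bound integral;
-- the `K` independent copies raise the previous scale and bound to the power `K`.
step : ∀ {N} K a b s B → Construction N a (2 * b) s B →
  Construction (K * N) a b (2 ^ (K * N) * s ^ K) (suc K ^ N * B ^ K)
step {N} K a b s B C = record
  { config = config′ ; χ = χ′ ; χ-pos = χ′-pos ; ∑-bound = begin
    2 ^ (K * N) * s ^ K * Z′      ≡⟨ cong (λ p → p * s ^ K * Z′) (sym (ℕₚ.^-*-assoc 2 K N)) ⟩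
    (2 ^ K) ^ N * s ^ K * Z′      ≡⟨ rearrange ((2 ^ K) ^ N) (s ^ K) Z′ ⟩
    s ^ K * ((2 ^ K) ^ N * Z′)    ≤⟨ ℕₚ.*-monoʳ-≤ (s ^ K) step-bound ⟩
    s ^ K * (suc K ^ N * Z ^ K)   ≡⟨ rearrange′ (s ^ K) (suc K ^ N) (Z ^ K) ⟩
    suc K ^ N * (s ^ K * Z ^ K)   ≡⟨ cong (suc K ^ N *_) (sym (^-distribʳ-* s Z K)) ⟩
    suc K ^ N * (s * Z) ^ K       ≤⟨ ℕₚ.*-monoʳ-≤ (suc K ^ N) (ℕₚ.^-monoˡ-≤ K (Construction.∑-bound C)) ⟩
    suc K ^ N * B ^ K             ∎ }
  where
  open Step K a b s B C
  open ℕₚ.≤-Reasoning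
  Z′ = ∑ₛ (λ A → weight a b A * χ′ A)
  rearrange : ∀ p q r → p * q * r ≡ q * (p * r)
  rearrange = solve-∀
  rearrange′ : ∀ p q r → p * (q * r) ≡ q * (p * r)
  rearrange′ = solve-∀

-- Iteration over the digits.

module Levels (K n₀ : ℕ) where

  size exponent : ℕ → ℕ
  size zero        = n₀
  size (suc m)     = K * size m
  exponent zero    = 0
  exponent (suc m) = size m + K * exponent m

  size≡ : ∀ m → size m ≡ K ^ m * n₀
  size≡ zero    = sym (ℕₚ.*-identityˡ n₀)
  size≡ (suc m) = trans (cong (K *_) (size≡ m)) (sym (ℕₚ.*-assoc K _ n₀))

  -- `exponent m` counts the lines in all `m` directions, each direction having size / K of them.
  K*exponent : ∀ m → K * exponent m ≡ m * size m
  K*exponent zero    = ℕₚ.*-zeroʳ K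
  K*exponent (suc m) = trans (cong (λ e → K * (size m + e)) (K*exponent m)) (rearrange K (size m) m)
    where
    rearrange : ∀ k z m → k * (z + m * z) ≡ suc m * (k * z)
    rearrange = solve-∀

  -- Followed down to the chain, `b` has doubled `m` times; there all sets are counted, which gives
  -- the power of `a + 2 ^ m * b`.
  iterate : ∀ m a b → Construction (size m) a b
    (2 ^ (m * size m)) (suc K ^ exponent m * (a + 2 ^ m * b) ^ size m)
  iterate zero a b = subst (Construction n₀ a b 1) eq (base n₀ a b)
    where
    eq : (a + b) ^ n₀ ≡ 1 * (a + 1 * b) ^ n₀
    eq = trans (cong (λ c → (a + c) ^ n₀) (sym (ℕₚ.*-identityˡ b))) (sym (ℕₚ.*-identityˡ _))
  iterate (suc m) a b = subst₂ (Construction (K * z) a b) scale≡ bound≡ (step K a b _ _ (iterate m a (2 * b)))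
    where
    open ≡-Reasoning
    z = size m
    e = exponent m
    scale≡ : 2 ^ (K * z) * (2 ^ (m * z)) ^ K ≡ 2 ^ (suc m * (K * z))
    scale≡ = begin
      2 ^ (K * z) * (2 ^ (m * z)) ^ K ≡⟨ cong (2 ^ (K * z) *_) (ℕₚ.^-*-assoc 2 (m * z) K) ⟩
      2 ^ (K * z) * 2 ^ (m * z * K)   ≡⟨ sym (ℕₚ.^-distribˡ-+-* 2 (K * z) (m * z * K)) ⟩
      2 ^ (K * z + m * z * K)         ≡⟨ cong (2 ^_) (rearrange K m z) ⟩
      2 ^ (suc m * (K * z))           ∎
      where
      rearrange : ∀ k m z → k * z + m * z * k ≡ suc m * (k * z)
      rearrange = solve-∀
    c = a + 2 ^ m * (2 * b)
    bound≡ : suc K ^ z * (suc K ^ e * c ^ z) ^ K ≡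
             suc K ^ (z + K * e) * (a + 2 ^ suc m * b) ^ (K * z)
    bound≡ = begin
      suc K ^ z * (suc K ^ e * c ^ z) ^ K
        ≡⟨ cong (suc K ^ z *_) (^-distribʳ-* (suc K ^ e) (c ^ z) K) ⟩
      suc K ^ z * ((suc K ^ e) ^ K * (c ^ z) ^ K)
        ≡⟨ cong₂ (λ p q → suc K ^ z * (p * q)) (power (suc K) e) (power c z) ⟩
      suc K ^ z * (suc K ^ (K * e) * c ^ (K * z))
        ≡⟨ sym (ℕₚ.*-assoc (suc K ^ z) _ _) ⟩
      suc K ^ z * suc K ^ (K * e) * c ^ (K * z)
        ≡⟨ cong (_* c ^ (K * z)) (sym (ℕₚ.^-distribˡ-+-* (suc K) z (K * e))) ⟩
      suc K ^ (z + K * e) * c ^ (K * z)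
        ≡⟨ cong (λ c → suc K ^ (z + K * e) * (a + c) ^ (K * z)) (rearrange (2 ^ m) b) ⟩
      suc K ^ (z + K * e) * (a + 2 ^ suc m * b) ^ (K * z) ∎
      where
      power : ∀ x y → (x ^ y) ^ K ≡ x ^ (K * y)
      power x y = trans (ℕₚ.^-*-assoc x y K) (cong (x ^_) (ℕₚ.*-comm y K))
      rearrange : ∀ p b → p * (2 * b) ≡ 2 * p * b
      rearrange = solve-∀

-- Numerical estimates: from the weighted count to a density.

pow-gap : ∀ s t → suc (s + t) ^ s * t ≤ (s + t) ^ suc s
pow-gap s t = go s t ℕₚ.≤-refl
  where
  open ℕₚ.≤-Reasoning
  -- Each step uses (D + 1) (D - r - 1) ≤ D (D - r) with D = s + t and u = D - r - 1.
  go : ∀ r u → r + u ≤ s + t → suc (s + t) ^ r * u ≤ (s + t) ^ suc r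
  go zero u u≤D = subst₂ _≤_ (sym (ℕₚ.*-identityˡ u)) (sym (ℕₚ.*-identityʳ (s + t))) u≤D
  go (suc r) u h = begin
    suc (s + t) * suc (s + t) ^ r * u   ≡⟨ rearrange (s + t) (suc (s + t) ^ r) u ⟩
    suc (s + t) ^ r * (u + (s + t) * u) ≤⟨ ℕₚ.*-monoʳ-≤ (suc (s + t) ^ r) (ℕₚ.+-monoˡ-≤ _ (ℕₚ.≤-trans (ℕₚ.m≤n+m u (suc r)) h)) ⟩
    suc (s + t) ^ r * (s + t + (s + t) * u) ≡⟨ rearrange′ (s + t) (suc (s + t) ^ r) u ⟩
    (s + t) * (suc (s + t) ^ r * suc u) ≤⟨ ℕₚ.*-monoʳ-≤ (s + t) (go r (suc u) (ℕₚ.≤-trans (ℕₚ.≤-reflexive (ℕₚ.+-suc r u)) h)) ⟩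
    (s + t) ^ suc (suc r) ∎
    where
    rearrange : ∀ d p u → suc d * p * u ≡ p * (u + d * u)
    rearrange = solve-∀
    rearrange′ : ∀ d p u → p * (d + d * u) ≡ d * (p * suc u)
    rearrange′ = solve-∀

-- This is (1 + 1/D)^(D/2) ≤ 2 for D = 2s, obtained from `pow-gap` at t = s.
half-power : ∀ s → 1 ≤ s → suc (s + s) ^ s ≤ 2 * (s + s) ^ s
half-power s 1≤s = ℕₚ.*-cancelʳ-≤ _ _ s {{>-nonZero 1≤s}} (begin
  suc (s + s) ^ s * s      ≤⟨ pow-gap s s ⟩
  (s + s) * (s + s) ^ s    ≡⟨ rearrange s ((s + s) ^ s) ⟩
  2 * (s + s) ^ s * s      ∎)
  where
  open ℕₚ.≤-Reasoning
  rearrange : ∀ s p → (s + s) * p ≡ 2 * p * s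
  rearrange = solve-∀

-- Let D = 2^d, so that K = D². Dividing by D^(2N) and taking logarithms leaves d a ≤ (m + 1) e + N
-- log₂(1 + 1/D). Here e = m N / K, and the last logarithm is at most 2/D by `half-power`. Writing d
-- as `suc d′` makes s = D/2 an integer.
weights⇒density : ∀ d′ N e a → let d = suc d′; m = d + d; K = 2 ^ m in
  K * e ≡ m * N →
  2 ^ (m * N) * (2 ^ d) ^ a ≤ suc K ^ e * (2 ^ d + 2 ^ m * 1) ^ N →
  a * 2 ^ d ≤ 8 * N
weights⇒density d′ N e a Ke h = ℕₚ.*-cancelˡ-≤ (D * d) {{>-nonZero (ℕₚ.*-mono-≤ {1} {_} {1} 1≤D (s≤s z≤n))}} (begin
    D * d * (a * D)              ≡⟨ r₁ D d a ⟩
    D * D * d * a                ≡⟨ cong (λ k → k * d * a) (sym K≡) ⟩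
    K * d * a                    ≤⟨ bound₅ ⟩
    ((d + d) * suc (d + d) + 4 * s) * N ≤⟨ ℕₚ.*-monoˡ-≤ N coefficient ⟩
    D * d * 8 * N                ≡⟨ ℕₚ.*-assoc (D * d) 8 N ⟩
    D * d * (8 * N)              ∎)
  where
  open ℕₚ.≤-Reasoning
  d m K s D : ℕ
  d = suc d′
  m = d + d
  K = 2 ^ m
  s = 2 ^ d′
  D = 2 ^ d
  1≤s : 1 ≤ s
  1≤s = ℕₚ.m^n>0 2 d′
  1≤D : 1 ≤ D
  1≤D = ℕₚ.m^n>0 2 d
  D≡ : D ≡ s + s
  D≡ = cong (s +_) (ℕₚ.+-identityʳ s)
  K≡ : K ≡ D * D
  K≡ = ℕₚ.^-distribˡ-+-* 2 d d
  r₁ : ∀ D d a → D * d * (a * D) ≡ D * D * d * a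
  r₁ = solve-∀
  D^N≢0 : NonZero (D ^ N)
  D^N≢0 = >-nonZero (ℕₚ.≤-trans (ℕₚ.m^n>0 2 (d * N)) (ℕₚ.≤-reflexive (sym (ℕₚ.^-*-assoc 2 d N))))
  bound₁ : D ^ N * D ^ a ≤ suc K ^ e * suc D ^ N
  bound₁ = ℕₚ.*-cancelˡ-≤ (D ^ N) {{D^N≢0}} (begin
    D ^ N * (D ^ N * D ^ a)          ≡⟨ sym (ℕₚ.*-assoc (D ^ N) _ _) ⟩
    D ^ N * D ^ N * D ^ a            ≡⟨ cong (_* D ^ a) (sym (trans (sym (ℕₚ.^-*-assoc 2 m N)) (trans (cong (_^ N) K≡) (^-distribʳ-* D D N)))) ⟩
    2 ^ (m * N) * D ^ a              ≤⟨ h ⟩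
    suc K ^ e * (D + K * 1) ^ N      ≡⟨ cong (λ c → suc K ^ e * c ^ N) (trans (cong (λ k → D + k * 1) K≡) (r₂ D)) ⟩
    suc K ^ e * (D * suc D) ^ N      ≡⟨ cong (suc K ^ e *_) (^-distribʳ-* D (suc D) N) ⟩
    suc K ^ e * (D ^ N * suc D ^ N)  ≡⟨ r₃ (suc K ^ e) (D ^ N) (suc D ^ N) ⟩
    D ^ N * (suc K ^ e * suc D ^ N)  ∎)
    where
    r₂ : ∀ D → D + D * D * 1 ≡ D * suc D
    r₂ = solve-∀
    r₃ : ∀ a b c → a * (b * c) ≡ b * (a * c)
    r₃ = solve-∀
  swap : ∀ x p q → (x ^ p) ^ q ≡ (x ^ q) ^ p
  swap x p q = trans (ℕₚ.^-*-assoc x p q) (trans (cong (x ^_) (ℕₚ.*-comm p q)) (sym (ℕₚ.^-*-assoc x q p)))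
  -- The power `s` replaces a bound for log₂(1 + 1/D): it lets `half-power` trade each (D + 1)^s for
  -- 2 D^s.
  bound₂ : (D ^ N) ^ s * (D ^ a) ^ s ≤ (suc K ^ e) ^ s * (2 ^ N * (D ^ N) ^ s)
  bound₂ = begin
    (D ^ N) ^ s * (D ^ a) ^ s              ≡⟨ sym (^-distribʳ-* (D ^ N) (D ^ a) s) ⟩
    (D ^ N * D ^ a) ^ s                    ≤⟨ ℕₚ.^-monoˡ-≤ s bound₁ ⟩
    (suc K ^ e * suc D ^ N) ^ s            ≡⟨ ^-distribʳ-* (suc K ^ e) (suc D ^ N) s ⟩
    (suc K ^ e) ^ s * (suc D ^ N) ^ s      ≡⟨ cong ((suc K ^ e) ^ s *_) (swap (suc D) N s) ⟩
    (suc K ^ e) ^ s * (suc D ^ s) ^ N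
      ≤⟨ ℕₚ.*-monoʳ-≤ ((suc K ^ e) ^ s) (ℕₚ.^-monoˡ-≤ N (subst (λ D → suc D ^ s ≤ 2 * D ^ s) (sym D≡) (half-power s 1≤s))) ⟩
    (suc K ^ e) ^ s * (2 * D ^ s) ^ N
      ≡⟨ cong ((suc K ^ e) ^ s *_) (trans (^-distribʳ-* 2 (D ^ s) N) (cong (2 ^ N *_) (swap D s N))) ⟩
    (suc K ^ e) ^ s * (2 ^ N * (D ^ N) ^ s) ∎
  bound₃ : 2 ^ (d * a * s) ≤ 2 ^ (suc m * e * s + N)
  bound₃ = ℕₚ.*-cancelˡ-≤ ((D ^ N) ^ s) {{ℕₚ.m^n≢0 (D ^ N) s {{D^N≢0}}}} (begin
    (D ^ N) ^ s * 2 ^ (d * a * s)              ≡⟨ cong ((D ^ N) ^ s *_) (sym (trans (cong (_^ s) (ℕₚ.^-*-assoc 2 d a)) (ℕₚ.^-*-assoc 2 (d * a) s))) ⟩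
    (D ^ N) ^ s * (D ^ a) ^ s                  ≤⟨ bound₂ ⟩
    (suc K ^ e) ^ s * (2 ^ N * (D ^ N) ^ s)    ≤⟨ ℕₚ.*-monoˡ-≤ (2 ^ N * (D ^ N) ^ s) (ℕₚ.^-monoˡ-≤ s (ℕₚ.^-monoˡ-≤ e sucK≤)) ⟩
    ((2 ^ suc m) ^ e) ^ s * (2 ^ N * (D ^ N) ^ s)
      ≡⟨ cong (_* (2 ^ N * (D ^ N) ^ s)) (trans (cong (_^ s) (ℕₚ.^-*-assoc 2 (suc m) e)) (ℕₚ.^-*-assoc 2 (suc m * e) s)) ⟩
    2 ^ (suc m * e * s) * (2 ^ N * (D ^ N) ^ s)
      ≡⟨ r₄ (2 ^ (suc m * e * s)) (2 ^ N) ((D ^ N) ^ s) ⟩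
    (D ^ N) ^ s * (2 ^ (suc m * e * s) * 2 ^ N)
      ≡⟨ cong ((D ^ N) ^ s *_) (sym (ℕₚ.^-distribˡ-+-* 2 (suc m * e * s) N)) ⟩
    (D ^ N) ^ s * 2 ^ (suc m * e * s + N)      ∎)
    where
    sucK≤ : suc K ≤ 2 ^ suc m
    sucK≤ = ℕₚ.+-mono-≤ (ℕₚ.m^n>0 2 m) (ℕₚ.≤-reflexive (sym (ℕₚ.+-identityʳ K)))
    r₄ : ∀ a b c → a * (b * c) ≡ c * (a * b)
    r₄ = solve-∀
  bound₄ : d * a * s ≤ suc m * e * s + N
  bound₄ = 2^-cancel bound₃
  bound₅ : K * d * a ≤ ((d + d) * suc (d + d) + 4 * s) * N
  bound₅ = ℕₚ.*-cancelˡ-≤ s {{>-nonZero 1≤s}} (begin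
    s * (K * d * a)                          ≡⟨ r₅ s K d a ⟩
    K * (d * a * s)                          ≤⟨ ℕₚ.*-monoʳ-≤ K bound₄ ⟩
    K * (suc m * e * s + N)                  ≡⟨ r₆ K (suc m) e s N ⟩
    suc m * (K * e) * s + K * N              ≡⟨ cong₂ (λ p q → suc m * p * s + q * N) Ke (trans K≡ (cong₂ _*_ D≡ D≡)) ⟩
    suc m * (m * N) * s + (s + s) * (s + s) * N ≡⟨ r₇ m N s ⟩
    s * ((m * suc m + 4 * s) * N)            ∎)
    where
    r₅ : ∀ s k d a → s * (k * d * a) ≡ k * (d * a * s)
    r₅ = solve-∀
    r₆ : ∀ k m e s n → k * (m * e * s + n) ≡ m * (k * e) * s + k * n
    r₆ = solve-∀
    r₇ : ∀ m n s → suc m * (m * n) * s + (s + s) * (s + s) * n ≡ s * ((m * suc m + 4 * s) * n)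
    r₇ = solve-∀
  -- From 1 ≤ D and d ≤ D the first term is at most 6 D d, and 4s = 2D is at most 2 D d; together
  -- they give the 8.
  coefficient : (d + d) * suc (d + d) + 4 * s ≤ D * d * 8
  coefficient = begin
    (d + d) * suc (d + d) + 4 * s    ≤⟨ ℕₚ.+-mono-≤ (ℕₚ.*-monoʳ-≤ (d + d) (ℕₚ.+-mono-≤ 1≤D (ℕₚ.+-mono-≤ (n≤2^n d) (n≤2^n d))))
                                          (ℕₚ.≤-trans (ℕₚ.≤-reflexive (trans (r₈ s) (cong (2 *_) (sym D≡)))) (ℕₚ.*-monoʳ-≤ 2 (ℕₚ.m≤m*n D d))) ⟩
    (d + d) * (D + (D + D)) + 2 * (D * d) ≡⟨ r₉ d D ⟩
    D * d * 8 ∎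
    where
    r₈ : ∀ s → 4 * s ≡ 2 * (s + s)
    r₈ = solve-∀
    r₉ : ∀ d D → (d + d) * (D + (D + D)) + 2 * (D * d) ≡ D * d * 8
    r₉ = solve-∀

-- Sparse configurations of every size.

module _ (d′ n₀ : ℕ) where
  private
    d = suc d′
    m = d + d
    K = 2 ^ m
  open Levels K n₀

  -- A cover-free `A` is a single term of the bounded sum, where it contributes at least its weight
  -- (2^d)^|A|.
  low-density : ∃ λ (P : Config (Fin (K ^ m * n₀))) → ∀ A → CoverFree P A → ∣ A ∣ * 2 ^ d ≤ 8 * (K ^ m * n₀)
  low-density = subst (λ N → ∃ λ (P : Config (Fin N)) → ∀ A → CoverFree P A → ∣ A ∣ * 2 ^ d ≤ 8 * N) (size≡ m)
    (config , λ A free → weights⇒density d′ (size m) (exponent m) ∣ A ∣ (K*exponent m) (begin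
      2 ^ (m * size m) * (2 ^ d) ^ ∣ A ∣
        ≡⟨ cong (2 ^ (m * size m) *_) (sym (trans (ℕₚ.*-identityʳ _) (weight-∣∣ (2 ^ d) A))) ⟩
      2 ^ (m * size m) * (weight (2 ^ d) 1 A * 1)
        ≤⟨ ℕₚ.*-monoʳ-≤ (2 ^ (m * size m)) (ℕₚ.≤-trans (ℕₚ.*-monoʳ-≤ (weight (2 ^ d) 1 A) (χ-pos A free))
             (f≤∑ₛf (λ A → weight (2 ^ d) 1 A * χ A) A)) ⟩
      2 ^ (m * size m) * ∑ₛ (λ A → weight (2 ^ d) 1 A * χ A)
        ≤⟨ ∑-bound ⟩
      suc K ^ exponent m * (2 ^ d + 2 ^ m * 1) ^ size m ∎))
    where
    open ℕₚ.≤-Reasoning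
    open Construction (iterate m (2 ^ d) 1)

-- |A| ≤ n 2^(-t/e), with the root cleared.
Sparse : ∀ {n} → Config (Fin n) → ℕ → ℕ → Set
Sparse {n} P e t = ∀ A → CoverFree P A → ∣ A ∣ ^ e * 2 ^ t ≤ n ^ e

∣++∅∣ : ∀ {n} (A : Subset n) r → ∣ A ++ ∅ {r} ∣ ≡ ∣ A ∣
∣++∅∣ []          r = Subsetₚ.∣⊥∣≡0 r
∣++∅∣ (true ∷ A)  r = cong suc (∣++∅∣ A r)
∣++∅∣ (false ∷ A) r = ∣++∅∣ A r

∈-++∅ : ∀ {n} (A : Subset n) r {i} → i ∈ᵇ (A ++ ∅ {r}) → ∃ λ j → j ∈ᵇ A × i ≡ j Fin.↑ˡ r
∈-++∅ {n} A r {i} i∈ with Fin.splitAt n i in eq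
... | inj₁ j = j , trans (sym (Vecₚ.lookup-++ˡ A (∅ {r}) j)) (trans (cong (lookup (A ++ ∅)) i≡) i∈) , sym i≡
  where i≡ = Finₚ.splitAt⁻¹-↑ˡ eq
... | inj₂ j with trans (sym i∈) (trans (cong (lookup (A ++ ∅ {r})) (sym (Finₚ.splitAt⁻¹-↑ʳ eq)))
                   (trans (Vecₚ.lookup-++ʳ A (∅ {r}) j) (Vecₚ.lookup-replicate j false)))
... | ()

restrict : ∀ n r → Config (Fin (n + r)) → Config (Fin n)
restrict n r = pull (Fin._↑ˡ r) (Finₚ.↑ˡ-injective r _ _)

-- Deleting points keeps an empty rectangle empty, so no covering pair of `P` inside `A` is lost.
restrict-CoverFree : ∀ n r (P : Config (Fin (n + r))) A →
  CoverFree (restrict n r P) A → CoverFree P (A ++ ∅ {r})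
restrict-CoverFree n r P A free i∈ j∈ i⋖j with ∈-++∅ A r i∈ | ∈-++∅ A r j∈
... | i′ , i′∈ , refl | j′ , j′∈ , refl = free i′∈ j′∈ (pull-Cover (Finₚ.↑ˡ-injective r _ _) P i⋖j)

no-consecutive : ∀ {n} (A : Subset n) →
  (∀ {i j} → toℕ j ≡ suc (toℕ i) → i ∈ᵇ A → j ∈ᵇ A → ⊥) → ∣ A ∣ + ∣ A ∣ ≤ suc n
no-consecutive []                  h = z≤n
no-consecutive (false ∷ A)         h = ℕₚ.m≤n⇒m≤1+n (no-consecutive A λ eq → h (cong suc eq))
no-consecutive (true ∷ [])         h = ℕₚ.≤-refl
no-consecutive (true ∷ true ∷ A)   h = ⊥-elim (h {zero} {suc zero} refl refl refl)
no-consecutive (true ∷ false ∷ A)  h =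
  s≤s (ℕₚ.≤-trans (ℕₚ.≤-reflexive (ℕₚ.+-suc ∣ A ∣ ∣ A ∣))
    (s≤s (no-consecutive A λ {i} {j} eq → h {suc (suc i)} {suc (suc j)} (cong (2 +_) eq))))

chain-bound : ∀ {n} A → CoverFree (chain n) A → ∣ A ∣ + ∣ A ∣ ≤ suc n
chain-bound A free = no-consecutive A λ {i} {j} eq i∈ j∈ →
  let i<j = ℕₚ.≤-reflexive (sym eq) in
  free i∈ j∈ (i<j , i<j , λ k i≤k k≤j _ _ → between k eq i≤k k≤j)
  where
  between : ∀ {i j} k → toℕ j ≡ suc (toℕ i) → i Fin.≤ k → k Fin.≤ j → k ≡ i ⊎ k ≡ j
  between k eq i≤k k≤j with ℕₚ.m≤n⇒m<n∨m≡n i≤k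
  ... | inj₁ i<k = inj₂ (Finₚ.≤-antisym k≤j (ℕₚ.≤-trans (ℕₚ.≤-reflexive eq) i<k))
  ... | inj₂ i≡k = inj₁ (Finₚ.toℕ-injective (sym i≡k))

-- The first hypothesis says (3/4)^e ≤ 2^(-t), and the second that the density is at most 3/4.
power-bound : ∀ e t {a n} → 3 ^ e * 2 ^ t ≤ 4 ^ e → 4 * a ≤ 3 * n → a ^ e * 2 ^ t ≤ n ^ e
power-bound e t {a} {n} h 4a≤3n = ℕₚ.*-cancelˡ-≤ (3 ^ e) {{ℕₚ.m^n≢0 3 e}} (begin
  3 ^ e * (a ^ e * 2 ^ t)   ≡⟨ rearrange (3 ^ e) (a ^ e) (2 ^ t) ⟩
  3 ^ e * 2 ^ t * a ^ e     ≤⟨ ℕₚ.*-monoˡ-≤ (a ^ e) h ⟩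
  4 ^ e * a ^ e             ≡⟨ sym (^-distribʳ-* 4 a e) ⟩
  (4 * a) ^ e               ≤⟨ ℕₚ.^-monoˡ-≤ e 4a≤3n ⟩
  (3 * n) ^ e               ≡⟨ ^-distribʳ-* 3 n e ⟩
  3 ^ e * n ^ e             ∎)
  where
  open ℕₚ.≤-Reasoning
  rearrange : ∀ p q r → p * (q * r) ≡ p * r * q
  rearrange = solve-∀

-- Neighbours in a chain form covering pairs, so |A| ≤ (n + 1)/2, which is at most 3n/4 once n ≥ 2.
chain-sparse : ∀ {n} e t → 3 ^ e * 2 ^ t ≤ 4 ^ e → 2 ≤ n → Sparse (chain n) e t
chain-sparse {n} e t h 2≤n A free = power-bound e t h (begin
  4 * ∣ A ∣                ≡⟨ rearrange ∣ A ∣ ⟩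
  2 * (∣ A ∣ + ∣ A ∣)      ≤⟨ ℕₚ.*-monoʳ-≤ 2 (chain-bound A free) ⟩
  2 * suc n                ≡⟨ ℕₚ.*-suc 2 n ⟩
  2 + 2 * n                ≤⟨ ℕₚ.+-monoˡ-≤ (2 * n) 2≤n ⟩
  3 * n                    ∎)
  where
  open ℕₚ.≤-Reasoning
  rearrange : ∀ a → 4 * a ≡ 2 * (a + a)
  rearrange = solve-∀

chain₁-sparse : ∀ e → Sparse (chain 1) e 0
chain₁-sparse e A _ = ℕₚ.≤-trans (ℕₚ.≤-reflexive (ℕₚ.*-identityʳ (∣ A ∣ ^ e)))
  (ℕₚ.^-monoˡ-≤ e (Subsetₚ.∣p∣≤n A))

low-density⁺ : ∀ d → 1 ≤ d → ∀ n₀ → let N = (2 ^ (d + d)) ^ (d + d) * n₀ in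
  ∃ λ (P : Config (Fin N)) → ∀ A → CoverFree P A → ∣ A ∣ * 2 ^ d ≤ 8 * N
low-density⁺ (suc d) _ = low-density d

multiple-between : ∀ n q → 1 ≤ q → q ≤ n → ∃ λ k → n ≤ q * k × q * k ≤ n + n
multiple-between n q 1≤q q≤n = suc (n / q) , (begin
    n                     ≡⟨ DivMod.m≡m%n+[m/n]*n n q ⟩
    n % q + n / q * q     ≤⟨ ℕₚ.+-monoˡ-≤ (n / q * q) (ℕₚ.<⇒≤ (DivMod.m%n<n n q)) ⟩
    q + n / q * q         ≡⟨ ℕₚ.*-comm (suc (n / q)) q ⟩
    q * suc (n / q)       ∎) , (begin
    q * suc (n / q)       ≡⟨ ℕₚ.*-comm q (suc (n / q)) ⟩
    q + n / q * q         ≤⟨ ℕₚ.+-mono-≤ q≤n (DivMod.m/n*n≤m n q) ⟩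
    n + n                 ∎)
  where
  open ℕₚ.≤-Reasoning
  instance
    q≢0 : NonZero q
    q≢0 = >-nonZero 1≤q

-- The size is rounded up to a multiple of `q` and the surplus points are discarded. Rounding at
-- most doubles the size, whence 16 instead of 8.
low-density-any : ∀ d → 1 ≤ d → ∀ n → (2 ^ (d + d)) ^ (d + d) ≤ n →
  ∃ λ (P : Config (Fin n)) → ∀ A → CoverFree P A → ∣ A ∣ * 2 ^ d ≤ 16 * n
low-density-any d 1≤d n q≤n = restrict n r P , λ A free → begin
    ∣ A ∣ * 2 ^ d             ≡⟨ cong (_* 2 ^ d) (sym (∣++∅∣ A r)) ⟩
    ∣ A ++ ∅ {r} ∣ * 2 ^ d    ≤⟨ proj₂ whole (A ++ ∅) (restrict-CoverFree n r P A free) ⟩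
    8 * (n + r)               ≡⟨ cong (8 *_) (ℕₚ.m+[n∸m]≡n n≤qk) ⟩
    8 * (q * k)               ≤⟨ ℕₚ.*-monoʳ-≤ 8 qk≤2n ⟩
    8 * (n + n)               ≡⟨ rearrange n ⟩
    16 * n                    ∎
  where
  open ℕₚ.≤-Reasoning
  q = (2 ^ (d + d)) ^ (d + d)
  1≤q : 1 ≤ q
  1≤q = ℕₚ.m^n>0 (2 ^ (d + d)) {{ℕₚ.m^n≢0 2 (d + d)}} (d + d)
  multiple = multiple-between n q 1≤q q≤n
  k = proj₁ multiple
  n≤qk = proj₁ (proj₂ multiple)
  qk≤2n = proj₂ (proj₂ multiple)
  r = q * k ∸ n
  whole = subst (λ N → ∃ λ (P : Config (Fin N)) → ∀ A → CoverFree P A → ∣ A ∣ * 2 ^ d ≤ 8 * N)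
    (sym (ℕₚ.m+[n∸m]≡n n≤qk)) (low-density⁺ d 1≤d k)
  P : Config (Fin (n + r))
  P = proj₁ whole
  rearrange : ∀ n → 8 * (n + n) ≡ 16 * n
  rearrange = solve-∀

-- The constant 16 uses up four of the `d` factors 2 and leaves the density 2^(-f).
low-density⇒sparse : ∀ {n} (P : Config (Fin n)) e d f t → d ≡ 4 + f → t ≤ f * e →
  (∀ A → CoverFree P A → ∣ A ∣ * 2 ^ d ≤ 16 * n) → Sparse P e t
low-density⇒sparse {n} P e d f t d≡ t≤fe h A free = begin
  ∣ A ∣ ^ e * 2 ^ t          ≤⟨ ℕₚ.*-monoʳ-≤ (∣ A ∣ ^ e) (ℕₚ.^-monoʳ-≤ 2 t≤fe) ⟩
  ∣ A ∣ ^ e * 2 ^ (f * e)    ≡⟨ cong (∣ A ∣ ^ e *_) (sym (ℕₚ.^-*-assoc 2 f e)) ⟩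
  ∣ A ∣ ^ e * (2 ^ f) ^ e    ≡⟨ sym (^-distribʳ-* ∣ A ∣ (2 ^ f) e) ⟩
  (∣ A ∣ * 2 ^ f) ^ e        ≤⟨ ℕₚ.^-monoˡ-≤ e (ℕₚ.*-cancelˡ-≤ 16 (begin
    16 * (∣ A ∣ * 2 ^ f)       ≡⟨ rearrange ∣ A ∣ (2 ^ f) ⟩
    ∣ A ∣ * (2 ^ 4 * 2 ^ f)    ≡⟨ cong (∣ A ∣ *_) (sym (trans (cong (2 ^_) d≡) (ℕₚ.^-distribˡ-+-* 2 4 f))) ⟩
    ∣ A ∣ * 2 ^ d              ≤⟨ h A free ⟩
    16 * n                     ∎)) ⟩
  n ^ e                      ∎
  where
  open ℕₚ.≤-Reasoning
  rearrange : ∀ a p → 16 * (a * p) ≡ a * (16 * p)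
  rearrange = solve-∀

-- The scale k satisfies 2^(4k²) ≤ n ≤ 2^(4(k + 2)²), whence t = 2(k + 2) ≥ √log n.  For
-- k ≤ 4 the density 16 / 2^k is trivial, and a chain with its density of at most 3/4 is used.
sparse-config : ∀ e → 14 ≤ e → 3 ^ e * 2 ^ 12 ≤ 4 ^ e → ∀ n → 1 ≤ n →
  ∃ λ (P : Config (Fin n)) → ∃ λ t → n ≤ 2 ^ (t * t) × Sparse P e t
sparse-config e 14≤e h 1             _   = chain 1 , 0 , ℕₚ.≤-refl , chain₁-sparse e
sparse-config e 14≤e h n@(suc (suc _)) 1≤n = by-scale (search {Lower} {Upper} split up 1≤n n start)
  where
  Lower Upper : ℕ → Set
  Lower k = 2 ^ (4 * (k * k)) ≤ n
  Upper k = n ≤ 2 ^ (4 * (k * k))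
  up : ∀ k → Upper k → Upper (suc k)
  up k n≤ = ℕₚ.≤-trans n≤ (ℕₚ.^-monoʳ-≤ 2 (ℕₚ.*-monoʳ-≤ 4 (ℕₚ.*-mono-≤ (ℕₚ.n≤1+n k) (ℕₚ.n≤1+n k))))
  split : ∀ k → Lower k ⊎ Upper (suc k)
  split k = [ inj₁ , (λ n≤ → inj₂ (up k n≤)) ]′ (ℕₚ.≤-total (2 ^ (4 * (k * k))) n)
  start : Upper n
  start = ℕₚ.≤-trans (n≤2^n n) (ℕₚ.^-monoʳ-≤ 2 (ℕₚ.≤-trans (ℕₚ.m≤m*n n n) (ℕₚ.m≤n*m (n * n) 4)))
  square : ∀ k → 4 * (k * k) ≡ 2 * k * (2 * k)
  square = solve-∀
  quad : ∀ d → (d + d) * (d + d) ≡ 4 * (d * d)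
  quad = solve-∀
  by-scale : (∃ λ k → Lower k × Upper (2 + k)) →
    ∃ λ (P : Config (Fin n)) → ∃ λ t → n ≤ 2 ^ (t * t) × Sparse P e t
  by-scale (k , lower , upper) = [ small , large ]′ (ℕₚ.≤-<-connex k 4)
    where
    Goal = ∃ λ (P : Config (Fin n)) → ∃ λ t → n ≤ 2 ^ (t * t) × Sparse P e t
    small : k ≤ 4 → Goal
    -- Since k + 2 ≤ 6, the upper bound on n is 2^(4 · 6²) = 2^(12²).
    small k≤4 = chain n , 12 ,
      ℕₚ.≤-trans upper (ℕₚ.^-monoʳ-≤ 2 (ℕₚ.*-monoʳ-≤ 4 (ℕₚ.*-mono-≤ 2+k≤6 2+k≤6))) ,
      chain-sparse e 12 h (s≤s (s≤s z≤n))
      where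
      2+k≤6 : 2 + k ≤ 6
      2+k≤6 = ℕₚ.+-monoʳ-≤ 2 k≤4
    large : 4 < k → Goal
    large 4<k = proj₁ restricted , 2 * (2 + k) ,
      ℕₚ.≤-trans upper (ℕₚ.^-monoʳ-≤ 2 (ℕₚ.≤-reflexive (square (2 + k)))) ,
      low-density⇒sparse (proj₁ restricted) e k f (2 * (2 + k)) k≡ t≤fe (proj₂ restricted)
      where
      restricted = low-density-any k (ℕₚ.≤-trans (s≤s z≤n) 4<k) n (subst (_≤ n)
        (sym (trans (ℕₚ.^-*-assoc 2 (k + k) (k + k)) (cong (2 ^_) (quad k)))) lower)
      f = k ∸ 4
      k≡ : k ≡ 4 + f
      k≡ = sym (ℕₚ.m+[n∸m]≡n (ℕₚ.<⇒≤ 4<k))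
      1≤f : 1 ≤ f
      1≤f = ℕₚ.m<n⇒0<n∸m 4<k
      -- With k = 4 + f and f ≥ 1 this reads 12 + 2f ≤ 14f, which is the origin of the 14.
      t≤fe : 2 * (2 + k) ≤ f * e
      t≤fe = begin
        2 * (2 + k)              ≡⟨ cong (λ k → 2 * (2 + k)) k≡ ⟩
        2 * (6 + f)              ≡⟨ ℕₚ.*-distribˡ-+ 2 6 f ⟩
        12 + 2 * f               ≤⟨ ℕₚ.+-monoˡ-≤ (2 * f) (ℕₚ.*-monoʳ-≤ 12 1≤f) ⟩
        12 * f + 2 * f           ≡⟨ sym (ℕₚ.*-distribʳ-+ f 12 2) ⟩
        14 * f                   ≡⟨ ℕₚ.*-comm 14 f ⟩
        f * 14                   ≤⟨ ℕₚ.*-monoʳ-≤ f 14≤e ⟩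
        f * e                    ∎
        where open ℕₚ.≤-Reasoning

-- The box-Delaunay graph of a configuration.

≤ℝ-trans : ∀ x y z → x ≤ℝ y → y ≤ℝ z → x ≤ℝ z
≤ℝ-trans x y z x≤y y≤z q q<x = y≤z q (x≤y q q<x)

fromℕ-mono-≤ : ∀ m n → m ≤ n → fromℕ m ≤ℝ fromℕ n
fromℕ-mono-≤ m n m≤n q q<m = ℚₚ.<-≤-trans q<m (ι-mono-≤ m≤n)

fromℕ-mono-< : ∀ m n → m < n → fromℕ m <ℝ fromℕ n
fromℕ-mono-< m n m<n = ℚₚ.<-dense (ι-mono-< m<n)

fromℕ-cancel-≤ : ∀ m n → fromℕ m ≤ℝ fromℕ n → m ≤ n
fromℕ-cancel-≤ m n h = ℕₚ.≮⇒≥ λ n<m → ℚₚ.<-irrefl refl (h (ι n) (ι-mono-< n<m))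

fromℕ-injective : ∀ m n → fromℕ m ≃ fromℕ n → m ≡ n
fromℕ-injective m n (m≤n , n≤m) = ℕₚ.≤-antisym (fromℕ-cancel-≤ m n m≤n) (fromℕ-cancel-≤ n m n≤m)

⊓<⊔ : ∀ {m n} → m ≢ n → m ⊓ n < m ⊔ n
⊓<⊔ {m} {n} m≢n with ℕₚ.<-cmp m n
... | tri< m<n _ _ = subst₂ _<_ (sym (ℕₚ.m≤n⇒m⊓n≡m (ℕₚ.<⇒≤ m<n))) (sym (ℕₚ.m≤n⇒m⊔n≡n (ℕₚ.<⇒≤ m<n))) m<n
... | tri≈ _ m≡n _ = ⊥-elim (m≢n m≡n)
... | tri> _ _ n<m = subst₂ _<_ (sym (ℕₚ.m≥n⇒m⊓n≡n (ℕₚ.<⇒≤ n<m))) (sym (ℕₚ.m≥n⇒m⊔n≡m (ℕₚ.<⇒≤ n<m))) n<m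

module _ {n : ℕ} (P : Config (Fin n)) where
  open Config P renaming (x to xᶠ; y to yᶠ) hiding (Cover)

  private
    x y : Fin n → ℕ
    x = toℕ ∘ xᶠ
    y = toℕ ∘ yᶠ

  points : PointSet n
  points = record
    { point    = λ i → fromℕ (x i) , fromℕ (y i)
    ; distinct = λ {i} {j} (x≃ , _) → x-injective (Finₚ.toℕ-injective (fromℕ-injective (x i) (x j) x≃))
    }

  open Graph (boxDelaunay points)

  InBox : Fin n → Fin n → Fin n → Set
  InBox i j k = (x i ⊓ x j ≤ x k × x k ≤ x i ⊔ x j) × (y i ⊓ y j ≤ y k × y k ≤ y i ⊔ y j)

  -- A decidable form of adjacency, which itself quantifies over all real rectangles. Decidability
  -- is what yields the exact independence and chromatic numbers.
  EmptyBox : Fin n → Fin n → Set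
  EmptyBox i j = i ≢ j × (∀ k → InBox i j k → k ≡ i ⊎ k ≡ j)

  emptyBox? : ∀ i j → Dec (EmptyBox i j)
  emptyBox? i j = ¬? (i Finₚ.≟ j) ×-dec Finₚ.all? λ k →
    ((((x i ⊓ x j) ≤? x k) ×-dec (x k ≤? (x i ⊔ x j))) ×-dec
     (((y i ⊓ y j) ≤? y k) ×-dec (y k ≤? (y i ⊔ y j)))) →-dec
    ((k Finₚ.≟ i) ⊎-dec (k Finₚ.≟ j))

  emptyBox⇒~ : ∀ {i j} → EmptyBox i j → i ~ j
  emptyBox⇒~ {i} {j} (i≢j , empty) = i≢j , R ,
    ((fromℕ-mono-≤ (x i ⊓ x j) (x i) (ℕₚ.m⊓n≤m (x i) (x j)) , fromℕ-mono-≤ (x i) (x i ⊔ x j) (ℕₚ.m≤m⊔n (x i) (x j))) ,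
     (fromℕ-mono-≤ (y i ⊓ y j) (y i) (ℕₚ.m⊓n≤m (y i) (y j)) , fromℕ-mono-≤ (y i) (y i ⊔ y j) (ℕₚ.m≤m⊔n (y i) (y j)))) ,
    ((fromℕ-mono-≤ (x i ⊓ x j) (x j) (ℕₚ.m⊓n≤n (x i) (x j)) , fromℕ-mono-≤ (x j) (x i ⊔ x j) (ℕₚ.m≤n⊔m (x i) (x j))) ,
     (fromℕ-mono-≤ (y i ⊓ y j) (y j) (ℕₚ.m⊓n≤n (y i) (y j)) , fromℕ-mono-≤ (y j) (y i ⊔ y j) (ℕₚ.m≤n⊔m (y i) (y j)))) ,
    λ k k≢i k≢j ((x₁ , x₂) , (y₁ , y₂)) → [ k≢i , k≢j ]′ (empty k
      ((fromℕ-cancel-≤ (x i ⊓ x j) (x k) x₁ , fromℕ-cancel-≤ (x k) (x i ⊔ x j) x₂) ,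
       (fromℕ-cancel-≤ (y i ⊓ y j) (y k) y₁ , fromℕ-cancel-≤ (y k) (y i ⊔ y j) y₂)))
    where
    R : Rectangle
    R = record
      { left   = fromℕ (x i ⊓ x j) ; right = fromℕ (x i ⊔ x j)
      ; bottom = fromℕ (y i ⊓ y j) ; top   = fromℕ (y i ⊔ y j)
      -- Rectangles must be nondegenerate; this is where the injectivity of both coordinates enters.
      ; left<right = fromℕ-mono-< (x i ⊓ x j) (x i ⊔ x j) (⊓<⊔ (i≢j ∘ x-injective ∘ Finₚ.toℕ-injective))
      ; bottom<top = fromℕ-mono-< (y i ⊓ y j) (y i ⊔ y j) (⊓<⊔ (i≢j ∘ y-injective ∘ Finₚ.toℕ-injective))
      }

  -- Any rectangle containing two points contains the box spanned by them.
  ~⇒emptyBox : ∀ {i j} → i ~ j → EmptyBox i j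
  ~⇒emptyBox {i} {j} (i≢j , R , ((l≤xi , xi≤r) , (b≤yi , yi≤t)) , ((l≤xj , xj≤r) , (b≤yj , yj≤t)) , empty) =
    i≢j , λ k ((x₁ , x₂) , (y₁ , y₂)) → outside k
      ((below left (x i) (x j) (x k) l≤xi l≤xj x₁ , above right (x i) (x j) (x k) xi≤r xj≤r x₂) ,
       (below bottom (y i) (y j) (y k) b≤yi b≤yj y₁ , above top (y i) (y j) (y k) yi≤t yj≤t y₂))
    where
    open Rectangle R
    below : ∀ l a b k → l ≤ℝ fromℕ a → l ≤ℝ fromℕ b → a ⊓ b ≤ k → l ≤ℝ fromℕ k
    below l a b k l≤a l≤b ≤k with ℕₚ.⊓-sel a b
    ... | inj₁ eq = ≤ℝ-trans l (fromℕ a) (fromℕ k) l≤a (fromℕ-mono-≤ a k (subst (_≤ k) eq ≤k))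
    ... | inj₂ eq = ≤ℝ-trans l (fromℕ b) (fromℕ k) l≤b (fromℕ-mono-≤ b k (subst (_≤ k) eq ≤k))
    above : ∀ r a b k → fromℕ a ≤ℝ r → fromℕ b ≤ℝ r → k ≤ a ⊔ b → fromℕ k ≤ℝ r
    above r a b k a≤r b≤r k≤ with ℕₚ.⊔-sel a b
    ... | inj₁ eq = ≤ℝ-trans (fromℕ k) (fromℕ a) r (fromℕ-mono-≤ k a (subst (k ≤_) eq k≤)) a≤r
    ... | inj₂ eq = ≤ℝ-trans (fromℕ k) (fromℕ b) r (fromℕ-mono-≤ k b (subst (k ≤_) eq k≤)) b≤r
    outside : ∀ k → PointSet.point points k ∈ᴿ R → k ≡ i ⊎ k ≡ j
    outside k k∈R with k Finₚ.≟ i | k Finₚ.≟ j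
    ... | yes k≡i | _       = inj₁ k≡i
    ... | no _    | yes k≡j = inj₂ k≡j
    ... | no k≢i  | no k≢j  = ⊥-elim (empty k k≢i k≢j k∈R)

  ~-dec : ∀ i j → Dec (i ~ j)
  ~-dec i j = map′ emptyBox⇒~ ~⇒emptyBox (emptyBox? i j)

  cover⇒~ : ∀ {i j} → Cover P i j → i ~ j
  cover⇒~ {i} {j} (xi<xj , yi<yj , cover) = emptyBox⇒~
    ( (λ { refl → ℕₚ.<-irrefl refl xi<xj })
    , λ k ((x₁ , x₂) , (y₁ , y₂)) → cover k
        (subst (_≤ x k) (ℕₚ.m≤n⇒m⊓n≡m (ℕₚ.<⇒≤ xi<xj)) x₁) (subst (x k ≤_) (ℕₚ.m≤n⇒m⊔n≡n (ℕₚ.<⇒≤ xi<xj)) x₂)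
        (subst (_≤ y k) (ℕₚ.m≤n⇒m⊓n≡m (ℕₚ.<⇒≤ yi<yj)) y₁) (subst (y k ≤_) (ℕₚ.m≤n⇒m⊔n≡n (ℕₚ.<⇒≤ yi<yj)) y₂))

  independent⇒coverFree : ∀ A → Independent (boxDelaunay points) A → CoverFree P A
  independent⇒coverFree A ind i∈ j∈ i⋖j =
    ind (Vecₚ.lookup⇒[]= _ A i∈) (Vecₚ.lookup⇒[]= _ A j∈) (cover⇒~ i⋖j)

-- Existence of the independence and chromatic numbers.

least : ∀ {ℓ} {D : ℕ → Set ℓ} → (∀ k → Dec (D k)) → ∀ n → D n →
  ∃ λ m → D m × (∀ k → D k → m ≤ k)
least D? n Dn with D? 0
least D? n       Dn | yes D0 = 0 , D0 , λ _ _ → z≤n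
least D? zero    Dn | no ¬D0 = ⊥-elim (¬D0 Dn)
least D? (suc n) Dn | no ¬D0 with least (D? ∘ suc) n Dn
... | m , Dm , m≤ = suc m , Dm , λ { zero D0 → ⊥-elim (¬D0 D0) ; (suc k) Dk → s≤s (m≤ k Dk) }

greatest : ∀ {ℓ} {D : ℕ → Set ℓ} → (∀ k → Dec (D k)) → D 0 → ∀ n → (∀ k → D k → k ≤ n) →
  ∃ λ m → D m × (∀ k → D k → k ≤ m)
greatest D? D0 n ≤n with D? n
greatest D? D0 n       ≤n | yes Dn = n , Dn , ≤n
greatest D? D0 zero    ≤n | no ¬Dn = ⊥-elim (¬Dn D0)
greatest D? D0 (suc n) ≤n | no ¬Dn = greatest D? D0 n λ k Dk →
  ℕₚ.≤-pred (ℕₚ.≤∧≢⇒< (≤n k Dk) λ { refl → ¬Dn Dk })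

module _ {n : ℕ} {ℓ : Level} (G : Graph n ℓ) where
  open Graph G

  module _ (_~?_ : ∀ i j → Dec (i ~ j)) where

    independent? : ∀ S → Dec (Independent G S)
    independent? S = map′ (λ f {i} {j} → f i j) (λ f i j → f {i} {j})
      (Finₚ.all? λ i → Finₚ.all? λ j →
        (i Subsetₚ.∈? S) →-dec ((j Subsetₚ.∈? S) →-dec ¬? (i ~? j)))

    independenceNumber : ∃ (IsIndependenceNumber G)
    independenceNumber with greatest
      (λ k → Subsetₚ.anySubset? λ S → independent? S ×-dec (∣ S ∣ ℕₚ.≟ k))
      (∅ , (λ i∈ → ⊥-elim (Subsetₚ.∉⊥ i∈)) , Subsetₚ.∣⊥∣≡0 n)
      n (λ { k (S , _ , refl) → Subsetₚ.∣p∣≤n S })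
    ... | α , S , max = α , S , λ S ind → max ∣ S ∣ (S , ind , refl)

    proper? : ∀ {k} (c : Fin n → Fin k) → Dec (∀ i j → i ~ j → c i ≢ c j)
    proper? c = Finₚ.all? λ i → Finₚ.all? λ j → (i ~? j) →-dec ¬? (c i Finₚ.≟ c j)

    -- The colourings are searched through their codes in `Fin (k ^ n)`. A decoded colouring agrees
    -- pointwise with the original one, which is all that properness depends on.
    colorable? : ∀ k → Dec (Colorable G k)
    colorable? k = map′
      (λ (c , proper) → finToFun {k} {n} c , λ {i} {j} → proper i j)
      (λ (c , proper) → funToFin c , λ i j i~j eq → proper i~j
        (trans (sym (Finₚ.finToFun-funToFin c _)) (trans eq (Finₚ.finToFun-funToFin c _))))
      (Finₚ.any? λ c → proper? (finToFun {k} {n} c))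

    chromaticNumber : ∃ (IsChromaticNumber G)
    chromaticNumber = least colorable? n ((λ i → i) , λ { i~j refl → ~-irrefl i~j })

  α-pos : ∀ {α} → Fin n → IsIndependenceNumber G α → 1 ≤ α
  α-pos i (_ , max) = subst (_≤ _) (Subsetₚ.∣⁅x⁆∣≡1 i) (max ⁅ i ⁆ λ {j} {k} j∈ k∈ j~k →
    ~-irrefl (subst (_~ k) (trans (Subsetₚ.x∈⁅y⁆⇒x≡y i j∈) (sym (Subsetₚ.x∈⁅y⁆⇒x≡y i k∈))) j~k))

-- Colour classes and the final bounds.

class : ∀ {n k} → (Fin n → Fin k) → Fin k → Subset n
class c r = tabulate λ i → does (c i Finₚ.≟ r)

sum-const-0 : ∀ k → sum {k} (λ _ → 0) ≡ 0
sum-const-0 zero    = refl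
sum-const-0 (suc k) = sum-const-0 k

sum-indicator : ∀ {k} (j : Fin k) → sum (λ r → if does (j Finₚ.≟ r) then 1 else 0) ≡ 1
sum-indicator {suc k} zero    = cong suc (sum-const-0 k)
sum-indicator {suc k} (suc j) = sum-indicator j

∣∷∣ : ∀ {n} b (A : Subset n) → ∣ b ∷ A ∣ ≡ (if b then 1 else 0) + ∣ A ∣
∣∷∣ true  A = refl
∣∷∣ false A = refl

sum-class : ∀ {n k} (c : Fin n → Fin k) → sum (λ r → ∣ class c r ∣) ≡ n
sum-class {zero}  {k} c = sum-const-0 k
sum-class {suc n} c = trans
  (sum-cong-≗ λ r → ∣∷∣ (does (c zero Finₚ.≟ r)) (class (c ∘ suc) r))
  (trans (∑-distrib-+ (λ r → if does (c zero Finₚ.≟ r) then 1 else 0) (λ r → ∣ class (c ∘ suc) r ∣))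
    (cong₂ _+_ (sum-indicator (c zero)) (sum-class (c ∘ suc))))

sum-bound : ∀ {k a} (f : Fin k → ℕ) → (∀ r → f r ≤ a) → sum f ≤ k * a
sum-bound {zero}  f f≤a = z≤n
sum-bound {suc k} f f≤a = ℕₚ.+-mono-≤ (f≤a zero) (sum-bound (f ∘ suc) (f≤a ∘ suc))

-- The colour classes are independent and partition the points.
n≤χα : ∀ {n ℓ} (G : Graph n ℓ) {α χ} → IsIndependenceNumber G α → Colorable G χ → n ≤ χ * α
n≤χα {n} G {α} {χ} (_ , max) (c , proper) = subst (_≤ χ * α) (sum-class c)
  (sum-bound (λ r → ∣ class c r ∣) λ r → max (class c r) λ i∈ j∈ i~j →
    proper i~j (trans (∈-class r i∈) (sym (∈-class r j∈))))
  where
  ∈-class : ∀ r {i} → i ∈ class c r → c i ≡ r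
  ∈-class r {i} i∈ with c i Finₚ.≟ r | trans (sym (Vecₚ.lookup∘tabulate (λ i → does (c i Finₚ.≟ r)) i)) (Vecₚ.[]=⇒lookup i∈)
  ... | yes ci≡r | _ = ci≡r
  ... | no _     | ()

χ-power : ∀ e t {n α χ} → 1 ≤ α → n ≤ χ * α → α ^ e * 2 ^ t ≤ n ^ e → 2 ^ t ≤ χ ^ e
χ-power e t {n} {α} {χ} 1≤α n≤χα h = ℕₚ.*-cancelˡ-≤ (α ^ e) {{ℕₚ.m^n≢0 α e {{>-nonZero 1≤α}}}} (begin
  α ^ e * 2 ^ t     ≤⟨ h ⟩
  n ^ e                 ≤⟨ ℕₚ.^-monoˡ-≤ e n≤χα ⟩
  (χ * α) ^ e         ≡⟨ ^-distribʳ-* χ α e ⟩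
  χ ^ e * α ^ e     ≡⟨ ℕₚ.*-comm (χ ^ e) (α ^ e) ⟩
  α ^ e * χ ^ e     ∎)
  where open ℕₚ.≤-Reasoning

-- The constant c is 1 / (e + 1). The logarithm enters only as a real `ℓ` that is at most b whenever
-- n ≤ 2^b; this is applied with b = t².
bounds : ∀ e → 14 ≤ suc e → 3 ^ suc e * 2 ^ 12 ≤ 4 ^ suc e →
  ∀ n .{{_ : NonZero n}} (ℓ : ℝ) → (∀ {b r} → n ≤ 2 ^ b → ι b ℚ.< r → ℝ.U ℓ r) →
  ∃ λ (P : PointSet n) → ∃ λ (α : ℕ) → ∃ λ (χ : ℕ) →
    IsIndependenceNumber (boxDelaunay P) α ×
    IsChromaticNumber (boxDelaunay P) χ ×
    fromℕ α ≤ℝ fromℕ n *ℝ 2^ (-ℝ (fromℚ (unit e) *ℝ √ ℓ)) ×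
    2^ (fromℚ (unit e) *ℝ √ ℓ) ≤ℝ fromℕ χ
bounds e 14≤e 3^e≤4^e n ℓ log≤ =
  let 1≤n = ℕ.>-nonZero⁻¹ n
      P , t , n≤2^t² , sparse = sparse-config (suc e) 14≤e 3^e≤4^e n 1≤n
      G = boxDelaunay (points P)
      α , isα = independenceNumber G (~-dec P)
      χ , isχ = chromaticNumber G (~-dec P)
      (S , S-ind , ∣S∣≡α) , _ = isα
      1≤α = α-pos G (fromℕ< 1≤n) isα
      α-small = subst (λ a → a ^ suc e * 2 ^ t ≤ n ^ suc e) ∣S∣≡α
        (sparse S (independent⇒coverFree P S S-ind))
      ℓ-upper = λ {q} t²<q → log≤ {t * t} {q} n≤2^t² (subst (ℚ._< q) (sym (ι-* t t)) t²<q)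
  in points P , α , χ , isα , isχ ,
     ≤n2^- {unit e} (unit-pos e) e t (unit-* e t) ℓ ℓ-upper {n} {α} 1≤n 1≤α α-small ,
     2^≤ {unit e} (unit-pos e) e t (unit-* e t) ℓ ℓ-upper {χ} (χ-power (suc e) t {n} {α} {χ} 1≤α (n≤χα G isα (proj₁ isχ)) α-small)


theorem1 : ∃ λ (c : ℝ) → 0ℝ <ℝ c ×
    (∀ (n : ℕ) .{{_ : NonZero n}} → ∃ λ (P : PointSet n) → ∃ λ (α : ℕ) → ∃ λ (χ : ℕ) →
    IsIndependenceNumber (boxDelaunay P) α ×
    IsChromaticNumber (boxDelaunay P) χ ×
    fromℕ α ≤ℝ fromℕ n *ℝ 2^ (-ℝ (c *ℝ √ (log₂ n))) ×
    2^ (c *ℝ √ (log₂ n)) ≤ℝ fromℕ χ)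
-- The constant is c = 1/32: the exponent 32 exceeds 14, and 3^32 · 2^12 ≤ 4^32 is checked by
-- evaluation.
theorem1 = fromℚ (unit 31) , ℚₚ.<-dense (unit-pos 31) ,
  λ n {{n≢0}} → bounds 31 (ℕₚ.m≤m+n 14 18) (toWitness {a? = 3 ^ 32 * 2 ^ 12 ≤? 4 ^ 32} _)
    n {{n≢0}} (log₂ n {{n≢0}}) (λ {b} {r} → log₂-upper n {{n≢0}} {b} {r})
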